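{- Let $A(n)$ be defined by $$\sum_{n=0}^{\infty}A(n)q^n=\frac{1}{(-q;q)_\infty(-q^2;q^2)_\infty}=(q;q^2)_\infty(q^2;q^4)_\infty ,$$ equivalently $A(n)=a_e(n)-a_o(n)$, where $a_e(n)$ (resp. $a_o(n)$) is the number of partitions of $n$ into an even (resp. odd) number of parts in which the even parts may appear in two colours. Then, as formal power series in $q$ (or for $|q|<1$), $$\sum_{n=0}^{\infty}A(3n)q^n=\frac{\chi(-q)\psi(q^3)\varphi(-q^3)}{\psi(-q)\psi(q^2)},\qquad \sum_{n=0}^{\infty}A(3n+1)q^n=-\frac{\psi^2(q^3)\chi^2(-q)}{\psi(-q)\psi(q^2)},$$ $$\sum_{n=0}^{\infty}A(3n+2)q^n=-\frac{\psi(-q^3)\psi(q^6)}{\psi^2(q^2)},\qquad \sum_{n=1}^{\infty}A(9n+5)q^n=-3q\,\frac{(q;q)_\infty(q^2;q^2)_\infty^4(q^{12};q^{12})_\infty^6}{(q^4;q^4)_\infty^{11}}.$$ Furthermore, for all $n\ge 0$, $$A(3n+2)\equiv -A(27n+17)\pmod 3,\qquad A(81n+44)\equiv 0\pmod 3.$$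
   Context: For complex $a$ and $|q|<1$, $(a;q)_\infty=\prod_{k\ge0}(1-aq^k)$. Ramanujan's theta functions: $\varphi(q)=\sum_{k=-\infty}^{\infty}q^{k^2}=(-q;q^2)_\infty^2(q^2;q^2)_\infty$, $\psi(q)=\sum_{k=-\infty}^{\infty}q^{2k^2+k}=\frac{(q^2;q^2)_\infty}{(q;q^2)_\infty}$, and $\chi(q)=(-q;q^2)_\infty$. -}

module Defs where

open import Data.Nat as ℕ using (ℕ; zero; suc; NonZero)
import Data.Nat.DivMod as ND
open import Data.Integer as ℤ using (ℤ; +_; -[1+_]; 0ℤ; 1ℤ; _+_; _*_; -_)
open import Data.List using (List; []; _∷_; map; upTo; foldr; filter; length; _++_)
open import Data.Bool using (Bool; true; false; if_then_else_)
open import Relation.Nullary.Decidable using (⌊_⌋)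

-- Formal power series over ℤ, represented by their coefficient functions.
PS : Set
PS = ℕ → ℤ

sumℤ : List ℤ → ℤ
sumℤ = foldr _+_ 0ℤ

one : PS
one zero    = 1ℤ
one (suc _) = 0ℤ

qs : PS
qs n = if ⌊ n ℕ.≟ 1 ⌋ then 1ℤ else 0ℤ

scale : ℤ → PS → PS
scale c f n = c * f n

negPS : PS → PS
negPS f n = - f n

_⊛_ : PS → PS → PS
(f ⊛ g) n = sumℤ (map (λ k → f k * g (n ℕ.∸ k)) (upTo (suc n)))
infixl 7 _⊛_

pow : PS → ℕ → PS
pow f zero    = one
pow f (suc k) = f ⊛ pow f k

-- multiplicative inverse of a series with constant term 1:
-- b 0 = 1, b (n+1) = - Σ_{j=0}^{n} f (j+1) * b (n - j).
-- invRev f n = [b n, b (n-1), ..., b 0]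
private
  go : PS → ℕ → List ℤ → ℤ
  go f j []       = 0ℤ
  go f j (x ∷ xs) = f (suc j) * x + go f (suc j) xs

invRev : PS → ℕ → List ℤ
invRev f zero    = 1ℤ ∷ []
invRev f (suc n) = let v = invRev f n in (- go f 0 v) ∷ v

inv : PS → PS
inv f n with invRev f n
... | []    = 0ℤ
... | b ∷ _ = b

_⊘_ : PS → PS → PS
f ⊘ g = f ⊛ inv g
infixl 7 _⊘_

factor : ℤ → ℕ → PS
factor c e n = one n + - (if ⌊ n ℕ.≟ e ⌋ then c else 0ℤ)

finProd : ℤ → ℕ → ℕ → ℕ → PS
finProd c a b zero    = one
finProd c a b (suc k) = finProd c a b k ⊛ factor c (a ℕ.+ b ℕ.* k)

-- (c q^a ; q^b)_∞ = ∏_{k≥0} (1 - c q^(a+bk)), for a, b ≥ 1.  The coefficient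
-- of q^n only involves the factors with k ≤ n (since a + b k ≥ k + 1), so it
-- equals the coefficient of q^n in the finite product over k < n+1.
pochC : ℤ → (a b : ℕ) → .{{NonZero a}} → .{{NonZero b}} → PS
pochC c a b n = finProd c a b (suc n) n

poch : (a b : ℕ) → .{{NonZero a}} → .{{NonZero b}} → PS
poch a b = pochC 1ℤ a b

poch⁻ : (a b : ℕ) → .{{NonZero a}} → .{{NonZero b}} → PS
poch⁻ a b = pochC (- 1ℤ) a b

-- substitution q ↦ q^m (neg = false) or q ↦ -q^m (neg = true)
sign : Bool → ℕ → ℤ
sign false k       = 1ℤ
sign true  zero    = 1ℤ
sign true  (suc k) = - sign true k

subst : Bool → (m : ℕ) → .{{NonZero m}} → PS → PS
subst neg m f n =
  if ⌊ (n ND.% m) ℕ.≟ 0 ⌋ then sign neg (n ND./ m) * f (n ND./ m) else 0ℤ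

intRange : ℕ → List ℤ
intRange n = map +_ (upTo (suc n)) ++ map -[1+_] (upTo n)

-- φ(q) = Σ_{k∈ℤ} q^(k²): coefficient of q^n is #{k ∈ ℤ : k² = n}
-- (all such k satisfy |k| ≤ n)
φ : PS
φ n = + length (filter (λ k → k * k ℤ.≟ + n) (intRange n))

-- ψ(q) = Σ_{k∈ℤ} q^(2k²+k): coefficient of q^n is #{k ∈ ℤ : 2k²+k = n}
-- (all such k satisfy |k| ≤ n)
ψ : PS
ψ n = + length (filter (λ k → + 2 * k * k + k ℤ.≟ + n) (intRange n))

χ : PS
χ = poch⁻ 1 2

A : ℕ → ℤ
A = inv (poch⁻ 1 1 ⊛ poch⁻ 2 2)

A9 : PS
A9 zero    = 0ℤ
A9 (suc m) = A (9 ℕ.* suc m ℕ.+ 5)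

{-# OPTIONS --safe #-}

-- Write f_k for (q^k;q^k)∞, so that ∑ A(n) qⁿ = f₁/f₄ = ψ(-q)/ψ(q²).  Sorting the exponents of a theta
-- series modulo 3 gives ψ(q) = P(q³) + q ψ(q⁹) with P(q) = f(q,q²), and hence trisections of ψ(-q) and
-- ψ(q²).  Comparing the two, the trisection of the quotient is equivalent to three relations between
-- eta quotients of level 12.  One of them is trivial; the others are multiples of
--     f(q,q⁵) φ(-q³) = f(-q⁴,-q⁸)² + q f(-q²,-q¹⁰)²
-- and of its image under q ↦ -q, which come from the change of variables (k,l) = (s+t,s-t) in the
-- double series on the left; the Jacobi triple product turns all these theta functions into eta quotients.
-- The same relations evaluate the norm P(q²)³ + q² ψ(q⁶)³ = ψ(q²)⁴/ψ(q⁶), hence trisect 1/ψ(q²)² and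
-- give A(9n+5).  Modulo 3, ψ(q²)³ ≡ ψ(q⁶) reduces ∑ A(3n+2) qⁿ to -ψ(-q³)ψ(q²), which is trisected twice.
--
-- The triple product is the limit of the q-binomial theorem for ∏_{k<2n} (q^(dn) + s q^(α+dk)), d = α+β,
-- after cancelling a monomial.  Limits are taken coefficientwise: f ≈[ m ] g means equality modulo q^m.

module Submission where

open import Defs
open import Data.Nat using (ℕ; zero; suc; _*_; _+_; _∸_; _≤_; _<_; z≤n; s≤s; NonZero)
import Data.Nat as ℕ
import Data.Nat.DivMod as ℕ
import Data.Nat.Properties as ℕ
import Data.Nat.Tactic.RingSolver as ℕ-solver
open import Data.Integer using (ℤ; +_; -[1+_]; -_; _-_; 0ℤ; 1ℤ) renaming (_+_ to _+ᶻ_; _*_ to _*ᶻ_)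
import Data.Integer as ℤ
import Data.Integer.Properties as ℤ
import Data.Integer.Tactic.RingSolver as ℤ-solver
open import Data.Integer.Divisibility using (_∣_)
import Data.Integer.Divisibility.Signed as Signed
open import Data.List using (List; []; _∷_; _++_; map; upTo; applyUpTo; filter; length)
import Data.List.Properties as List
open import Data.Vec using (Vec; []; _∷_; zipWith)
import Data.Vec as Vec
open import Data.Bool using (Bool; true; false; not; if_then_else_)
open import Data.Maybe using (Maybe; just; nothing)
open import Data.Product using (Σ; _×_; _,_; proj₁; proj₂)
open import Data.Empty using (⊥-elim)
open import Data.Unit using (⊤; tt)
open import Function using (_∘_; id)
open import Relation.Nullary using (yes; no)
open import Relation.Nullary.Decidable using (⌊_⌋; isYes≗does)
open import Relation.Binary using (Setoid)
open import Relation.Binary.PropositionalEquality using (_≡_; _≢_; refl; sym; trans; cong; cong₂; module ≡-Reasoning)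
import Relation.Binary.Reasoning.Setoid as SetoidReasoning
open import Algebra.Bundles using (CommutativeRing)
open import Algebra.Structures using (IsCommutativeRing)
import Algebra.Solver.Ring
import Algebra.Solver.Ring.AlmostCommutativeRing as ACR

-- The ring of formal power series

-- Beyond the sorting of exponents in theta series, the only additive facts are `lattice⁺` and
-- `lattice⁻`. Every other relation between sums (`relation₀`, `relation₁`, the bracket in `norm-η`)
-- is one of these two times a single eta quotient, written as a local vector `v` and found by
-- dividing one term of the target by the matching term of the lattice identity. Purely
-- multiplicative identities are comparisons of integer vectors, left to computation. The trisection
-- of A is not obtained by inverting ψ(q²). The three claimed parts are assembled into one series,
-- multiplied by ψ(q²) and compared with ψ(-q) in each class modulo 3; a monic factor can then be
-- cancelled. Only A(9n+5) needs an actual inverse, and the norm supplies it. The coefficient 3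
-- there is the middle one of (1 - x + x²)² = 1 - 2x + 3x² - 2x³ + x⁴. Series have no negative
-- exponents. This is why the q-binomial theorem appears in homogeneous form, with q^(dn) in place
-- of 1, and why the monomial is cancelled by comparing shifted coefficients.

infix 4 _≈_

-- Series are functions, so equality is taken coefficientwise. A record, unlike the bare function
-- type, lets unification recover `f` and `g` from a proof.
record _≈_ (f g : PS) : Set where
  constructor pointwise
  field at : ∀ n → f n ≡ g n
open _≈_

𝟘 : PS
𝟘 _ = 0ℤ

-- Sealed: series are functions, so the unifier would otherwise unfold products into coefficient sums.
opaque
  infixl 6 _⊕_
  infixl 7 _·_
  infixr 9 _•_
  infixr 8 ⊝_

  _⊕_ : PS → PS → PS
  (f ⊕ g) n = f n +ᶻ g n

  ⊝_ : PS → PS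
  ⊝_ = negPS

  _·_ : PS → PS → PS
  _·_ = _⊛_

  _•_ : ℤ → PS → PS
  _•_ = scale

  ⊕-at : ∀ f g n → (f ⊕ g) n ≡ f n +ᶻ g n
  ⊕-at f g n = refl

  ⊝-at : ∀ f n → (⊝ f) n ≡ - f n
  ⊝-at f n = refl

  •-at : ∀ c f n → (c • f) n ≡ c *ᶻ f n
  •-at c f n = refl

  ·-at : ∀ f g n → (f · g) n ≡ (f ⊛ g) n
  ·-at f g n = refl

tail : PS → PS
tail f n = f (suc n)

sumℤ-applyUpTo : (h : ℕ → ℤ) (g : ℕ → ℕ) (n : ℕ) → sumℤ (map h (applyUpTo g n)) ≡ sumℤ (applyUpTo (h ∘ g) n)
sumℤ-applyUpTo h g zero    = refl
sumℤ-applyUpTo h g (suc n) = cong (h (g 0) +ᶻ_) (sumℤ-applyUpTo h (g ∘ suc) n)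

⊛-zero : ∀ f g → (f ⊛ g) 0 ≡ f 0 *ᶻ g 0
⊛-zero f g = ℤ.+-identityʳ _

-- This is fg = f(0)g + q·tail(f)·g, read off at q^(n+1). It replaces list sums by recursion on the
-- degree, and the ring laws below are inductions along it.
⊛-suc : ∀ f g n → (f ⊛ g) (suc n) ≡ f 0 *ᶻ g (suc n) +ᶻ (tail f ⊛ g) n
⊛-suc f g n = cong (f 0 *ᶻ g (suc n) +ᶻ_)
  (trans (sumℤ-applyUpTo (λ k → f k *ᶻ g (suc n ∸ k)) suc (suc n))
    (sym (sumℤ-applyUpTo (λ k → f (suc k) *ᶻ g (n ∸ k)) id (suc n))))

-- Only coefficients up to n are compared, so the same lemma serves exact equality and congruence
-- modulo a power of q.
⊛-cong-at : ∀ {f f′ g g′} n → (∀ k → k ≤ n → f k ≡ f′ k) → (∀ k → k ≤ n → g k ≡ g′ k) → (f ⊛ g) n ≡ (f′ ⊛ g′) n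
⊛-cong-at {f} {f′} {g} {g′} zero p q =
  trans (⊛-zero f g) (trans (cong₂ _*ᶻ_ (p 0 z≤n) (q 0 z≤n)) (sym (⊛-zero f′ g′)))
⊛-cong-at {f} {f′} {g} {g′} (suc n) p q =
  trans (⊛-suc f g n) (trans
    (cong₂ _+ᶻ_ (cong₂ _*ᶻ_ (p 0 z≤n) (q (suc n) ℕ.≤-refl))
      (⊛-cong-at n (λ k k≤n → p (suc k) (s≤s k≤n)) (λ k k≤n → q k (ℕ.m≤n⇒m≤1+n k≤n))))
    (sym (⊛-suc f′ g′ n)))

⊛-distribʳ-at : ∀ n f g h → ((λ k → f k +ᶻ g k) ⊛ h) n ≡ (f ⊛ h) n +ᶻ (g ⊛ h) n
⊛-distribʳ-at zero f g h rewrite ⊛-zero (λ k → f k +ᶻ g k) h | ⊛-zero f h | ⊛-zero g h = ℤ.*-distribʳ-+ (h 0) (f 0) (g 0)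
⊛-distribʳ-at (suc n) f g h
  rewrite ⊛-suc (λ k → f k +ᶻ g k) h n | ⊛-suc f h n | ⊛-suc g h n | ⊛-distribʳ-at n (tail f) (tail g) h =
  lemma (f 0) (g 0) (h (suc n)) _ _
  where
  lemma : ∀ a b c x y → (a +ᶻ b) *ᶻ c +ᶻ (x +ᶻ y) ≡ (a *ᶻ c +ᶻ x) +ᶻ (b *ᶻ c +ᶻ y)
  lemma = ℤ-solver.solve-∀

scale-⊛-at : ∀ n c f g → (scale c f ⊛ g) n ≡ c *ᶻ (f ⊛ g) n
scale-⊛-at zero c f g rewrite ⊛-zero (scale c f) g | ⊛-zero f g = ℤ.*-assoc c (f 0) (g 0)
scale-⊛-at (suc n) c f g
  rewrite ⊛-suc (scale c f) g n | ⊛-suc f g n | scale-⊛-at n c (tail f) g =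
  lemma c (f 0) (g (suc n)) _
  where
  lemma : ∀ c a b x → c *ᶻ a *ᶻ b +ᶻ c *ᶻ x ≡ c *ᶻ (a *ᶻ b +ᶻ x)
  lemma = ℤ-solver.solve-∀

⊛-assoc-at : ∀ n f g h → ((f ⊛ g) ⊛ h) n ≡ (f ⊛ (g ⊛ h)) n
⊛-assoc-at zero f g h
  rewrite ⊛-zero (f ⊛ g) h | ⊛-zero f g | ⊛-zero f (g ⊛ h) | ⊛-zero g h = ℤ.*-assoc (f 0) (g 0) (h 0)
⊛-assoc-at (suc n) f g h = begin
  ((f ⊛ g) ⊛ h) (suc n)
    ≡⟨ ⊛-suc (f ⊛ g) h n ⟩
  (f ⊛ g) 0 *ᶻ h (suc n) +ᶻ (tail (f ⊛ g) ⊛ h) n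
    -- By `⊛-suc` the tail of f ⊛ g is f(0)·tail g + tail f ⊛ g, which brings the product with h
    -- within reach of distributivity and induction.
    ≡⟨ cong₂ _+ᶻ_ (cong (ℤ._* h (suc n)) (⊛-zero f g))
         (⊛-cong-at {g = h} n (λ k _ → ⊛-suc f g k) (λ _ _ → refl)) ⟩
  f 0 *ᶻ g 0 *ᶻ h (suc n) +ᶻ ((λ k → scale (f 0) (tail g) k +ᶻ (tail f ⊛ g) k) ⊛ h) n
    ≡⟨ cong (f 0 *ᶻ g 0 *ᶻ h (suc n) +ᶻ_) (trans (⊛-distribʳ-at n (scale (f 0) (tail g)) (tail f ⊛ g) h)
         (cong₂ _+ᶻ_ (scale-⊛-at n (f 0) (tail g) h) (⊛-assoc-at n (tail f) g h))) ⟩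
  f 0 *ᶻ g 0 *ᶻ h (suc n) +ᶻ (f 0 *ᶻ (tail g ⊛ h) n +ᶻ (tail f ⊛ (g ⊛ h)) n)
    ≡⟨ lemma (f 0) (g 0) (h (suc n)) _ _ ⟩
  f 0 *ᶻ (g 0 *ᶻ h (suc n) +ᶻ (tail g ⊛ h) n) +ᶻ (tail f ⊛ (g ⊛ h)) n
    ≡⟨ cong (λ z → f 0 *ᶻ z +ᶻ (tail f ⊛ (g ⊛ h)) n) (⊛-suc g h n) ⟨
  f 0 *ᶻ (g ⊛ h) (suc n) +ᶻ (tail f ⊛ (g ⊛ h)) n
    ≡⟨ ⊛-suc f (g ⊛ h) n ⟨
  (f ⊛ (g ⊛ h)) (suc n) ∎
  where
  open ≡-Reasoning
  lemma : ∀ a b c x y → a *ᶻ b *ᶻ c +ᶻ (a *ᶻ x +ᶻ y) ≡ a *ᶻ (b *ᶻ c +ᶻ x) +ᶻ y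
  lemma = ℤ-solver.solve-∀

-- The mirror image of `⊛-suc`, peeling the second factor; the two recursions together give
-- commutativity.
⊛-sucʳ : ∀ n f g → (f ⊛ g) (suc n) ≡ f (suc n) *ᶻ g 0 +ᶻ (f ⊛ tail g) n
⊛-sucʳ zero f g
  rewrite ⊛-suc f g 0 | ⊛-zero (tail f) g | ⊛-zero f (tail g) = ℤ.+-comm (f 0 *ᶻ g 1) (f 1 *ᶻ g 0)
⊛-sucʳ (suc n) f g
  rewrite ⊛-suc f g (suc n) | ⊛-sucʳ n (tail f) g | ⊛-suc f (tail g) n =
  lemma (f 0 *ᶻ g (suc (suc n))) (f (suc (suc n)) *ᶻ g 0) _
  where
  lemma : ∀ a b x → a +ᶻ (b +ᶻ x) ≡ b +ᶻ (a +ᶻ x)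
  lemma = ℤ-solver.solve-∀

⊛-comm-at : ∀ n f g → (f ⊛ g) n ≡ (g ⊛ f) n
⊛-comm-at zero f g rewrite ⊛-zero f g | ⊛-zero g f = ℤ.*-comm (f 0) (g 0)
⊛-comm-at (suc n) f g rewrite ⊛-suc f g n | ⊛-sucʳ n g f | ⊛-comm-at n (tail f) g =
  cong (ℤ._+ (g ⊛ tail f) n) (ℤ.*-comm (f 0) (g (suc n)))

𝟘-⊛-at : ∀ n f → (𝟘 ⊛ f) n ≡ 0ℤ
𝟘-⊛-at zero f = refl
𝟘-⊛-at (suc n) f rewrite ⊛-suc 𝟘 f n | 𝟘-⊛-at n f = refl

one-⊛-at : ∀ n f → (one ⊛ f) n ≡ f n
one-⊛-at zero f rewrite ⊛-zero one f = ℤ.*-identityˡ (f 0)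
one-⊛-at (suc n) f rewrite ⊛-suc one f n | 𝟘-⊛-at n f = trans (ℤ.+-identityʳ _) (ℤ.*-identityˡ (f (suc n)))

opaque
  unfolding _⊕_

  PS-isCommutativeRing : IsCommutativeRing _≈_ _⊕_ _·_ ⊝_ 𝟘 one
  PS-isCommutativeRing = record
    { isRing = record
        { +-isAbelianGroup = record
          { isGroup = record
            { isMonoid = record
              { isSemigroup = record
                { isMagma = record
                  { isEquivalence = record
                    { refl = pointwise λ _ → refl
                    ; sym = λ p → pointwise λ n → sym (at p n)
                    ; trans = λ p q → pointwise λ n → trans (at p n) (at q n) }
                  ; ∙-cong = λ p q → pointwise λ n → cong₂ _+ᶻ_ (at p n) (at q n) }
                ; assoc = λ f g h → pointwise λ n → ℤ.+-assoc (f n) (g n) (h n) }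
              ; identity = (λ f → pointwise λ n → ℤ.+-identityˡ (f n)) , (λ f → pointwise λ n → ℤ.+-identityʳ (f n)) }
            ; inverse = (λ f → pointwise λ n → ℤ.+-inverseˡ (f n)) , (λ f → pointwise λ n → ℤ.+-inverseʳ (f n))
            ; ⁻¹-cong = λ p → pointwise λ n → cong -_ (at p n) }
          ; comm = λ f g → pointwise λ n → ℤ.+-comm (f n) (g n) }
        ; *-cong = λ p q → pointwise λ n → ⊛-cong-at n (λ k _ → at p k) (λ k _ → at q k)
        ; *-assoc = λ f g h → pointwise λ n → ⊛-assoc-at n f g h
        ; *-identity = (λ f → pointwise λ n → one-⊛-at n f) ,
                       (λ f → pointwise λ n → trans (⊛-comm-at n f one) (one-⊛-at n f))
        ; distrib = (λ h f g → pointwise λ n → trans (⊛-comm-at n h (f ⊕ g))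
                      (trans (⊛-distribʳ-at n f g h) (cong₂ _+ᶻ_ (⊛-comm-at n f h) (⊛-comm-at n g h)))) ,
                    (λ h f g → pointwise λ n → ⊛-distribʳ-at n f g h) }
      ; *-comm = λ f g → pointwise λ n → ⊛-comm-at n f g }

PS-ring : CommutativeRing _ _
PS-ring = record { isCommutativeRing = PS-isCommutativeRing }

open CommutativeRing PS-ring
  using (setoid)
  renaming ( refl to ≈-refl; sym to ≈-sym; trans to ≈-trans; reflexive to ≈-reflexive
           ; +-cong to ⊕-cong; *-cong to ·-cong; +-assoc to ⊕-assoc; *-assoc to ·-assoc
           ; +-comm to ⊕-comm; *-comm to ·-comm; *-identityˡ to ·-identityˡ; *-identityʳ to ·-identityʳ
           ; +-identityˡ to ⊕-identityˡ; +-identityʳ to ⊕-identityʳ; zeroˡ to ·-zeroˡ; zeroʳ to ·-zeroʳ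
           ; distribʳ to ·-distribʳ; distribˡ to ·-distribˡ; -‿cong to ⊝-cong)

module ≈-Reasoning = SetoidReasoning setoid

·-congˡ : ∀ {f g h} → g ≈ h → f · g ≈ f · h
·-congˡ = ·-cong ≈-refl

·-congʳ : ∀ {f g h} → g ≈ h → g · f ≈ h · f
·-congʳ p = ·-cong p ≈-refl

⊕-congˡ : ∀ {f g h} → g ≈ h → f ⊕ g ≈ f ⊕ h
⊕-congˡ = ⊕-cong ≈-refl

⊕-congʳ : ∀ {f g h} → g ≈ h → g ⊕ f ≈ h ⊕ f
⊕-congʳ p = ⊕-cong p ≈-refl

opaque
  unfolding _⊕_

  •-· : ∀ c f g → c • f · g ≈ c • (f · g)
  •-· c f g = pointwise λ n → scale-⊛-at n c f g

  •-cong : ∀ {c d f g} → c ≡ d → f ≈ g → c • f ≈ d • g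
  •-cong {c} refl p = pointwise λ n → cong (c *ᶻ_) (at p n)

  •-• : ∀ c d f → c • (d • f) ≈ (c *ᶻ d) • f
  •-• c d f = pointwise λ n → sym (ℤ.*-assoc c d (f n))

  1-• : ∀ f → 1ℤ • f ≈ f
  1-• f = pointwise λ n → ℤ.*-identityˡ (f n)

  0-• : ∀ f → 0ℤ • f ≈ 𝟘
  0-• f = pointwise λ n → ℤ.*-zeroˡ (f n)

  •-+ : ∀ c d f → (c +ᶻ d) • f ≈ c • f ⊕ d • f
  •-+ c d f = pointwise λ n → ℤ.*-distribʳ-+ (f n) c d

  •-neg : ∀ c f → (- c) • f ≈ ⊝ (c • f)
  •-neg c f = pointwise λ n → sym (ℤ.neg-distribˡ-* c (f n))

-- Clauses for 0 and 1 so that the solver reads its literals 0 and 1 as 𝟘 and one.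
constant : ℤ → PS
constant (+ 0) = 𝟘
constant (+ 1) = one
constant c     = c • one

constant-≈ : ∀ c → constant c ≈ c • one
constant-≈ (+ 0)           = ≈-sym (0-• one)
constant-≈ (+ 1)           = ≈-sym (1-• one)
constant-≈ (+ suc (suc n)) = ≈-refl
constant-≈ -[1+ n ]        = ≈-refl

constant-· : ∀ c f → constant c · f ≈ c • f
constant-· c f = ≈-trans (·-congʳ (constant-≈ c)) (≈-trans (•-· c one f) (•-cong refl (·-identityˡ f)))

PS-almost : ACR.AlmostCommutativeRing _ _
PS-almost = ACR.fromCommutativeRing PS-ring

constant-homo : CommutativeRing.rawRing ℤ.+-*-commutativeRing ACR.-Raw-AlmostCommutative⟶ PS-almost
constant-homo = record
  { ⟦_⟧ = constant
  ; +-homo = λ c d → ≈-trans (constant-≈ (c +ᶻ d))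
      (≈-trans (•-+ c d one) (⊕-cong (≈-sym (constant-≈ c)) (≈-sym (constant-≈ d))))
  ; *-homo = λ c d → ≈-trans (constant-≈ (c *ᶻ d)) (≈-sym (≈-trans (constant-· c (constant d))
      (≈-trans (•-cong refl (constant-≈ d)) (•-• c d one))))
  ; -‿homo = λ c → ≈-trans (constant-≈ (- c)) (≈-trans (•-neg c one) (⊝-cong (≈-sym (constant-≈ c))))
  ; 0-homo = ≈-refl
  ; 1-homo = ≈-refl }

constant-≟ : ∀ c d → Maybe (constant c ≈ constant d)
constant-≟ c d with c ℤ.≟ d
... | yes refl = just ≈-refl
... | no _     = nothing

module Ring-solver = Algebra.Solver.Ring (CommutativeRing.rawRing ℤ.+-*-commutativeRing) PS-almost constant-homo constant-≟
open Ring-solver using (solve; _:+_; _:*_; _:=_; con; :-_; _:^_)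

-- Congruence modulo q^m

infix 4 _≈[_]_

record _≈[_]_ (f : PS) (m : ℕ) (g : PS) : Set where
  constructor truncated
  field below : ∀ n → n < m → f n ≡ g n
open _≈[_]_

≈⇒≈[] : ∀ {f g m} → f ≈ g → f ≈[ m ] g
≈⇒≈[] p = truncated λ n _ → at p n

limit : ∀ {f g} → (∀ m → f ≈[ m ] g) → f ≈ g
limit p = pointwise λ n → below (p (suc n)) n ℕ.≤-refl

≈[]-refl : ∀ {f m} → f ≈[ m ] f
≈[]-refl = truncated λ _ _ → refl

≈[]-sym : ∀ {f g m} → f ≈[ m ] g → g ≈[ m ] f
≈[]-sym p = truncated λ n n<m → sym (below p n n<m)

≈[]-trans : ∀ {f g h m} → f ≈[ m ] g → g ≈[ m ] h → f ≈[ m ] h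
≈[]-trans p q = truncated λ n n<m → trans (below p n n<m) (below q n n<m)

≈[]-weaken : ∀ {f g m n} → n ≤ m → f ≈[ m ] g → f ≈[ n ] g
≈[]-weaken n≤m p = truncated λ k k<n → below p k (ℕ.≤-trans k<n n≤m)

≈[]-setoid : ℕ → Setoid _ _
≈[]-setoid m = record
  { Carrier = PS ; _≈_ = λ f g → f ≈[ m ] g
  ; isEquivalence = record { refl = ≈[]-refl ; sym = ≈[]-sym ; trans = ≈[]-trans } }

module ≈[]-Reasoning (m : ℕ) = SetoidReasoning (≈[]-setoid m)

opaque
  unfolding _⊕_

  ⊕-cong[] : ∀ {f f′ g g′ m} → f ≈[ m ] f′ → g ≈[ m ] g′ → f ⊕ g ≈[ m ] f′ ⊕ g′
  ⊕-cong[] p q = truncated λ n n<m → cong₂ _+ᶻ_ (below p n n<m) (below q n n<m)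

  ·-cong[] : ∀ {f f′ g g′ m} → f ≈[ m ] f′ → g ≈[ m ] g′ → f · g ≈[ m ] f′ · g′
  ·-cong[] p q = truncated λ n n<m → ⊛-cong-at n
    (λ k k≤n → below p k (ℕ.≤-<-trans k≤n n<m)) (λ k k≤n → below q k (ℕ.≤-<-trans k≤n n<m))

  •-cong[] : ∀ {c f g m} → f ≈[ m ] g → c • f ≈[ m ] c • g
  •-cong[] {c} p = truncated λ n n<m → cong (c *ᶻ_) (below p n n<m)

·-vanishʳ : ∀ {f g m} → g ≈[ m ] 𝟘 → f · g ≈[ m ] 𝟘
·-vanishʳ {f} p = ≈[]-trans (·-cong[] ≈[]-refl p) (≈⇒≈[] (·-zeroʳ f))

•-vanish : ∀ {c f m} → f ≈[ m ] 𝟘 → c • f ≈[ m ] 𝟘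
•-vanish {c} {f} p = truncated λ n n<m →
  trans (•-at c f n) (trans (cong (c *ᶻ_) (below p n n<m)) (ℤ.*-zeroʳ c))

·-at-zero : ∀ f g → (f · g) 0 ≡ f 0 *ᶻ g 0
·-at-zero f g = trans (·-at f g 0) (⊛-zero f g)

-- Powers of q

X : ℕ → PS
X e n = if ⌊ n ℕ.≟ e ⌋ then 1ℤ else 0ℤ

shift : PS → PS
shift f zero    = 0ℤ
shift f (suc n) = f n

shift-· : ∀ f g → shift f · g ≈ shift (f · g)
shift-· f g = pointwise λ where
  zero    → ·-at-zero (shift f) g
  (suc n) → trans (·-at (shift f) g (suc n)) (trans (⊛-suc (shift f) g n)
              (trans (ℤ.+-identityˡ _) (sym (·-at f g n))))

shift-cong : ∀ {f g} → f ≈ g → shift f ≈ shift g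
shift-cong p = pointwise λ where
  zero    → refl
  (suc n) → at p n

X-zero : X 0 ≈ one
X-zero = pointwise λ where
  zero    → refl
  (suc n) → refl

X-suc : ∀ e → X (suc e) ≈ shift (X e)
X-suc e = pointwise λ where
  zero    → refl
  (suc n) → cong (if_then 1ℤ else 0ℤ) (trans (isYes≗does (suc n ℕ.≟ suc e)) (sym (isYes≗does (n ℕ.≟ e))))

X-suc-· : ∀ e f → X (suc e) · f ≈ shift (X e · f)
X-suc-· e f = ≈-trans (·-congʳ (X-suc e)) (shift-· (X e) f)

X-+ : ∀ a b → X (a + b) ≈ X a · X b
X-+ zero b = ≈-sym (≈-trans (·-congʳ X-zero) (·-identityˡ (X b)))
X-+ (suc a) b = ≈-trans (X-suc (a + b)) (≈-trans (shift-cong (X-+ a b)) (≈-sym (X-suc-· a (X b))))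

X-·-at : ∀ e f n → (X e · f) (e + n) ≡ f n
X-·-at zero f n = at (≈-trans (·-congʳ X-zero) (·-identityˡ f)) n
X-·-at (suc e) f n = trans (at (X-suc-· e f) (suc e + n)) (X-·-at e f n)

X-vanish : ∀ {m} e → m ≤ e → X e ≈[ m ] 𝟘
X-vanish zero z≤n = truncated λ _ ()
X-vanish (suc e) m≤1+e = truncated λ where
  zero _ → refl
  (suc n) 1+n<m → trans (at (X-suc e) (suc n)) (below (X-vanish e ℕ.≤-refl) n (ℕ.≤-pred (ℕ.≤-trans 1+n<m m≤1+e)))

-- A positive power of q has constant term 0, hence no inverse among these series; cancelling it
-- amounts to reading coefficients e places further on.
X-cancel : ∀ e {f g} → X e · f ≈ X e · g → f ≈ g
X-cancel e {f} {g} p = pointwise λ n →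
  trans (sym (X-·-at e f n)) (trans (at p (e + n)) (X-·-at e g n))

·-• : ∀ c f g → f · c • g ≈ c • (f · g)
·-• c f g = ≈-trans (·-comm f (c • g)) (≈-trans (•-· c g f) (•-cong refl (·-comm g f)))

monomial-· : ∀ c d a b → c • X a · d • X b ≈ (c *ᶻ d) • X (a + b)
monomial-· c d a b = ≈-trans (•-· c (X a) (d • X b))
  (≈-trans (•-cong refl (≈-trans (·-• d (X a) (X b)) (•-cong refl (≈-sym (X-+ a b))))) (•-• c d (X (a + b))))

-- Infinite products

factor-≈ : ∀ c e → factor c e ≈ one ⊕ ⊝ (c • X e)
factor-≈ c e = pointwise λ n → sym (trans (⊕-at one _ n)
  (cong (one n +ᶻ_) (trans (⊝-at _ n) (cong -_ (trans (•-at c (X e) n) (select ⌊ n ℕ.≟ e ⌋))))))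
  where
  select : ∀ b → c *ᶻ (if b then 1ℤ else 0ℤ) ≡ (if b then c else 0ℤ)
  select true  = ℤ.*-identityʳ c
  select false = ℤ.*-zeroʳ c

factor-one : ∀ c e → factor c e ≈[ e ] one
factor-one c e = ≈[]-trans (≈⇒≈[] (factor-≈ c e)) (truncated λ n n<e →
  trans (⊕-at one _ n) (trans (cong (one n +ᶻ_) (trans (⊝-at _ n)
    (cong -_ (below (•-vanish {c} (X-vanish e ℕ.≤-refl)) n n<e)))) (ℤ.+-identityʳ (one n))))

finProd-suc : ∀ c a b k → finProd c a b (suc k) ≈ finProd c a b k · factor c (a + b * k)
finProd-suc c a b k = pointwise λ n → sym (·-at _ _ n)

-- Definitionally `pochC`, but free of its instance arguments, so that the parameters can be open
-- expressions such as k + k.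
P∞ : ℤ → ℕ → ℕ → PS
P∞ c a b n = finProd c a b (suc n) n

index-bound : ∀ {a b} → 1 ≤ a → 1 ≤ b → ∀ k → suc k ≤ a + b * k
index-bound {a} {b} 1≤a 1≤b k =
  ℕ.+-mono-≤ 1≤a (ℕ.≤-trans (ℕ.≤-reflexive (sym (ℕ.*-identityˡ k))) (ℕ.*-monoˡ-≤ k 1≤b))

finProd-stable : ∀ c {a b} → 1 ≤ a → 1 ≤ b → ∀ k n → finProd c a b (k + suc n) n ≡ finProd c a b (suc n) n
finProd-stable c 1≤a 1≤b zero n = refl
finProd-stable c {a} {b} 1≤a 1≤b (suc k) n =
  trans (below step n (ℕ.≤-trans (ℕ.≤-trans (ℕ.m≤n+m (suc n) k) (ℕ.n≤1+n _)) (index-bound 1≤a 1≤b (k + suc n))))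
        (finProd-stable c 1≤a 1≤b k n)
  where
  step : finProd c a b (suc (k + suc n)) ≈[ a + b * (k + suc n) ] finProd c a b (k + suc n)
  step = ≈[]-trans (≈⇒≈[] (finProd-suc c a b _))
    (≈[]-trans (·-cong[] ≈[]-refl (factor-one c _)) (≈⇒≈[] (·-identityʳ _)))

-- The k-th factor is 1 modulo q^(k+1) by `index-bound`. Identities of infinite products are
-- therefore proved for finite ones and carried over by `limit`.
P∞-finProd : ∀ c {a b m N} → 1 ≤ a → 1 ≤ b → m ≤ N → P∞ c a b ≈[ m ] finProd c a b N
P∞-finProd c {a} {b} {m} {N} 1≤a 1≤b m≤N = truncated λ n n<m →
  trans (sym (finProd-stable c 1≤a 1≤b (N ∸ suc n) n))
    (cong (λ K → finProd c a b K n) (ℕ.m∸n+n≡m (ℕ.≤-trans n<m m≤N)))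

-- Defined by recursion so that a product or sum of length `double (suc N)` or `triple (suc N)`
-- unfolds by exactly two or three steps.
double triple : ℕ → ℕ
double zero    = zero
double (suc n) = suc (suc (double n))
triple zero    = zero
triple (suc n) = suc (suc (suc (triple n)))

double-≡ : ∀ n → double n ≡ n + n
double-≡ zero    = refl
double-≡ (suc n) = cong suc (trans (cong suc (double-≡ n)) (sym (ℕ.+-suc n n)))

triple-≡ : ∀ n → triple n ≡ n + n + n
triple-≡ zero    = refl
triple-≡ (suc n) = trans (cong (λ k → suc (suc (suc k))) (triple-≡ n)) (lemma n)
  where
  lemma : ∀ n → suc (suc (suc (n + n + n))) ≡ suc n + suc n + suc n
  lemma = ℕ-solver.solve-∀

≤-double : ∀ n → n ≤ double n
≤-double n = ℕ.≤-trans (ℕ.m≤m+n n n) (ℕ.≤-reflexive (sym (double-≡ n)))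

≤-triple : ∀ n → n ≤ triple n
≤-triple n = ℕ.≤-trans (ℕ.≤-trans (ℕ.m≤m+n n n) (ℕ.m≤m+n (n + n) n)) (ℕ.≤-reflexive (sym (triple-≡ n)))

finProd-split₂ : ∀ c a b N → finProd c a b (double N) ≈ finProd c a (b + b) N · finProd c (a + b) (b + b) N
finProd-split₂ c a b zero = ≈-sym (·-identityˡ one)
finProd-split₂ c a b (suc N) = begin
  finProd c a b (suc (suc (double N)))
    ≈⟨ ≈-trans (finProd-suc c a b (suc (double N))) (·-congʳ (finProd-suc c a b (double N))) ⟩
  finProd c a b (double N) · factor c (a + b * double N) · factor c (a + b * suc (double N))
    ≈⟨ ·-cong (·-cong (finProd-split₂ c a b N) (≈-reflexive (cong (factor c) e₀))) (≈-reflexive (cong (factor c) e₁)) ⟩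
  F · G · factor c (a + (b + b) * N) · factor c (a + b + (b + b) * N)
    ≈⟨ solve 4 (λ x y z w → x :* y :* z :* w := x :* z :* (y :* w)) ≈-refl F G _ _ ⟩
  F · factor c (a + (b + b) * N) · (G · factor c (a + b + (b + b) * N))
    ≈⟨ ·-cong (finProd-suc c a (b + b) N) (finProd-suc c (a + b) (b + b) N) ⟨
  finProd c a (b + b) (suc N) · finProd c (a + b) (b + b) (suc N) ∎
  where
  open ≈-Reasoning
  F G : PS
  F = finProd c a (b + b) N
  G = finProd c (a + b) (b + b) N
  l₀ : ∀ a b N → a + b * (N + N) ≡ a + (b + b) * N
  l₀ = ℕ-solver.solve-∀
  l₁ : ∀ a b N → a + b * suc (N + N) ≡ a + b + (b + b) * N
  l₁ = ℕ-solver.solve-∀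
  e₀ : a + b * double N ≡ a + (b + b) * N
  e₀ = trans (cong (λ k → a + b * k) (double-≡ N)) (l₀ a b N)
  e₁ : a + b * suc (double N) ≡ a + b + (b + b) * N
  e₁ = trans (cong (λ k → a + b * suc k) (double-≡ N)) (l₁ a b N)

finProd-split₃ : ∀ c a b N → finProd c a b (triple N) ≈
  finProd c a (b + b + b) N · finProd c (a + b) (b + b + b) N · finProd c (a + b + b) (b + b + b) N
finProd-split₃ c a b zero = ≈-sym (≈-trans (·-identityʳ _) (·-identityˡ one))
finProd-split₃ c a b (suc N) = begin
  finProd c a b (suc (suc (suc (triple N))))
    ≈⟨ ≈-trans (finProd-suc c a b (suc (suc (triple N)))) (·-congʳ
         (≈-trans (finProd-suc c a b (suc (triple N))) (·-congʳ (finProd-suc c a b (triple N))))) ⟩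
  finProd c a b (triple N) · factor c (a + b * triple N) · factor c (a + b * suc (triple N))
    · factor c (a + b * suc (suc (triple N)))
    ≈⟨ ·-cong (·-cong (·-cong (finProd-split₃ c a b N) (≈-reflexive (cong (factor c) e₀)))
         (≈-reflexive (cong (factor c) e₁))) (≈-reflexive (cong (factor c) e₂)) ⟩
  F · G · H · factor c (a + (b + b + b) * N) · factor c (a + b + (b + b + b) * N)
    · factor c (a + b + b + (b + b + b) * N)
    ≈⟨ solve 6 (λ x y z u v w → x :* y :* z :* u :* v :* w := x :* u :* (y :* v) :* (z :* w)) ≈-refl F G H _ _ _ ⟩
  F · factor c (a + (b + b + b) * N) · (G · factor c (a + b + (b + b + b) * N))
    · (H · factor c (a + b + b + (b + b + b) * N))
    ≈⟨ ·-cong (·-cong (finProd-suc c a (b + b + b) N) (finProd-suc c (a + b) (b + b + b) N))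
         (finProd-suc c (a + b + b) (b + b + b) N) ⟨
  finProd c a (b + b + b) (suc N) · finProd c (a + b) (b + b + b) (suc N)
    · finProd c (a + b + b) (b + b + b) (suc N) ∎
  where
  open ≈-Reasoning
  F G H : PS
  F = finProd c a (b + b + b) N
  G = finProd c (a + b) (b + b + b) N
  H = finProd c (a + b + b) (b + b + b) N
  l₀ : ∀ a b N → a + b * (N + N + N) ≡ a + (b + b + b) * N
  l₀ = ℕ-solver.solve-∀
  l₁ : ∀ a b N → a + b * suc (N + N + N) ≡ a + b + (b + b + b) * N
  l₁ = ℕ-solver.solve-∀
  l₂ : ∀ a b N → a + b * suc (suc (N + N + N)) ≡ a + b + b + (b + b + b) * N
  l₂ = ℕ-solver.solve-∀
  e₀ : a + b * triple N ≡ a + (b + b + b) * N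
  e₀ = trans (cong (λ k → a + b * k) (triple-≡ N)) (l₀ a b N)
  e₁ : a + b * suc (triple N) ≡ a + b + (b + b + b) * N
  e₁ = trans (cong (λ k → a + b * suc k) (triple-≡ N)) (l₁ a b N)
  e₂ : a + b * suc (suc (triple N)) ≡ a + b + b + (b + b + b) * N
  e₂ = trans (cong (λ k → a + b * suc (suc k)) (triple-≡ N)) (l₂ a b N)

finProd-± : ∀ a b N → finProd 1ℤ a b N · finProd (- 1ℤ) a b N ≈ finProd 1ℤ (a + a) (b + b) N
finProd-± a b zero = ·-identityˡ one
finProd-± a b (suc N) = begin
  finProd 1ℤ a b (suc N) · finProd (- 1ℤ) a b (suc N)
    ≈⟨ ·-cong (finProd-suc 1ℤ a b N) (finProd-suc (- 1ℤ) a b N) ⟩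
  F · factor 1ℤ e · (G · factor (- 1ℤ) e)
    ≈⟨ ·-cong (·-congˡ (≈-trans (factor-≈ 1ℤ e) (⊕-congˡ (⊝-cong (1-• (X e))))))
         (·-congˡ (≈-trans (factor-≈ (- 1ℤ) e) (⊕-congˡ (⊝-cong (≈-trans (•-neg 1ℤ (X e)) (⊝-cong (1-• (X e)))))))) ⟩
  F · (one ⊕ ⊝ X e) · (G · (one ⊕ ⊝ ⊝ X e))
    ≈⟨ solve 3 (λ f g x → f :* (con 1ℤ :+ :- x) :* (g :* (con 1ℤ :+ :- (:- x))) := f :* g :* (con 1ℤ :+ :- (x :* x)))
         ≈-refl F G (X e) ⟩
  F · G · (one ⊕ ⊝ (X e · X e))
    ≈⟨ ·-cong (finProd-± a b N) (⊕-congˡ (⊝-cong (≈-trans (≈-sym (X-+ e e)) (≈-reflexive (cong X (lemma a b N)))))) ⟩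
  finProd 1ℤ (a + a) (b + b) N · (one ⊕ ⊝ X (a + a + (b + b) * N))
    ≈⟨ ·-congˡ (≈-trans (factor-≈ 1ℤ _) (⊕-congˡ (⊝-cong (1-• _)))) ⟨
  finProd 1ℤ (a + a) (b + b) N · factor 1ℤ (a + a + (b + b) * N)
    ≈⟨ finProd-suc 1ℤ (a + a) (b + b) N ⟨
  finProd 1ℤ (a + a) (b + b) (suc N) ∎
  where
  open ≈-Reasoning
  e : ℕ
  e = a + b * N
  F G : PS
  F = finProd 1ℤ a b N
  G = finProd (- 1ℤ) a b N
  lemma : ∀ a b N → a + b * N + (a + b * N) ≡ a + a + (b + b) * N
  lemma = ℕ-solver.solve-∀

P∞-split₂ : ∀ c {a b} → 1 ≤ a → 1 ≤ b → P∞ c a b ≈ P∞ c a (b + b) · P∞ c (a + b) (b + b)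
P∞-split₂ c {a} {b} 1≤a 1≤b = limit λ m → ≈[]-trans (P∞-finProd c 1≤a 1≤b (≤-double m))
  (≈[]-trans (≈⇒≈[] (finProd-split₂ c a b m)) (≈[]-sym (·-cong[]
    (P∞-finProd c 1≤a 1≤2b ℕ.≤-refl) (P∞-finProd c (ℕ.m≤n⇒m≤n+o b 1≤a) 1≤2b ℕ.≤-refl))))
  where
  1≤2b : 1 ≤ b + b
  1≤2b = ℕ.m≤n⇒m≤n+o b 1≤b

P∞-split₃ : ∀ c {a b} → 1 ≤ a → 1 ≤ b →
  P∞ c a b ≈ P∞ c a (b + b + b) · P∞ c (a + b) (b + b + b) · P∞ c (a + b + b) (b + b + b)
P∞-split₃ c {a} {b} 1≤a 1≤b = limit λ m → ≈[]-trans (P∞-finProd c 1≤a 1≤b (≤-triple m))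
  (≈[]-trans (≈⇒≈[] (finProd-split₃ c a b m)) (≈[]-sym (·-cong[] (·-cong[]
    (P∞-finProd c 1≤a 1≤3b ℕ.≤-refl) (P∞-finProd c 1≤a+b 1≤3b ℕ.≤-refl))
    (P∞-finProd c (ℕ.m≤n⇒m≤n+o b 1≤a+b) 1≤3b ℕ.≤-refl))))
  where
  1≤a+b : 1 ≤ a + b
  1≤a+b = ℕ.m≤n⇒m≤n+o b 1≤a
  1≤3b : 1 ≤ b + b + b
  1≤3b = ℕ.m≤n⇒m≤n+o b (ℕ.m≤n⇒m≤n+o b 1≤b)

P∞-± : ∀ {a b} → 1 ≤ a → 1 ≤ b → P∞ 1ℤ a b · P∞ (- 1ℤ) a b ≈ P∞ 1ℤ (a + a) (b + b)
P∞-± {a} {b} 1≤a 1≤b = limit λ m → ≈[]-trans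
  (·-cong[] (P∞-finProd 1ℤ {N = m} 1≤a 1≤b ℕ.≤-refl) (P∞-finProd (- 1ℤ) 1≤a 1≤b ℕ.≤-refl))
  (≈[]-trans (≈⇒≈[] (finProd-± a b m))
    (≈[]-sym (P∞-finProd 1ℤ (ℕ.m≤n⇒m≤n+o a 1≤a) (ℕ.m≤n⇒m≤n+o b 1≤b) ℕ.≤-refl)))

P∞-at-zero : ∀ c {a b} → 1 ≤ a → 1 ≤ b → P∞ c a b 0 ≡ 1ℤ
P∞-at-zero c 1≤a 1≤b = below (P∞-one 1≤a 1≤b) 0 (s≤s z≤n)
  where
  P∞-one : ∀ {a b} → 1 ≤ a → 1 ≤ b → P∞ c a b ≈[ 1 ] one
  P∞-one {a} {b} 1≤a 1≤b = ≈[]-trans (P∞-finProd c {N = 1} 1≤a 1≤b ℕ.≤-refl)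
    (≈[]-trans (≈⇒≈[] (≈-trans (finProd-suc c a b 0) (·-identityˡ _)))
      (≈[]-weaken (ℕ.≤-trans 1≤a (ℕ.m≤m+n a (b * 0))) (factor-one c (a + b * 0))))

-- Inverses

-- The helper inside inv is private to Defs; it is recovered by unification from its occurrence in inv.
mutual
  inv-go : PS → ℕ → List ℤ → ℤ
  inv-go = _

  inv-suc : ∀ f n → inv f (suc n) ≡ - inv-go f 0 (invRev f n)
  inv-suc f n with invRev f n | 0
  ... | v | j = cong -_ {x = inv-go f j v} refl

inv-go-tail : ∀ f j v → inv-go f (suc j) v ≡ inv-go (tail f) j v
inv-go-tail f j []      = refl
inv-go-tail f j (x ∷ v) = cong (f (suc (suc j)) *ᶻ x +ᶻ_) (inv-go-tail f (suc j) v)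

-- The list `invRev f n` holds the coefficients of the inverse from n down to 0, which is the order
-- in which a convolution meets them. The multiplier g is kept apart from f because the induction
-- replaces g by its tail while the inverse stays that of f.
inv-go-⊛ : ∀ f g n → inv-go g 0 (invRev f n) ≡ (tail g ⊛ inv f) n
inv-go-⊛ f g zero    = refl
inv-go-⊛ f g (suc n) = trans
  (cong (g 1 *ᶻ inv f (suc n) +ᶻ_) (trans (inv-go-tail g 0 (invRev f n)) (inv-go-⊛ f (tail g) n)))
  (sym (⊛-suc (tail g) (inv f) n))

·-inverseʳ : ∀ {f} → f 0 ≡ 1ℤ → f · inv f ≈ one
·-inverseʳ {f} f0≡1 = pointwise coefficient
  where
  lemma : ∀ x → 1ℤ *ᶻ - x +ᶻ x ≡ 0ℤ
  lemma = ℤ-solver.solve-∀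
  coefficient : ∀ n → (f · inv f) n ≡ one n
  coefficient zero    = trans (·-at-zero f (inv f)) (cong (_*ᶻ 1ℤ) f0≡1)
  coefficient (suc n) = trans (·-at f (inv f) (suc n)) (trans (⊛-suc f (inv f) n)
    (trans (cong₂ (λ x y → x *ᶻ y +ᶻ (tail f ⊛ inv f) n) f0≡1 (trans (inv-suc f n) (cong -_ (inv-go-⊛ f f n))))
      (lemma ((tail f ⊛ inv f) n))))

·-undo : ∀ {f} → f 0 ≡ 1ℤ → ∀ g → g ≈ inv f · (f · g)
·-undo {f} f0≡1 g = ≈-sym (≈-trans (≈-sym (·-assoc (inv f) f g))
  (≈-trans (·-congʳ (≈-trans (·-comm (inv f) f) (·-inverseʳ f0≡1))) (·-identityˡ g)))

·-cancelˡ : ∀ {f g h} → f 0 ≡ 1ℤ → f · g ≈ f · h → g ≈ h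
·-cancelˡ {f} {g} {h} f0≡1 p = ≈-trans (·-undo f0≡1 g) (≈-trans (·-congˡ p) (≈-sym (·-undo f0≡1 h)))

·-cancel[] : ∀ {f g h m} → f 0 ≡ 1ℤ → f · g ≈[ m ] f · h → g ≈[ m ] h
·-cancel[] {f} {g} {h} f0≡1 p = ≈[]-trans (≈⇒≈[] (·-undo f0≡1 g))
  (≈[]-trans (·-cong[] ≈[]-refl p) (≈⇒≈[] (≈-sym (·-undo f0≡1 h))))

inv-unique : ∀ {f g} → f 0 ≡ 1ℤ → f · g ≈ one → g ≈ inv f
inv-unique f0≡1 p = ·-cancelˡ f0≡1 (≈-trans p (≈-sym (·-inverseʳ f0≡1)))

infixr 8 _^_ _^ᶻ_

_^_ : PS → ℕ → PS
f ^ zero  = one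
f ^ suc n = f · f ^ n

_^ᶻ_ : PS → ℤ → PS
f ^ᶻ (+ n)    = f ^ n
f ^ᶻ -[1+ n ] = inv f ^ suc n

module _ {f : PS} (f0≡1 : f 0 ≡ 1ℤ) where

  ·-inv-· : ∀ g → g ≈ f · (inv f · g)
  ·-inv-· g = ≈-sym (≈-trans (≈-sym (·-assoc f (inv f) g))
    (≈-trans (·-congʳ (·-inverseʳ f0≡1)) (·-identityˡ g)))

  ^ᶻ-suc : ∀ i → f ^ᶻ ℤ.suc i ≈ f · f ^ᶻ i
  ^ᶻ-suc (+ n)          = ≈-refl
  ^ᶻ-suc -[1+ zero ]    = ·-inv-· one
  ^ᶻ-suc -[1+ suc n ]   = ·-inv-· (inv f ^ suc n)

  ^ᶻ-pred : ∀ i → f ^ᶻ ℤ.pred i ≈ inv f · f ^ᶻ i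
  ^ᶻ-pred (+ zero)  = ≈-refl
  ^ᶻ-pred (+ suc n) = ·-undo f0≡1 (f ^ n)
  ^ᶻ-pred -[1+ n ]  = ≈-refl

  ^ᶻ-+ : ∀ i j → f ^ᶻ (i +ᶻ j) ≈ f ^ᶻ i · f ^ᶻ j
  ^ᶻ-+ (+ zero) j = ≈-trans (≈-reflexive (cong (f ^ᶻ_) (ℤ.+-identityˡ j))) (≈-sym (·-identityˡ _))
  ^ᶻ-+ (+ suc n) j = ≈-trans (≈-reflexive (cong (f ^ᶻ_) (ℤ.suc-+ n j)))
    (≈-trans (^ᶻ-suc (+ n +ᶻ j)) (≈-trans (·-congˡ (^ᶻ-+ (+ n) j)) (≈-sym (·-assoc f (f ^ n) (f ^ᶻ j)))))
  ^ᶻ-+ -[1+ zero ] j = ≈-trans (^ᶻ-pred j) (·-congʳ (≈-sym (·-identityʳ (inv f))))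
  ^ᶻ-+ -[1+ suc n ] j = ≈-trans (≈-reflexive (cong (f ^ᶻ_) (ℤ.pred-+ -[1+ n ] j)))
    (≈-trans (^ᶻ-pred (-[1+ n ] +ᶻ j)) (≈-trans (·-congˡ (^ᶻ-+ -[1+ n ] j)) (≈-sym (·-assoc (inv f) _ (f ^ᶻ j)))))

-- Eta quotients of level 12

product : ∀ {k} → Vec PS k → Vec ℤ k → PS
product []       []       = one
product (f ∷ fs) (e ∷ es) = f ^ᶻ e · product fs es

Monic : ∀ {k} → Vec PS k → Set
Monic []       = ⊤
Monic (f ∷ fs) = f 0 ≡ 1ℤ × Monic fs

product-+ : ∀ {k} {fs : Vec PS k} → Monic fs → ∀ v w → product fs (zipWith _+ᶻ_ v w) ≈ product fs v · product fs w
product-+ {fs = []} _ [] [] = ≈-sym (·-identityˡ one)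
product-+ {fs = f ∷ fs} (f0≡1 , ms) (d ∷ v) (e ∷ w) = ≈-trans (·-cong (^ᶻ-+ f0≡1 d e) (product-+ ms v w))
  (solve 4 (λ a b c d → a :* b :* (c :* d) := a :* c :* (b :* d)) ≈-refl _ _ _ _)

product-0 : ∀ {k} (fs : Vec PS k) → product fs (Vec.replicate k 0ℤ) ≈ one
product-0 []       = ≈-refl
product-0 (f ∷ fs) = ≈-trans (·-identityˡ _) (product-0 fs)

E : ℕ → PS
E k = P∞ 1ℤ k k

etas : Vec PS 6
etas = E 1 ∷ E 2 ∷ E 3 ∷ E 4 ∷ E 6 ∷ E 12 ∷ []

1≤ : ∀ {n} → 1 ≤ suc n
1≤ = s≤s z≤n

etas-monic : Monic etas
etas-monic = one₁ 0 , one₁ 1 , one₁ 2 , one₁ 3 , one₁ 5 , one₁ 11 , tt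
  where
  one₁ : ∀ k → E (suc k) 0 ≡ 1ℤ
  one₁ k = P∞-at-zero 1ℤ {suc k} {suc k} 1≤ 1≤

opaque
  eta : Vec ℤ 6 → PS
  eta = product etas

  eta-+ : ∀ v w → eta (zipWith _+ᶻ_ v w) ≈ eta v · eta w
  eta-+ = product-+ {fs = etas} etas-monic

  eta-0 : eta (Vec.replicate 6 0ℤ) ≈ one
  eta-0 = product-0 etas

  eta-product : ∀ v → eta v ≈ product etas v
  eta-product v = ≈-refl

infix 4 _≈η_

-- Products, inverses and powers act on the exponent vectors, which normalise to literals; an
-- identity between eta quotients then holds by computation. Since `eta` is opaque, unification
-- compares the vectors and does not unfold the products.
_≈η_ : PS → Vec ℤ 6 → Set
f ≈η v = f ≈ eta v

infixl 7 _·η_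

_·η_ : ∀ {f g v w} → f ≈η v → g ≈η w → f · g ≈η zipWith _+ᶻ_ v w
_·η_ {v = v} {w} p q = ≈-trans (·-cong p q) (≈-sym (eta-+ v w))

-v+v≡0 : ∀ {k} (v : Vec ℤ k) → zipWith _+ᶻ_ v (Vec.map -_ v) ≡ Vec.replicate k 0ℤ
-v+v≡0 []      = refl
-v+v≡0 (e ∷ v) = cong₂ _∷_ (ℤ.+-inverseʳ e) (-v+v≡0 v)

eta-inverse : ∀ v → eta v · eta (Vec.map -_ v) ≈ one
eta-inverse v = ≈-trans (≈-sym (eta-+ v (Vec.map -_ v))) (≈-trans (≈-reflexive (cong eta (-v+v≡0 v))) eta-0)

·-monic : ∀ {f g} → f 0 ≡ 1ℤ → g 0 ≡ 1ℤ → (f · g) 0 ≡ 1ℤ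
·-monic {f} {g} p q = trans (·-at-zero f g) (cong₂ _*ᶻ_ p q)

^-monic : ∀ {f} n → f 0 ≡ 1ℤ → (f ^ n) 0 ≡ 1ℤ
^-monic zero p    = refl
^-monic (suc n) p = ·-monic p (^-monic n p)

^ᶻ-monic : ∀ {f} i → f 0 ≡ 1ℤ → (f ^ᶻ i) 0 ≡ 1ℤ
^ᶻ-monic (+ n) p        = ^-monic n p
^ᶻ-monic {f} -[1+ n ] p = ^-monic {inv f} (suc n) refl

product-monic : ∀ {k} {fs : Vec PS k} → Monic fs → ∀ v → product fs v 0 ≡ 1ℤ
product-monic {fs = []} _ [] = refl
product-monic {fs = f ∷ fs} (f0≡1 , ms) (e ∷ v) = ·-monic (^ᶻ-monic e f0≡1) (product-monic ms v)

η-monic : ∀ {f v} → f ≈η v → f 0 ≡ 1ℤ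
η-monic {f} {v} p = trans (at p 0) (trans (at (eta-product v) 0) (product-monic {fs = etas} etas-monic v))

inv-η : ∀ {f v} → f ≈η v → inv f ≈η Vec.map -_ v
inv-η {f} {v} p = ≈-sym (inv-unique (η-monic p) (≈-trans (·-congʳ p) (eta-inverse v)))

_^η_ : ∀ {f v} → f ≈η v → ∀ n → f ^ n ≈η Vec.map (+ n *ᶻ_) v
_^η_ {f} {v} p zero = ≈-trans (≈-sym eta-0) (≈-reflexive (cong eta (sym (0*v v))))
  where
  0*v : ∀ {k} (v : Vec ℤ k) → Vec.map (0ℤ *ᶻ_) v ≡ Vec.replicate k 0ℤ
  0*v []      = refl
  0*v (e ∷ v) = cong (0ℤ ∷_) (0*v v)
_^η_ {f} {v} p (suc n) = ≈-trans (p ·η (p ^η n)) (≈-reflexive (cong eta (suc*v v)))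
  where
  suc*v : ∀ {k} (v : Vec ℤ k) → zipWith _+ᶻ_ v (Vec.map (+ n *ᶻ_) v) ≡ Vec.map (+ suc n *ᶻ_) v
  suc*v []      = refl
  suc*v (e ∷ v) = cong₂ _∷_ (sym (ℤ.suc-* (+ n) e)) (suc*v v)

_/η_ : ∀ {f g v w} → f · g ≈η w → g ≈η v → f ≈η zipWith _+ᶻ_ w (Vec.map -_ v)
_/η_ {f} {g} {v} {w} p q = begin
  f                               ≈⟨ ·-identityʳ f ⟨
  f · one                         ≈⟨ ·-congˡ (eta-inverse v) ⟨
  f · (eta v · eta (Vec.map -_ v)) ≈⟨ ·-assoc f _ _ ⟨
  f · eta v · eta (Vec.map -_ v)  ≈⟨ ·-congʳ (·-congˡ q) ⟨
  f · g · eta (Vec.map -_ v)      ≈⟨ p ·η ≈-refl ⟩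
  eta (zipWith _+ᶻ_ w (Vec.map -_ v)) ∎
  where open ≈-Reasoning

E₁η : E 1 ≈η (+ 1 ∷ + 0 ∷ + 0 ∷ + 0 ∷ + 0 ∷ + 0 ∷ [])
E₁η = ≈-sym (≈-trans (eta-product _)
  (solve 1 (λ x → x :* con 1ℤ :* (con 1ℤ :* (con 1ℤ :* (con 1ℤ :* (con 1ℤ :* (con 1ℤ :* con 1ℤ))))) := x) ≈-refl (E 1)))

E₂η : E 2 ≈η (+ 0 ∷ + 1 ∷ + 0 ∷ + 0 ∷ + 0 ∷ + 0 ∷ [])
E₂η = ≈-sym (≈-trans (eta-product _)
  (solve 1 (λ x → con 1ℤ :* (x :* con 1ℤ :* (con 1ℤ :* (con 1ℤ :* (con 1ℤ :* (con 1ℤ :* con 1ℤ))))) := x) ≈-refl (E 2)))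

E₃η : E 3 ≈η (+ 0 ∷ + 0 ∷ + 1 ∷ + 0 ∷ + 0 ∷ + 0 ∷ [])
E₃η = ≈-sym (≈-trans (eta-product _)
  (solve 1 (λ x → con 1ℤ :* (con 1ℤ :* (x :* con 1ℤ :* (con 1ℤ :* (con 1ℤ :* (con 1ℤ :* con 1ℤ))))) := x) ≈-refl (E 3)))

E₄η : E 4 ≈η (+ 0 ∷ + 0 ∷ + 0 ∷ + 1 ∷ + 0 ∷ + 0 ∷ [])
E₄η = ≈-sym (≈-trans (eta-product _)
  (solve 1 (λ x → con 1ℤ :* (con 1ℤ :* (con 1ℤ :* (x :* con 1ℤ :* (con 1ℤ :* (con 1ℤ :* con 1ℤ))))) := x) ≈-refl (E 4)))

E₆η : E 6 ≈η (+ 0 ∷ + 0 ∷ + 0 ∷ + 0 ∷ + 1 ∷ + 0 ∷ [])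
E₆η = ≈-sym (≈-trans (eta-product _)
  (solve 1 (λ x → con 1ℤ :* (con 1ℤ :* (con 1ℤ :* (con 1ℤ :* (x :* con 1ℤ :* (con 1ℤ :* con 1ℤ))))) := x) ≈-refl (E 6)))

E₁₂η : E 12 ≈η (+ 0 ∷ + 0 ∷ + 0 ∷ + 0 ∷ + 0 ∷ + 1 ∷ [])
E₁₂η = ≈-sym (≈-trans (eta-product _)
  (solve 1 (λ x → con 1ℤ :* (con 1ℤ :* (con 1ℤ :* (con 1ℤ :* (con 1ℤ :* (x :* con 1ℤ :* con 1ℤ))))) := x) ≈-refl (E 12)))

odd-product : ∀ k → 1 ≤ k → P∞ 1ℤ k (k + k) · E (k + k) ≈ E k
odd-product k 1≤k = ≈-sym (P∞-split₂ 1ℤ 1≤k 1≤k)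

odd-product⁻ : ∀ k → 1 ≤ k → P∞ (- 1ℤ) k (k + k) · P∞ 1ℤ k (k + k) ≈ P∞ 1ℤ (k + k) (k + k + (k + k))
odd-product⁻ k 1≤k = ≈-trans (·-comm _ _) (P∞-± 1≤k (ℕ.m≤n⇒m≤n+o k 1≤k))

χ₁ : P∞ 1ℤ 1 2 ≈η (+ 1 ∷ - + 1 ∷ + 0 ∷ + 0 ∷ + 0 ∷ + 0 ∷ [])
χ₁ = ≈-trans (odd-product 1 1≤) E₁η /η E₂η

χ₂ : P∞ 1ℤ 2 4 ≈η (+ 0 ∷ + 1 ∷ + 0 ∷ - + 1 ∷ + 0 ∷ + 0 ∷ [])
χ₂ = ≈-trans (odd-product 2 1≤) E₂η /η E₄η

χ₃ : P∞ 1ℤ 3 6 ≈η (+ 0 ∷ + 0 ∷ + 1 ∷ + 0 ∷ - + 1 ∷ + 0 ∷ [])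
χ₃ = ≈-trans (odd-product 3 1≤) E₃η /η E₆η

χ₆ : P∞ 1ℤ 6 12 ≈η (+ 0 ∷ + 0 ∷ + 0 ∷ + 0 ∷ + 1 ∷ - + 1 ∷ [])
χ₆ = ≈-trans (odd-product 6 1≤) E₆η /η E₁₂η

χ⁻₁ : P∞ (- 1ℤ) 1 2 ≈η (- + 1 ∷ + 2 ∷ + 0 ∷ - + 1 ∷ + 0 ∷ + 0 ∷ [])
χ⁻₁ = ≈-trans (odd-product⁻ 1 1≤) χ₂ /η χ₁

χ⁻₃ : P∞ (- 1ℤ) 3 6 ≈η (+ 0 ∷ + 0 ∷ - + 1 ∷ + 0 ∷ + 2 ∷ - + 1 ∷ [])
χ⁻₃ = ≈-trans (odd-product⁻ 3 1≤) χ₆ /η χ₃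

E⁻₁ : P∞ (- 1ℤ) 1 1 ≈η (- + 1 ∷ + 1 ∷ + 0 ∷ + 0 ∷ + 0 ∷ + 0 ∷ [])
E⁻₁ = ≈-trans (≈-trans (·-comm _ _) (P∞-± 1≤ 1≤)) E₂η /η E₁η

E⁻₂ : P∞ (- 1ℤ) 2 2 ≈η (+ 0 ∷ - + 1 ∷ + 0 ∷ + 1 ∷ + 0 ∷ + 0 ∷ [])
E⁻₂ = ≈-trans (≈-trans (·-comm _ _) (P∞-± 1≤ 1≤)) E₄η /η E₂η

E⁻₃ : P∞ (- 1ℤ) 3 3 ≈η (+ 0 ∷ + 0 ∷ - + 1 ∷ + 0 ∷ + 1 ∷ + 0 ∷ [])
E⁻₃ = ≈-trans (≈-trans (·-comm _ _) (P∞-± 1≤ 1≤)) E₆η /η E₃η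

-- Sums over -N ≤ k < N

S : ℕ → (ℤ → PS) → PS
S zero    f = 𝟘
S (suc N) f = S N f ⊕ (f (+ N) ⊕ f -[1+ N ])

S-cong-< : ∀ {m} N {f g : ℤ → PS} → (∀ i → i < N → f (+ i) ≈[ m ] g (+ i)) →
  (∀ i → i < N → f -[1+ i ] ≈[ m ] g -[1+ i ]) → S N f ≈[ m ] S N g
S-cong-< zero    p q = ≈[]-refl
S-cong-< (suc N) p q = ⊕-cong[] (S-cong-< N (λ i i<N → p i (ℕ.m≤n⇒m≤1+n i<N)) (λ i i<N → q i (ℕ.m≤n⇒m≤1+n i<N)))
  (⊕-cong[] (p N ℕ.≤-refl) (q N ℕ.≤-refl))

S-cong[] : ∀ {m} N {f g : ℤ → PS} → (∀ k → ℤ.∣ k ∣ ≤ N → f k ≈[ m ] g k) → S N f ≈[ m ] S N g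
S-cong[] N p = S-cong-< N (λ i i<N → p (+ i) (ℕ.<⇒≤ i<N)) (λ i i<N → p -[1+ i ] i<N)

S-cong : ∀ N {f g : ℤ → PS} → (∀ k → f k ≈ g k) → S N f ≈ S N g
S-cong N p = limit λ m → S-cong[] N (λ k _ → ≈⇒≈[] (p k))

S-⊕ : ∀ N (f g : ℤ → PS) → S N (λ k → f k ⊕ g k) ≈ S N f ⊕ S N g
S-⊕ zero    f g = ≈-sym (⊕-identityˡ 𝟘)
S-⊕ (suc N) f g = ≈-trans (⊕-congʳ (S-⊕ N f g))
  (solve 6 (λ a b c d e f → a :+ b :+ (c :+ d :+ (e :+ f)) := a :+ (c :+ e) :+ (b :+ (d :+ f))) ≈-refl _ _ _ _ _ _)

S-𝟘 : ∀ N → S N (λ _ → 𝟘) ≈ 𝟘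
S-𝟘 zero    = ≈-refl
S-𝟘 (suc N) = ≈-trans (⊕-cong (S-𝟘 N) (⊕-identityˡ 𝟘)) (⊕-identityˡ 𝟘)

S-· : ∀ N c (f : ℤ → PS) → c · S N f ≈ S N (λ k → c · f k)
S-· zero    c f = ·-zeroʳ c
S-· (suc N) c f = ≈-trans (solve 4 (λ c s a b → c :* (s :+ (a :+ b)) := c :* s :+ (c :* a :+ c :* b)) ≈-refl _ _ _ _)
  (⊕-congʳ (S-· N c f))

S-·ʳ : ∀ N c (f : ℤ → PS) → S N f · c ≈ S N (λ k → f k · c)
S-·ʳ N c f = ≈-trans (·-comm _ _) (≈-trans (S-· N c f) (S-cong N (λ k → ·-comm c (f k))))

S-• : ∀ N c (f : ℤ → PS) → c • S N f ≈ S N (λ k → c • f k)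
S-• N c f = ≈-trans (≈-sym (constant-· c _)) (≈-trans (S-· N (constant c) f) (S-cong N (λ k → constant-· c (f k))))

S-swap : ∀ N M (g : ℤ → ℤ → PS) → S N (λ k → S M (g k)) ≈ S M (λ l → S N (λ k → g k l))
S-swap zero    M g = ≈-sym (S-𝟘 M)
S-swap (suc N) M g = ≈-trans (⊕-cong (S-swap N M g) (≈-sym (S-⊕ M (g (+ N)) (g -[1+ N ]))))
  (≈-sym (S-⊕ M (λ l → S N (λ k → g k l)) (λ l → g (+ N) l ⊕ g -[1+ N ] l)))

-- The half-open range makes the splitting exact: the integers of [-2N, 2N) are 2j and 2j + 1 with j
-- in [-N, N), without boundary terms. The same holds modulo 3 in `S-triple`.
S-double : ∀ N (f : ℤ → PS) → S (double N) f ≈ S N (λ j → f (j +ᶻ j)) ⊕ S N (λ j → f (j +ᶻ j +ᶻ + 1))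
S-double zero    f = ≈-sym (⊕-identityˡ 𝟘)
S-double (suc N) f rewrite double-≡ N | ℕ.+-comm (N + N) 1 = ≈-trans
  (⊕-congʳ (⊕-congʳ (≈-trans (≈-reflexive (cong (λ n → S n f) (sym (double-≡ N)))) (S-double N f))))
  (solve 6 (λ s t a b c d → s :+ t :+ (a :+ b) :+ (c :+ d) := s :+ (a :+ d) :+ (t :+ (c :+ b)))
    ≈-refl _ _ _ _ _ _)

S-triple : ∀ N (f : ℤ → PS) → S (triple N) f ≈
  S N (λ j → f (j +ᶻ j +ᶻ j)) ⊕ S N (λ j → f (j +ᶻ j +ᶻ j +ᶻ + 1)) ⊕ S N (λ j → f (j +ᶻ j +ᶻ j +ᶻ + 2))
S-triple zero    f = ≈-sym (≈-trans (⊕-identityʳ _) (⊕-identityˡ 𝟘))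
S-triple (suc N) f rewrite triple-≡ N | ℕ.+-comm (N + N + N) 1 | ℕ.+-comm (N + N + N) 2 = ≈-trans
  (⊕-congʳ (⊕-congʳ (⊕-congʳ (≈-trans (≈-reflexive (cong (λ n → S n f) (sym (triple-≡ N)))) (S-triple N f)))))
  (solve 9 (λ s t u a b c d e f →
      s :+ t :+ u :+ (a :+ b) :+ (c :+ d) :+ (e :+ f) := s :+ (a :+ f) :+ (t :+ (c :+ d)) :+ (u :+ (e :+ b)))
    ≈-refl _ _ _ _ _ _ _ _ _)

-- The reflection k ↦ -1 - k, which maps the half-open range [-N, N) to itself; k ↦ -k does not.
flip : ℤ → ℤ
flip (+ n)    = -[1+ n ]
flip -[1+ n ] = + n

S-flip : ∀ N (f : ℤ → PS) → S N (λ k → f (flip k)) ≈ S N f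
S-flip zero    f = ≈-refl
S-flip (suc N) f = ⊕-cong (S-flip N f) (⊕-comm _ _)

S-vanish : ∀ {m K N} {f : ℤ → PS} → (∀ k → K ≤ ℤ.∣ k ∣ → f k ≈[ m ] 𝟘) → K ≤ N → S N f ≈[ m ] S K f
S-vanish {N = zero} p z≤n = ≈[]-refl
S-vanish {K = K} {N = suc N} {f} p K≤1+N with K ℕ.≟ suc N
... | yes refl = ≈[]-refl
... | no K≢1+N = ≈[]-trans
  (⊕-cong[] (S-vanish p K≤N) (⊕-cong[] (p (+ N) K≤N) (p -[1+ N ] K≤1+N)))
  (≈⇒≈[] (≈-trans (⊕-congˡ (⊕-identityˡ 𝟘)) (⊕-identityʳ _)))
  where
  K≤N : K ≤ N
  K≤N = ℕ.≤-pred (ℕ.≤∧≢⇒< K≤1+N K≢1+N)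

S-suc : ∀ N (f : ℤ → PS) → S N (λ k → f (ℤ.suc k)) ⊕ f (- (+ N)) ≈ S N f ⊕ f (+ N)
S-suc zero    f = ≈-refl
S-suc (suc N) f = begin
  S N (λ k → f (ℤ.suc k)) ⊕ (f (+ suc N) ⊕ f (ℤ.suc -[1+ N ])) ⊕ f -[1+ N ]
    ≈⟨ ⊕-congʳ (⊕-congˡ (⊕-congˡ (≈-reflexive (cong f (suc-neg N))))) ⟩
  S N (λ k → f (ℤ.suc k)) ⊕ (f (+ suc N) ⊕ f (- (+ N))) ⊕ f -[1+ N ]
    ≈⟨ solve 4 (λ a b c d → a :+ (b :+ c) :+ d := a :+ c :+ (b :+ d)) ≈-refl _ _ _ _ ⟩
  S N (λ k → f (ℤ.suc k)) ⊕ f (- (+ N)) ⊕ (f (+ suc N) ⊕ f -[1+ N ])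
    ≈⟨ ⊕-congʳ (S-suc N f) ⟩
  S N f ⊕ f (+ N) ⊕ (f (+ suc N) ⊕ f -[1+ N ])
    ≈⟨ solve 4 (λ a b c d → a :+ b :+ (c :+ d) := a :+ (b :+ d) :+ c) ≈-refl _ _ _ _ ⟩
  S N f ⊕ (f (+ N) ⊕ f -[1+ N ]) ⊕ f (+ suc N) ∎
  where
  open ≈-Reasoning
  suc-neg : ∀ N → ℤ.suc -[1+ N ] ≡ - (+ N)
  suc-neg zero    = refl
  suc-neg (suc N) = refl

∣∣-shift : ∀ {K} k c → K + ℤ.∣ c ∣ ≤ ℤ.∣ k ∣ → K ≤ ℤ.∣ k +ᶻ c ∣
∣∣-shift {K} k c p = ℕ.+-cancelʳ-≤ ℤ.∣ c ∣ K ℤ.∣ k +ᶻ c ∣ (ℕ.≤-trans p (ℕ.≤-trans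
  (ℕ.≤-reflexive (cong ℤ.∣_∣ (lemma k c)))
  (ℕ.≤-trans (ℤ.∣i+j∣≤∣i∣+∣j∣ (k +ᶻ c) (- c)) (ℕ.≤-reflexive (cong (λ x → ℤ.∣ k +ᶻ c ∣ + x) (ℤ.∣-i∣≡∣i∣ c))))))
  where
  lemma : ∀ k c → k ≡ k +ᶻ c +ᶻ - c
  lemma = ℤ-solver.solve-∀

∣-n∣ : ∀ n → ℤ.∣ - (+ n) ∣ ≡ n
∣-n∣ n = ℤ.∣-i∣≡∣i∣ (+ n)

S-suc[] : ∀ {m K N} {f : ℤ → PS} → (∀ k → K ≤ ℤ.∣ k ∣ → f k ≈[ m ] 𝟘) → K ≤ N →
  S N (λ k → f (ℤ.suc k)) ≈[ m ] S N f
S-suc[] {m} {K} {N} {f} p K≤N = begin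
  S N (λ k → f (ℤ.suc k))                   ≈⟨ ≈⇒≈[] (⊕-identityʳ _) ⟨
  S N (λ k → f (ℤ.suc k)) ⊕ 𝟘               ≈⟨ ⊕-cong[] ≈[]-refl (p (- (+ N)) (ℕ.≤-trans K≤N (ℕ.≤-reflexive (sym (∣-n∣ N))))) ⟨
  S N (λ k → f (ℤ.suc k)) ⊕ f (- (+ N))     ≈⟨ ≈⇒≈[] (S-suc N f) ⟩
  S N f ⊕ f (+ N)                           ≈⟨ ⊕-cong[] ≈[]-refl (p (+ N) K≤N) ⟩
  S N f ⊕ 𝟘                                 ≈⟨ ≈⇒≈[] (⊕-identityʳ _) ⟩
  S N f ∎
  where open ≈[]-Reasoning m

S-shift⁺ : ∀ {m K N} c {f : ℤ → PS} → (∀ k → K ≤ ℤ.∣ k ∣ → f k ≈[ m ] 𝟘) → K + c ≤ N →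
  S N (λ k → f (k +ᶻ + c)) ≈[ m ] S N f
S-shift⁺ {N = N} zero {f} p _ = ≈⇒≈[] (S-cong N (λ k → ≈-reflexive (cong f (ℤ.+-identityʳ k))))
S-shift⁺ {K = K} {N} (suc c) {f} p K+c≤N = ≈[]-trans
  (≈⇒≈[] (S-cong N (λ k → ≈-reflexive (cong f (lemma k (+ c))))))
  (≈[]-trans (S-suc[] {f = λ k → f (k +ᶻ + c)} (λ k q → p (k +ᶻ + c) (∣∣-shift k (+ c) q)) K+c≤N′)
    (S-shift⁺ c p K+c≤N′))
  where
  lemma : ∀ k c → k +ᶻ (1ℤ +ᶻ c) ≡ 1ℤ +ᶻ k +ᶻ c
  lemma = ℤ-solver.solve-∀
  K+c≤N′ : K + c ≤ N
  K+c≤N′ = ℕ.≤-trans (ℕ.+-monoʳ-≤ K (ℕ.n≤1+n c)) K+c≤N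

-- Moving the window affects only indices whose terms vanish. The bound contains |c| twice because a
-- negative shift is the inverse of a positive one applied to the already shifted summand, whose
-- support may be wider by |c|.
S-shift : ∀ {m K N} c {f : ℤ → PS} → (∀ k → K ≤ ℤ.∣ k ∣ → f k ≈[ m ] 𝟘) → K + ℤ.∣ c ∣ + ℤ.∣ c ∣ ≤ N →
  S N (λ k → f (k +ᶻ c)) ≈[ m ] S N f
S-shift (+ c) p K≤N = S-shift⁺ c p (ℕ.≤-trans (ℕ.m≤m+n _ c) K≤N)
S-shift {N = N} -[1+ c ] {f} p K≤N = ≈[]-sym (≈[]-trans
  (≈⇒≈[] (S-cong N (λ k → ≈-reflexive (cong f (lemma k (+ suc c))))))
  (S-shift⁺ (suc c) {λ k → f (k +ᶻ -[1+ c ])} (λ k q → p (k +ᶻ -[1+ c ]) (∣∣-shift k -[1+ c ] q)) K≤N))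
  where
  lemma : ∀ k c → k ≡ k +ᶻ c +ᶻ - c
  lemma = ℤ-solver.solve-∀

-- The Jacobi triple product

-- D h N = Σ_{i+j=N} h i j
D : (ℕ → ℕ → PS) → ℕ → PS
D h zero    = h 0 0
D h (suc N) = h (suc N) 0 ⊕ D (λ i j → h i (suc j)) N

D-cong : ∀ {h h′ : ℕ → ℕ → PS} N → (∀ i j → h i j ≈ h′ i j) → D h N ≈ D h′ N
D-cong zero    p = p 0 0
D-cong (suc N) p = ⊕-cong (p (suc N) 0) (D-cong N (λ i j → p i (suc j)))

D-⊕ : ∀ (h h′ : ℕ → ℕ → PS) N → D (λ i j → h i j ⊕ h′ i j) N ≈ D h N ⊕ D h′ N
D-⊕ h h′ zero    = ≈-refl
D-⊕ h h′ (suc N) = ≈-trans (⊕-congˡ (D-⊕ (λ i j → h i (suc j)) (λ i j → h′ i (suc j)) N))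
  (solve 4 (λ a b c d → a :+ b :+ (c :+ d) := a :+ c :+ (b :+ d)) ≈-refl _ _ _ _)

D-· : ∀ c (h : ℕ → ℕ → PS) N → c · D h N ≈ D (λ i j → c · h i j) N
D-· c h zero    = ≈-refl
D-· c h (suc N) = ≈-trans (·-distribˡ c _ _) (⊕-congˡ (D-· c (λ i j → h i (suc j)) N))

D-last : ∀ (h : ℕ → ℕ → PS) N → D h (suc N) ≈ D (λ i j → h (suc i) j) N ⊕ h 0 (suc N)
D-last h zero    = ≈-refl
D-last h (suc N) = ≈-trans (⊕-congˡ (D-last (λ i j → h i (suc j)) N)) (≈-sym (⊕-assoc _ _ _))

centred : (ℕ → ℕ → PS) → ℕ → ℤ → PS
centred h n (+ i)    = h (n ∸ i) (n + i)
centred h n -[1+ i ] = h (n + suc i) (n ∸ suc i)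

-- The index is k = j - n, which runs over the closed interval [-n, n]. The half-open sum covers all
-- of it but k = n, hence the extra term.
D-centred : ∀ (h : ℕ → ℕ → PS) n → D h (n + n) ≈ S n (centred h n) ⊕ h 0 (n + n)
D-centred h zero = ≈-sym (⊕-identityˡ _)
D-centred h (suc n) = begin
  D h (suc n + suc n)
    ≈⟨ ≈-reflexive (cong (D h) 2+2n) ⟩
  D h (suc (suc (n + n)))
    ≈⟨ ⊕-congˡ (D-last (λ i j → h i (suc j)) (n + n)) ⟩
  h (suc (suc (n + n))) 0 ⊕ (D h⁺ (n + n) ⊕ h 0 (suc (suc (n + n))))
    ≈⟨ ⊕-congˡ (⊕-congʳ (D-centred h⁺ n)) ⟩
  h (suc (suc (n + n))) 0 ⊕ (S n (centred h⁺ n) ⊕ h 1 (suc (n + n)) ⊕ h 0 (suc (suc (n + n))))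
    ≈⟨ ⊕-cong (≈-reflexive (cong (λ k → h k 0) (sym 2+2n))) (⊕-cong (⊕-cong
         (limit λ m → S-cong-< n (λ i i<n → ≈⇒≈[] (≈-reflexive (cong (λ k → h k (suc (n + i))) (suc-∸ i (ℕ.<⇒≤ i<n)))))
                               (λ i i<n → ≈⇒≈[] (≈-reflexive (cong (h (suc (n + suc i))) (suc-∸ (suc i) i<n)))))
         (≈-reflexive (cong₂ h (suc-∸-self n) refl))) (≈-reflexive (cong (h 0) (sym 2+2n)))) ⟩
  h (suc n + suc n) 0 ⊕ (S n (centred h (suc n)) ⊕ h (suc n ∸ n) (suc n + n) ⊕ h 0 (suc n + suc n))
    ≈⟨ solve 4 (λ a b c d → a :+ (b :+ c :+ d) := b :+ (c :+ a) :+ d) ≈-refl _ _ _ _ ⟩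
  S n (centred h (suc n)) ⊕ (h (suc n ∸ n) (suc n + n) ⊕ h (suc n + suc n) 0) ⊕ h 0 (suc n + suc n)
    ≈⟨ ⊕-congʳ (⊕-congˡ (⊕-congˡ (≈-reflexive (cong (h (suc n + suc n)) (sym (ℕ.n∸n≡0 n)))))) ⟩
  S (suc n) (centred h (suc n)) ⊕ h 0 (suc n + suc n) ∎
  where
  open ≈-Reasoning
  h⁺ : ℕ → ℕ → PS
  h⁺ i j = h (suc i) (suc j)
  2+2n : suc n + suc n ≡ suc (suc (n + n))
  2+2n = cong suc (ℕ.+-suc n n)
  suc-∸ : ∀ i → i ≤ n → suc (n ∸ i) ≡ suc n ∸ i
  suc-∸ i i≤n = sym (ℕ.+-∸-assoc 1 i≤n)
  suc-∸-self : ∀ n → 1 ≡ suc n ∸ n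
  suc-∸-self zero    = refl
  suc-∸-self (suc n) = suc-∸-self n

-- T n = n(n-1)/2 = 0 + 1 + ... + (n-1), the power of q^d picked up by n consecutive factors.
T : ℕ → ℕ
T zero    = zero
T (suc n) = n + T n

T-+ : ∀ a b → T (a + b) ≡ T a + T b + a * b
T-+ zero b = sym (ℕ.+-identityʳ (T b))
T-+ (suc a) b = trans (cong (λ x → a + b + x) (T-+ a b)) (lemma a b (T a) (T b))
  where
  lemma : ∀ a b x y → a + b + (x + y + a * b) ≡ a + x + y + (b + a * b)
  lemma = ℕ-solver.solve-∀

2T : ∀ n → 2 * T (suc n) ≡ suc n * n
2T zero    = refl
2T (suc n) = trans (ℕ.*-distribˡ-+ 2 (suc n) (T (suc n))) (trans (cong (λ x → 2 * suc n + x) (2T n)) (lemma n))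
  where
  lemma : ∀ n → 2 * suc n + suc n * n ≡ suc (suc n) * suc n
  lemma = ℕ-solver.solve-∀

sign-0 : ∀ s → sign s 0 ≡ 1ℤ
sign-0 false = refl
sign-0 true  = refl

sign-suc : ∀ s n → sign s (suc n) ≡ sign s 1 *ᶻ sign s n
sign-suc false n = refl
sign-suc true  n = sym (ℤ.-1*i≡-i (sign true n))

sign-+ : ∀ s a b → sign s (a + b) ≡ sign s a *ᶻ sign s b
sign-+ false a b = refl
sign-+ true zero b = sym (ℤ.*-identityˡ (sign true b))
sign-+ true (suc a) b = trans (cong -_ (sign-+ true a b)) (ℤ.neg-distribˡ-* (sign true a) (sign true b))

sign² : ∀ s a → sign s a *ᶻ sign s a ≡ 1ℤ
sign² false a = refl
sign² true zero = refl
sign² true (suc a) = trans (lemma (sign true a)) (sign² true a)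
  where
  lemma : ∀ x → - x *ᶻ - x ≡ x *ᶻ x
  lemma = ℤ-solver.solve-∀

-- Gauss d i j is the Gaussian binomial coefficient (i+j choose j) in base q^d
Gauss : ℕ → ℕ → ℕ → PS
Gauss d zero    j       = one
Gauss d (suc i) zero    = one
Gauss d (suc i) (suc j) = Gauss d (suc i) j ⊕ X (d * suc j) · Gauss d i (suc j)

Gauss-zeroʳ : ∀ d i → Gauss d i 0 ≡ one
Gauss-zeroʳ d zero    = refl
Gauss-zeroʳ d (suc i) = refl

module _ (d : ℕ) where

  F : ℕ → PS
  F = finProd 1ℤ d d

  F-suc : ∀ n → F (suc n) ≈ F n · (one ⊕ ⊝ X (d * suc n))
  F-suc n = ≈-trans (finProd-suc 1ℤ d d n) (·-congˡ (≈-trans (factor-≈ 1ℤ _)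
    (⊕-congˡ (⊝-cong (≈-trans (1-• _) (≈-reflexive (cong X (sym (ℕ.*-suc d n)))))))))

  -- The quotient formula for Gaussian binomials with denominators cleared. In the inductive step
  -- both terms of Pascal's rule carry `F (suc i + j)`, and (1 - x) + x(1 - y) = 1 - xy supplies the
  -- missing factor.
  Gauss-F : ∀ i j → Gauss d i j · (F i · F j) ≈ F (i + j)
  Gauss-F zero j = ≈-trans (·-identityˡ _) (·-identityˡ _)
  Gauss-F (suc i) zero = ≈-trans (·-identityˡ _) (≈-trans (·-identityʳ _) (≈-reflexive (cong F (sym (ℕ.+-identityʳ (suc i))))))
  Gauss-F (suc i) (suc j) = begin
    (G₁ ⊕ xⱼ · G₂) · (F (suc i) · F (suc j))
      ≈⟨ solve 5 (λ g₁ g₂ x a b → (g₁ :+ x :* g₂) :* (a :* b) := g₁ :* (a :* b) :+ x :* (g₂ :* (a :* b))) ≈-refl G₁ G₂ xⱼ _ _ ⟩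
    G₁ · (F (suc i) · F (suc j)) ⊕ xⱼ · (G₂ · (F (suc i) · F (suc j)))
      ≈⟨ ⊕-cong (·-congˡ (·-congˡ (F-suc j))) (·-congˡ (·-congˡ (·-congʳ (F-suc i)))) ⟩
    G₁ · (F (suc i) · (F j · (one ⊕ ⊝ xⱼ))) ⊕ xⱼ · (G₂ · (F i · (one ⊕ ⊝ xᵢ) · F (suc j)))
      ≈⟨ solve 8 (λ g₁ g₂ a b c e x y → g₁ :* (a :* (b :* (con 1ℤ :+ :- x))) :+ x :* (g₂ :* (c :* (con 1ℤ :+ :- y) :* e))
           := g₁ :* (a :* b) :* (con 1ℤ :+ :- x) :+ x :* (con 1ℤ :+ :- y) :* (g₂ :* (c :* e))) ≈-refl G₁ G₂ _ _ _ _ xⱼ xᵢ ⟩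
    G₁ · (F (suc i) · F j) · (one ⊕ ⊝ xⱼ) ⊕ xⱼ · (one ⊕ ⊝ xᵢ) · (G₂ · (F i · F (suc j)))
      ≈⟨ ⊕-cong (·-congʳ (Gauss-F (suc i) j)) (·-congˡ (≈-trans (Gauss-F i (suc j)) (≈-reflexive (cong F (ℕ.+-suc i j))))) ⟩
    F (suc i + j) · (one ⊕ ⊝ xⱼ) ⊕ xⱼ · (one ⊕ ⊝ xᵢ) · F (suc i + j)
      ≈⟨ solve 3 (λ f x y → f :* (con 1ℤ :+ :- x) :+ x :* (con 1ℤ :+ :- y) :* f := f :* (con 1ℤ :+ :- (x :* y))) ≈-refl _ xⱼ xᵢ ⟩
    F (suc i + j) · (one ⊕ ⊝ (xⱼ · xᵢ))
      ≈⟨ ·-congˡ (⊕-congˡ (⊝-cong (≈-trans (≈-sym (X-+ _ _)) (≈-reflexive (cong X (lemma d i j)))))) ⟩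
    F (suc (i + j)) · (one ⊕ ⊝ X (d * suc (suc (i + j))))
      ≈⟨ F-suc (suc (i + j)) ⟨
    F (suc (suc (i + j)))
      ≈⟨ ≈-reflexive (cong F (cong suc (sym (ℕ.+-suc i j)))) ⟩
    F (suc i + suc j) ∎
    where
    open ≈-Reasoning
    G₁ G₂ xᵢ xⱼ : PS
    G₁ = Gauss d (suc i) j
    G₂ = Gauss d i (suc j)
    xᵢ = X (d * suc i)
    xⱼ = X (d * suc j)
    lemma : ∀ d i j → d * suc j + d * suc i ≡ d * suc (suc (i + j))
    lemma = ℕ-solver.solve-∀

  Gauss-limit : 1 ≤ d → ∀ {m i j} → m ≤ i → m ≤ j → E d · Gauss d i j ≈[ m ] one
  -- Two further copies of `E d` stand in for `F i` and `F j` modulo q^m. After `Gauss-F` the claim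
  -- reads E² = E², and both copies are cancelled.
  Gauss-limit 1≤d {m} {i} {j} m≤i m≤j = ·-cancel[] (P∞-at-zero 1ℤ 1≤d 1≤d) (·-cancel[] (P∞-at-zero 1ℤ 1≤d 1≤d) (begin
    E d · (E d · (E d · G))  ≈⟨ ≈⇒≈[] (solve 2 (λ e g → e :* (e :* (e :* g)) := e :* (g :* (e :* e))) ≈-refl (E d) G) ⟩
    E d · (G · (E d · E d))  ≈⟨ ·-cong[] ≈[]-refl (·-cong[] ≈[]-refl (·-cong[] (P∞-finProd 1ℤ 1≤d 1≤d m≤i) (P∞-finProd 1ℤ 1≤d 1≤d m≤j))) ⟩
    E d · (G · (F i · F j))  ≈⟨ ≈⇒≈[] (·-congˡ (Gauss-F i j)) ⟩
    E d · F (i + j)          ≈⟨ ·-cong[] ≈[]-refl (P∞-finProd 1ℤ 1≤d 1≤d (ℕ.m≤n⇒m≤n+o j m≤i)) ⟨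
    E d · E d                ≈⟨ ≈⇒≈[] (·-congˡ (≈-sym (·-identityʳ (E d)))) ⟩
    E d · (E d · one) ∎))
    where
    open ≈[]-Reasoning m
    G : PS
    G = Gauss d i j

  -- ∏_{k<N} (q^w + s q^(e+dk)) with s = ±1
  module _ (s : Bool) (w : ℕ) where

    Q : ℕ → ℕ → PS
    Q e zero    = one
    Q e (suc N) = (X w ⊕ sign s 1 • X e) · Q (e + d) N

    term′ : ℕ → ℕ → ℕ → PS
    term′ e i j = Gauss d i j · sign s j • X (d * T j + e * j + w * i)

    q-binomial : ∀ e N → Q e N ≈ D (term′ e) N
    q-binomial e zero = ≈-sym (≈-trans (·-identityˡ _) (≈-trans (•-cong (sign-0 s) (≈-reflexive (cong X (zeros d e w)))) (≈-trans (1-• (X 0)) X-zero)))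
      where
      zeros : ∀ d e w → d * 0 + e * 0 + w * 0 ≡ 0
      zeros = ℕ-solver.solve-∀
    q-binomial e (suc N) = begin
      (X w ⊕ c • X e) · Q (e + d) N
        ≈⟨ ·-congˡ (q-binomial (e + d) N) ⟩
      (X w ⊕ c • X e) · D (term′ (e + d)) N
        ≈⟨ ·-distribʳ _ _ _ ⟩
      X w · D (term′ (e + d)) N ⊕ c • X e · D (term′ (e + d)) N
        ≈⟨ ⊕-cong (≈-trans (D-· _ _ N) (≈-sym (⊕-identityʳ _))) (≈-trans (D-· _ _ N) (≈-sym (⊕-identityˡ _))) ⟩
      (D (λ i j → u (suc i) j) N ⊕ 𝟘) ⊕ (𝟘 ⊕ D (λ i j → v i (suc j)) N)
        ≈⟨ ⊕-congʳ (D-last u N) ⟨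
      D u (suc N) ⊕ D v (suc N)
        ≈⟨ D-⊕ u v (suc N) ⟨
      D (λ i j → u i j ⊕ v i j) (suc N)
        ≈⟨ D-cong (suc N) u⊕v ⟩
      D (term′ e) (suc N) ∎
      where
      open ≈-Reasoning
      c : ℤ
      c = sign s 1
      u v : ℕ → ℕ → PS
      -- The pair (0,0) does not occur in `D u (suc N)`; this value makes `u⊕v` true at all indices,
      -- as `D-cong` demands.
      u zero    zero    = term′ e 0 0
      u zero    (suc j) = 𝟘
      u (suc i) j       = X w · term′ (e + d) i j
      v i zero    = 𝟘
      v i (suc j) = c • X e · term′ (e + d) i j

      e₁ : ∀ d e w i j t → w + (d * t + (e + d) * j + w * i) ≡ d * j + (d * t + e * j + w * suc i)
      e₁ = ℕ-solver.solve-∀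
      e₂ : ∀ d e w i j t → e + (d * t + (e + d) * j + w * i) ≡ d * (j + t) + e * suc j + w * i
      e₂ = ℕ-solver.solve-∀

      u-suc : ∀ i j → X w · term′ (e + d) i j ≈ X (d * j) · Gauss d i j · sign s j • X (d * T j + e * j + w * suc i)
      u-suc i j = begin
        X w · (Gauss d i j · sign s j • X (d * T j + (e + d) * j + w * i))
          ≈⟨ solve 3 (λ a b c → a :* (b :* c) := b :* (a :* c)) ≈-refl _ _ _ ⟩
        Gauss d i j · (X w · sign s j • X (d * T j + (e + d) * j + w * i))
          ≈⟨ ·-congˡ (≈-trans (·-• _ _ _) (•-cong refl (≈-trans (≈-sym (X-+ _ _))
               (≈-trans (≈-reflexive (cong X (e₁ d e w i j (T j)))) (X-+ _ _))))) ⟩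
        Gauss d i j · sign s j • (X (d * j) · X (d * T j + e * j + w * suc i))
          ≈⟨ ·-congˡ (≈-sym (·-• _ _ _)) ⟩
        Gauss d i j · (X (d * j) · sign s j • X (d * T j + e * j + w * suc i))
          ≈⟨ solve 3 (λ a b c → b :* (a :* c) := a :* b :* c) ≈-refl _ _ _ ⟩
        X (d * j) · Gauss d i j · sign s j • X (d * T j + e * j + w * suc i) ∎

      v-suc : ∀ i j → c • X e · term′ (e + d) i j ≈ Gauss d i j · sign s (suc j) • X (d * T (suc j) + e * suc j + w * i)
      v-suc i j = ≈-trans (solve 3 (λ a b c → a :* (b :* c) := b :* (a :* c)) ≈-refl _ _ _)
        (·-congˡ (≈-trans (monomial-· _ _ _ _) (•-cong (sym (sign-suc s j)) (≈-reflexive (cong X (e₂ d e w i j (T j)))))))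

      u⊕v : ∀ i j → u i j ⊕ v i j ≈ term′ e i j
      u⊕v zero zero = ⊕-identityʳ _
      u⊕v zero (suc j) = ≈-trans (⊕-identityˡ _) (v-suc 0 j)
      u⊕v (suc i) zero = ≈-trans (⊕-identityʳ _) (≈-trans (u-suc i 0) (·-congʳ (≈-trans
        (·-cong (≈-trans (≈-reflexive (cong X (ℕ.*-zeroʳ d))) X-zero) (≈-reflexive (Gauss-zeroʳ d i))) (·-identityˡ one))))
      u⊕v (suc i) (suc j) = ≈-trans (⊕-cong (u-suc i (suc j)) (v-suc (suc i) j))
        (solve 3 (λ a b c → a :* c :+ b :* c := (b :+ a) :* c) ≈-refl _ _ _)

    Q-+ : ∀ e N M → Q e (N + M) ≈ Q e N · Q (e + d * N) M
    Q-+ e zero M = ≈-trans (≈-reflexive (cong (λ e → Q e M) (sym (trans (cong (λ x → e + x) (ℕ.*-zeroʳ d)) (ℕ.+-identityʳ e))))) (≈-sym (·-identityˡ _))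
    Q-+ e (suc N) M = ≈-trans (·-congˡ (Q-+ (e + d) N M)) (≈-trans (≈-sym (·-assoc _ _ _))
      (·-congˡ (≈-reflexive (cong (λ e → Q e M) (lemma e d N)))))
      where
      lemma : ∀ e d N → e + d + d * N ≡ e + d * suc N
      lemma = ℕ-solver.solve-∀

    factor⁺ : ∀ e → factor (- sign s 1) e ≈ one ⊕ sign s 1 • X e
    factor⁺ e = ≈-trans (factor-≈ _ e) (⊕-congˡ (≈-trans (≈-sym (•-neg _ (X e))) (•-cong (ℤ.neg-involutive (sign s 1)) ≈-refl)))

    -- In the upper half of the product the second exponent is at least w, so q^w comes out of every
    -- factor.
    Q-upper : ∀ a r → Q (w + a) r ≈ X (w * r) · finProd (- sign s 1) a d r
    Q-upper a zero = ≈-sym (≈-trans (·-identityʳ _) (≈-trans (≈-reflexive (cong X (ℕ.*-zeroʳ w))) X-zero))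
    Q-upper a (suc r) = begin
      Q (w + a) (suc r)
        ≈⟨ ≈-trans (≈-reflexive (cong (Q (w + a)) (ℕ.+-comm 1 r))) (Q-+ (w + a) r 1) ⟩
      Q (w + a) r · ((X w ⊕ sign s 1 • X (w + a + d * r)) · one)
        ≈⟨ ·-cong (Q-upper a r) (≈-trans (·-identityʳ _) (⊕-cong (≈-sym (·-identityʳ _))
             (≈-trans (•-cong refl (≈-trans (≈-reflexive (cong X (ℕ.+-assoc w a (d * r)))) (X-+ w (a + d * r)))) (≈-sym (·-• _ _ _))))) ⟩
      X (w * r) · finProd (- sign s 1) a d r · (X w · one ⊕ X w · sign s 1 • X (a + d * r))
        ≈⟨ solve 4 (λ x f y z → x :* f :* (y :* con 1ℤ :+ y :* z) := y :* x :* (f :* (con 1ℤ :+ z))) ≈-refl _ _ _ _ ⟩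
      X w · X (w * r) · (finProd (- sign s 1) a d r · (one ⊕ sign s 1 • X (a + d * r)))
        ≈⟨ ·-cong (≈-trans (≈-reflexive (cong X (ℕ.*-suc w r))) (X-+ w (w * r)))
             (≈-trans (finProd-suc _ a d r) (·-congˡ (factor⁺ _))) ⟨
      X (w * suc r) · finProd (- sign s 1) a d (suc r) ∎
      where open ≈-Reasoning

    -- In the lower half it is the second monomial s q^(e+dk) that comes out, leaving 1 + s
    -- q^(w-e-dk). The hypothesis says that the exponents left over are b + d(r-1), ..., b + d, b,
    -- so the product over b appears in reverse order.
    Q-lower : ∀ b r e → w + d ≡ e + b + d * r → Q e r ≈ sign s r • X (e * r + d * T r) · finProd (- sign s 1) b d r
    Q-lower b zero e _ = ≈-sym (≈-trans (·-identityʳ _) (≈-trans (•-cong (sign-0 s) (≈-trans (≈-reflexive (cong X (lemma e d))) X-zero)) (1-• one)))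
      where
      lemma : ∀ e d → e * 0 + d * 0 ≡ 0
      lemma = ℕ-solver.solve-∀
    Q-lower b (suc r) e p = begin
      (X w ⊕ c • X e) · Q (e + d) r
        ≈⟨ ·-cong (⊕-congʳ split) (Q-lower b r (e + d) (trans p (l₁ e b d r))) ⟩
      (c • X e · c • X (b + d * r) ⊕ c • X e) · (sign s r • X ((e + d) * r + d * T r) · finProd (- c) b d r)
        ≈⟨ solve 4 (λ x y z f → (x :* y :+ x) :* (z :* f) := x :* z :* (f :* (con 1ℤ :+ y))) ≈-refl _ _ _ _ ⟩
      c • X e · sign s r • X ((e + d) * r + d * T r) · (finProd (- c) b d r · (one ⊕ c • X (b + d * r)))
        ≈⟨ ·-cong (≈-trans (monomial-· _ _ _ _) (•-cong (sym (sign-suc s r)) (≈-reflexive (cong X (l₂ e d r (T r))))))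
             (≈-sym (≈-trans (finProd-suc _ b d r) (·-congˡ (factor⁺ _)))) ⟩
      sign s (suc r) • X (e * suc r + d * T (suc r)) · finProd (- c) b d (suc r) ∎
      where
      open ≈-Reasoning
      c : ℤ
      c = sign s 1
      l₁ : ∀ e b d r → e + b + d * suc r ≡ e + d + b + d * r
      l₁ = ℕ-solver.solve-∀
      l₂ : ∀ e d r t → e + ((e + d) * r + d * t) ≡ e * suc r + d * (r + t)
      l₂ = ℕ-solver.solve-∀
      l₃ : ∀ e b d r → e + b + d * suc r ≡ e + (b + d * r) + d
      l₃ = ℕ-solver.solve-∀
      split : X w ≈ c • X e · c • X (b + d * r)
      split = ≈-sym (≈-trans (monomial-· _ _ _ _) (≈-trans (•-cong (sign² s 1)
        (≈-reflexive (cong X (ℕ.+-cancelʳ-≡ d _ _ (sym (trans p (l₃ e b d r))))))) (1-• (X w))))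

-- α k(k+1)/2 + β k(k-1)/2
exponent : ℕ → ℕ → ℤ → ℕ
exponent α β (+ n)    = α * T (suc n) + β * T n
exponent α β -[1+ n ] = α * T (suc n) + β * T (suc (suc n))

term : Bool → ℕ → ℕ → ℤ → PS
term s α β k = sign s ℤ.∣ k ∣ • X (exponent α β k)

-- Ramanujan's f(s q^α, s q^β) with s = ±1
θ : Bool → ℕ → ℕ → PS
θ s α β n = S (suc n) (term s α β) n

n≤T : ∀ n → n ≤ T (suc n)
n≤T n = ℕ.m≤m+n n (T n)

≤-* : ∀ {a} → 1 ≤ a → ∀ n → n ≤ a * n
≤-* {a} 1≤a n = ℕ.≤-trans (ℕ.≤-reflexive (sym (ℕ.*-identityˡ n))) (ℕ.*-monoˡ-≤ n 1≤a)

exponent-bound : ∀ {α β} → 1 ≤ α → 1 ≤ β → ∀ k → ℤ.∣ k ∣ ≤ exponent α β k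
exponent-bound 1≤α 1≤β (+ n)    = ℕ.m≤n⇒m≤n+o _ (ℕ.≤-trans (n≤T n) (≤-* 1≤α _))
exponent-bound 1≤α 1≤β -[1+ n ] = ℕ.m≤n⇒m≤o+n _ (ℕ.≤-trans (n≤T (suc n)) (≤-* 1≤β _))

term-vanish : ∀ s {α β m} → 1 ≤ α → 1 ≤ β → ∀ k → m ≤ ℤ.∣ k ∣ → term s α β k ≈[ m ] 𝟘
term-vanish s 1≤α 1≤β k m≤k = •-vanish (X-vanish _ (ℕ.≤-trans m≤k (exponent-bound 1≤α 1≤β k)))

θ-S : ∀ s {α β m N} → 1 ≤ α → 1 ≤ β → m ≤ N → θ s α β ≈[ m ] S N (term s α β)
θ-S s {α} {β} {m} {N} 1≤α 1≤β m≤N = truncated λ n n<m →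
  sym (below (S-vanish {suc n} {suc n} {N} (term-vanish s 1≤α 1≤β) (ℕ.≤-trans n<m m≤N)) n ℕ.≤-refl)

module _ (s : Bool) (α β n : ℕ) where

  private
    d w κ : ℕ
    d = α + β
    w = d * n
    -- The exponent of the monomial to be cancelled: αn + d T(n) comes from the lower n factors, wn
    -- from the upper n.
    κ = α * n + d * T n + w * n
    c : ℤ
    c = sign s 1

  gauss : ℤ → PS
  gauss = centred (Gauss d) n

  upper-exponent : ∀ i r → n ≡ i + r →
    d * T (n + i) + α * (n + i) + w * r ≡ κ + exponent α β (+ i)
  upper-exponent i r refl = trans (cong (λ t → d * t + α * (i + r + i) + d * (i + r) * r) (T-+ (i + r) i))
    (lemma α β i r (T (i + r)) (T i))
    where
    lemma : ∀ α β i r x y → (α + β) * (x + y + (i + r) * i) + α * (i + r + i) + (α + β) * (i + r) * r ≡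
      α * (i + r) + (α + β) * x + (α + β) * (i + r) * (i + r) + (α * (i + y) + β * y)
    lemma = ℕ-solver.solve-∀

  lower-exponent : ∀ i r → n ≡ suc i + r →
    d * T r + α * r + w * (n + suc i) ≡ κ + exponent α β -[1+ i ]
  lower-exponent i r refl = trans (lemma₁ α β i r (T r)) (trans
    (cong (λ x → α * r + (α + β) * (T r + suc i + x + suc i * r + (suc i + r) * (suc i + r))) (sym (2T i)))
    (trans (lemma₂ α β i r (T r) (T i))
      (cong (λ t → α * (suc i + r) + (α + β) * t + (α + β) * (suc i + r) * (suc i + r) + (α * (i + T i) + β * (suc i + (i + T i))))
        (sym (T-+ (suc i) r)))))
    where
    lemma₁ : ∀ α β i r x → (α + β) * x + α * r + (α + β) * (suc i + r) * (suc i + r + suc i) ≡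
      α * r + (α + β) * (x + suc i + suc i * i + suc i * r + (suc i + r) * (suc i + r))
    lemma₁ = ℕ-solver.solve-∀
    lemma₂ : ∀ α β i r x y → α * r + (α + β) * (x + suc i + 2 * (i + y) + suc i * r + (suc i + r) * (suc i + r)) ≡
      α * (suc i + r) + (α + β) * (i + y + x + suc i * r) + (α + β) * (suc i + r) * (suc i + r)
        + (α * (i + y) + β * (suc i + (i + y)))
    lemma₂ = ℕ-solver.solve-∀

  term′-term : ∀ G j e k → sign s j ≡ sign s n *ᶻ sign s ℤ.∣ k ∣ → e ≡ κ + exponent α β k →
    G · sign s j • X e ≈ sign s n • X κ · (G · term s α β k)
  term′-term G j e k p q = ≈-trans
    (·-congˡ (≈-trans (•-cong p (≈-reflexive (cong X q))) (≈-sym (monomial-· _ _ _ _))))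
    (solve 3 (λ a b c → a :* (b :* c) := b :* (a :* c)) ≈-refl _ _ _)

  upper-term : ∀ i → i ≤ n → term′ d s w α (n ∸ i) (n + i) ≈ sign s n • X κ · (gauss (+ i) · term s α β (+ i))
  upper-term i i≤n = term′-term _ (n + i) _ (+ i) (sign-+ s n i)
    (upper-exponent i (n ∸ i) (sym (ℕ.m+[n∸m]≡n i≤n)))

  lower-term : ∀ i → suc i ≤ n →
    term′ d s w α (n + suc i) (n ∸ suc i) ≈ sign s n • X κ · (gauss -[1+ i ] · term s α β -[1+ i ])
  lower-term i i<n = term′-term _ (n ∸ suc i) _ -[1+ i ] signs (lower-exponent i (n ∸ suc i) (sym (ℕ.m+[n∸m]≡n i<n)))
    where
    lemma : ∀ x y → x *ᶻ (y *ᶻ y) ≡ y *ᶻ x *ᶻ y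
    lemma = ℤ-solver.solve-∀
    signs : sign s (n ∸ suc i) ≡ sign s n *ᶻ sign s (suc i)
    signs = trans (sym (trans (cong (sign s (n ∸ suc i) *ᶻ_) (sign² s (suc i))) (ℤ.*-identityʳ _)))
      (trans (lemma (sign s (n ∸ suc i)) (sign s (suc i)))
        (cong (_*ᶻ sign s (suc i)) (trans (sym (sign-+ s (suc i) (n ∸ suc i))) (cong (sign s) (ℕ.m+[n∸m]≡n i<n)))))

  -- The product `Q` of 2n factors is evaluated twice: halved into `Q-lower` and `Q-upper`, and
  -- expanded by the q-binomial theorem around its middle term. Both values carry the same monomial,
  -- with sign (±1)^n and exponent κ.
  finite-triple-product : finProd (- c) α d n · finProd (- c) β d n ≈
    S n (λ k → gauss k · term s α β k) ⊕ Gauss d 0 (n + n) · term s α β (+ n)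
  finite-triple-product = X-cancel κ (begin
    X κ · (Fα · Fβ)
      ≈⟨ monomial-cancel (Fα · Fβ) ⟩
    sign s n • (sign s n • X κ · (Fα · Fβ))
      ≈⟨ •-cong refl (begin
        sign s n • X κ · (Fα · Fβ)
          ≈⟨ ·-congʳ (•-cong (sym (ℤ.*-identityʳ (sign s n))) ≈-refl) ⟩
        (sign s n *ᶻ 1ℤ) • X (α * n + d * T n + w * n) · (Fα · Fβ)
          ≈⟨ ·-congʳ (≈-trans (≈-sym (monomial-· _ _ _ _)) (·-congˡ (1-• _))) ⟩
        sign s n • X (α * n + d * T n) · X (w * n) · (Fα · Fβ)
          ≈⟨ solve 4 (λ x y a b → x :* y :* (a :* b) := x :* b :* (y :* a)) ≈-refl _ _ _ _ ⟩
        sign s n • X (α * n + d * T n) · Fβ · (X (w * n) · Fα)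
          ≈⟨ ·-cong (Q-lower d s w β n α (lemma d (d * n) )) (≈-trans (≈-reflexive (cong (λ e → Q d s w e n) (ℕ.+-comm α w))) (Q-upper d s w α n)) ⟨
        Q d s w α n · Q d s w (α + d * n) n
          ≈⟨ Q-+ d s w α n n ⟨
        Q d s w α (n + n)
          ≈⟨ q-binomial d s w α (n + n) ⟩
        D (term′ d s w α) (n + n)
          ≈⟨ D-centred (term′ d s w α) n ⟩
        S n (centred (term′ d s w α) n) ⊕ term′ d s w α 0 (n + n)
          ≈⟨ ⊕-cong (limit λ m → S-cong-< n (λ i i<n → ≈⇒≈[] (upper-term i (ℕ.<⇒≤ i<n))) (λ i i<n → ≈⇒≈[] (lower-term i i<n)))
               (term′-term _ (n + n) _ (+ n) (sign-+ s n n) (upper-exponent n 0 (sym (ℕ.+-identityʳ n)))) ⟩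
        S n (λ k → sign s n • X κ · (gauss k · term s α β k)) ⊕ sign s n • X κ · (Gauss d 0 (n + n) · term s α β (+ n))
          ≈⟨ ⊕-congʳ (S-· n _ _) ⟨
        sign s n • X κ · S n (λ k → gauss k · term s α β k) ⊕ sign s n • X κ · (Gauss d 0 (n + n) · term s α β (+ n))
          ≈⟨ ·-distribˡ _ _ _ ⟨
        sign s n • X κ · (S n (λ k → gauss k · term s α β k) ⊕ Gauss d 0 (n + n) · term s α β (+ n)) ∎) ⟩
    sign s n • (sign s n • X κ · (S n (λ k → gauss k · term s α β k) ⊕ Gauss d 0 (n + n) · term s α β (+ n)))
      ≈⟨ monomial-cancel _ ⟨
    X κ · (S n (λ k → gauss k · term s α β k) ⊕ Gauss d 0 (n + n) · term s α β (+ n)) ∎)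
    where
    open ≈-Reasoning
    Fα Fβ : PS
    Fα = finProd (- c) α d n
    Fβ = finProd (- c) β d n
    lemma : ∀ d x → x + d ≡ d + x
    lemma d x = ℕ.+-comm x d
    monomial-cancel : ∀ f → X κ · f ≈ sign s n • (sign s n • X κ · f)
    monomial-cancel f = ≈-sym (≈-trans (•-cong refl (•-· _ _ _)) (≈-trans (•-• _ _ _)
      (≈-trans (•-cong (sign² s n) ≈-refl) (1-• _))))

jacobi-triple-product : ∀ s {α β} → 1 ≤ α → 1 ≤ β →
  θ s α β ≈ E (α + β) · (P∞ (- sign s 1) α (α + β) · P∞ (- sign s 1) β (α + β))
jacobi-triple-product s {α} {β} 1≤α 1≤β = limit λ m → ≈[]-sym (truncation m)
  where
  d : ℕ
  d = α + β
  1≤d : 1 ≤ d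
  1≤d = ℕ.m≤n⇒m≤n+o β 1≤α
  c : ℤ
  c = - sign s 1
  t : ℤ → PS
  t = term s α β

  -- The truncation is at n = 2m: for |k| ≤ m both indices of the Gaussian binomial are then at
  -- least m, so `Gauss-limit` applies, and for larger |k| the theta term itself vanishes modulo
  -- q^m.
  summand : ∀ m k → E d · (gauss s α β (m + m) k · t k) ≈[ m ] t k
  summand m k with ℤ.∣ k ∣ ℕ.≤? m
  ... | no k≰m = ≈[]-trans (·-vanishʳ (·-vanishʳ vanish)) (≈[]-sym vanish)
    where
    vanish : t k ≈[ m ] 𝟘
    vanish = term-vanish s 1≤α 1≤β k (ℕ.<⇒≤ (ℕ.≰⇒> k≰m))
  ... | yes k≤m = ≈[]-trans (≈⇒≈[] (≈-sym (·-assoc _ _ _)))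
    (≈[]-trans (·-cong[] (middle k k≤m) ≈[]-refl) (≈⇒≈[] (·-identityˡ _)))
    where
    m≤2m∸ : ∀ i → i ≤ m → m ≤ m + m ∸ i
    m≤2m∸ i i≤m = ℕ.≤-trans (ℕ.m≤m+n m (m ∸ i)) (ℕ.≤-reflexive (sym (ℕ.+-∸-assoc m i≤m)))
    m≤2m+ : ∀ i → m ≤ m + m + i
    m≤2m+ i = ℕ.≤-trans (ℕ.m≤m+n m m) (ℕ.m≤m+n (m + m) i)
    middle : ∀ k → ℤ.∣ k ∣ ≤ m → E d · gauss s α β (m + m) k ≈[ m ] one
    middle (+ i)    i≤m = Gauss-limit d 1≤d (m≤2m∸ i i≤m) (m≤2m+ i)
    middle -[1+ i ] i≤m = Gauss-limit d 1≤d (m≤2m+ (suc i)) (m≤2m∸ (suc i) i≤m)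

  truncation : ∀ m → E d · (P∞ c α d · P∞ c β d) ≈[ m ] θ s α β
  truncation m = begin
    E d · (P∞ c α d · P∞ c β d)
      ≈⟨ ·-cong[] ≈[]-refl (·-cong[] (P∞-finProd c 1≤α 1≤d m≤n) (P∞-finProd c 1≤β 1≤d m≤n)) ⟩
    E d · (finProd c α d n · finProd c β d n)
      ≈⟨ ·-cong[] ≈[]-refl (≈⇒≈[] (finite-triple-product s α β n)) ⟩
    E d · (S n (λ k → gauss s α β n k · t k) ⊕ Gauss d 0 (n + n) · t (+ n))
      ≈⟨ ·-cong[] ≈[]-refl (⊕-cong[] ≈[]-refl (·-vanishʳ (term-vanish s 1≤α 1≤β (+ n) m≤n))) ⟩
    E d · (S n (λ k → gauss s α β n k · t k) ⊕ 𝟘)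
      ≈⟨ ≈⇒≈[] (≈-trans (·-congˡ (⊕-identityʳ _)) (S-· n (E d) _)) ⟩
    S n (λ k → E d · (gauss s α β n k · t k))
      ≈⟨ S-cong[] n (λ k _ → summand m k) ⟩
    S n t
      ≈⟨ θ-S s 1≤α 1≤β m≤n ⟨
    θ s α β ∎
    where
    open ≈[]-Reasoning m
    n : ℕ
    n = m + m
    m≤n : m ≤ n
    m≤n = ℕ.m≤m+n m m

-- Substitution q ↦ ±q^m

X-self : ∀ e → X e e ≡ 1ℤ
X-self e with e ℕ.≟ e
... | yes _   = refl
... | no e≢e  = ⊥-elim (e≢e refl)

X-other : ∀ {e n} → n ≢ e → X e n ≡ 0ℤ
X-other {e} {n} n≢e with n ℕ.≟ e
... | yes n≡e = ⊥-elim (n≢e n≡e)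
... | no _    = refl

-- The truncation of f below q^r as an explicit combination of monomials. Substitution respects
-- truncation and linear combinations, so its multiplicativity needs checking on monomials only.
polynomial : ℕ → PS → PS
polynomial zero    f = 𝟘
polynomial (suc r) f = polynomial r f ⊕ f r • X r

polynomial-high : ∀ {r n} f → r ≤ n → polynomial r f n ≡ 0ℤ
polynomial-high {zero} f _ = refl
polynomial-high {suc r} {n} f r<n = trans (⊕-at _ _ n) (cong₂ _+ᶻ_ (polynomial-high f (ℕ.<⇒≤ r<n))
  (trans (•-at (f r) (X r) n) (trans (cong (f r *ᶻ_) (X-other (ℕ.<⇒≢ r<n ∘ sym))) (ℤ.*-zeroʳ (f r)))))

polynomial-≈ : ∀ r f → f ≈[ r ] polynomial r f
polynomial-≈ zero f = truncated λ _ ()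
polynomial-≈ (suc r) f = truncated coefficient
  where
  coefficient : ∀ n → n < suc r → f n ≡ (polynomial r f ⊕ f r • X r) n
  coefficient n n<1+r with n ℕ.≟ r
  ... | yes refl = sym (trans (⊕-at _ _ n) (trans (cong₂ _+ᶻ_ (polynomial-high {n} f ℕ.≤-refl)
    (trans (•-at (f n) (X n) n) (trans (cong (f n *ᶻ_) (X-self n)) (ℤ.*-identityʳ (f n))))) (ℤ.+-identityˡ (f n))))
  ... | no n≢r = sym (trans (⊕-at _ _ n) (trans (cong₂ _+ᶻ_
    (sym (below (polynomial-≈ r f) n (ℕ.≤∧≢⇒< (ℕ.≤-pred n<1+r) n≢r)))
    (trans (•-at (f r) (X r) n) (trans (cong (f r *ᶻ_) (X-other n≢r)) (ℤ.*-zeroʳ (f r))))) (ℤ.+-identityʳ (f n))))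

module _ (neg : Bool) (m : ℕ) .{{_ : NonZero m}} where

  subst-cong[] : ∀ {f g r} → f ≈[ r ] g → subst neg m f ≈[ r ] subst neg m g
  subst-cong[] p = truncated λ n n<r → cong (λ x → if ⌊ n ℕ.% m ℕ.≟ 0 ⌋ then sign neg (n ℕ./ m) *ᶻ x else 0ℤ)
    (below p (n ℕ./ m) (ℕ.≤-<-trans (ℕ.m/n≤m n m) n<r))

  subst-cong : ∀ {f g} → f ≈ g → subst neg m f ≈ subst neg m g
  subst-cong p = limit λ r → subst-cong[] (≈⇒≈[] p)

  subst-𝟘 : subst neg m 𝟘 ≈ 𝟘
  subst-𝟘 = pointwise λ n → select (sign neg (n ℕ./ m)) ⌊ n ℕ.% m ℕ.≟ 0 ⌋
    where
    select : ∀ x b → (if b then x *ᶻ 0ℤ else 0ℤ) ≡ 0ℤ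
    select x true  = ℤ.*-zeroʳ x
    select x false = refl

  subst-⊕ : ∀ f g → subst neg m (f ⊕ g) ≈ subst neg m f ⊕ subst neg m g
  subst-⊕ f g = pointwise λ n → trans (select (sign neg (n ℕ./ m)) _ _ _ ⌊ n ℕ.% m ℕ.≟ 0 ⌋ (⊕-at f g _)) (sym (⊕-at _ _ n))
    where
    select : ∀ x y z w b → w ≡ y +ᶻ z →
      (if b then x *ᶻ w else 0ℤ) ≡ (if b then x *ᶻ y else 0ℤ) +ᶻ (if b then x *ᶻ z else 0ℤ)
    select x y z w true  refl = ℤ.*-distribˡ-+ x y z
    select x y z w false _    = refl

  subst-• : ∀ c f → subst neg m (c • f) ≈ c • subst neg m f
  subst-• c f = pointwise λ n → trans (select (sign neg (n ℕ./ m)) _ _ ⌊ n ℕ.% m ℕ.≟ 0 ⌋ (•-at c f _)) (sym (•-at c _ n))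
    where
    lemma : ∀ x c y → x *ᶻ (c *ᶻ y) ≡ c *ᶻ (x *ᶻ y)
    lemma = ℤ-solver.solve-∀
    select : ∀ x y w b → w ≡ c *ᶻ y → (if b then x *ᶻ w else 0ℤ) ≡ c *ᶻ (if b then x *ᶻ y else 0ℤ)
    select x y w true  refl = lemma x c y
    select x y w false _    = sym (ℤ.*-zeroʳ c)

  subst-X : ∀ e → subst neg m (X e) ≈ sign neg e • X (m * e)
  subst-X e = pointwise λ n → trans (coefficient n) (sym (•-at _ _ n))
    where
    coefficient : ∀ n → subst neg m (X e) n ≡ sign neg e *ᶻ X (m * e) n
    coefficient n with n ℕ.% m ℕ.≟ 0
    ... | no r≢0 = sym (trans (cong (sign neg e *ᶻ_) (X-other n≢me)) (ℤ.*-zeroʳ (sign neg e)))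
      where
      n≢me : n ≢ m * e
      n≢me refl = r≢0 (trans (cong (ℕ._% m) (ℕ.*-comm m e)) (ℕ.m*n%n≡0 e m))
    ... | yes r≡0 with n ℕ./ m ℕ.≟ e
    ...   | yes refl = cong (sign neg (n ℕ./ m) *ᶻ_)
              (sym (trans (cong (X (m * (n ℕ./ m))) n≡) (X-self _)))
      where
      n≡ : n ≡ m * (n ℕ./ m)
      n≡ = trans (ℕ.m≡m%n+[m/n]*n n m) (trans (cong (λ x → x + n ℕ./ m * m) r≡0) (ℕ.*-comm (n ℕ./ m) m))
    ...   | no n/m≢e = trans (ℤ.*-zeroʳ (sign neg (n ℕ./ m)))
              (sym (trans (cong (sign neg e *ᶻ_) (X-other n≢me)) (ℤ.*-zeroʳ (sign neg e))))
      where
      n≢me : n ≢ m * e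
      n≢me refl = n/m≢e (trans (cong (ℕ._/ m) (ℕ.*-comm m e)) (ℕ.m*n/n≡m e m))

  subst-X-· : ∀ e g → subst neg m (X e · g) ≈ subst neg m (X e) · subst neg m g
  subst-X-· e g = limit λ r → ≈[]-trans (subst-cong[] (·-cong[] ≈[]-refl (polynomial-≈ r g)))
    (≈[]-trans (≈⇒≈[] (on-polynomial r)) (≈[]-sym (·-cong[] ≈[]-refl (subst-cong[] (polynomial-≈ r g)))))
    where
    on-X : ∀ l → subst neg m (X e · X l) ≈ subst neg m (X e) · subst neg m (X l)
    on-X l = ≈-trans (subst-cong (≈-sym (X-+ e l))) (≈-trans (subst-X (e + l)) (≈-trans
      (•-cong (sign-+ neg e l) (≈-reflexive (cong X (ℕ.*-distribˡ-+ m e l))))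
      (≈-sym (≈-trans (·-cong (subst-X e) (subst-X l)) (monomial-· _ _ _ _)))))
    on-polynomial : ∀ r → subst neg m (X e · polynomial r g) ≈ subst neg m (X e) · subst neg m (polynomial r g)
    on-polynomial zero = ≈-trans (≈-trans (subst-cong (·-zeroʳ _)) subst-𝟘)
      (≈-sym (≈-trans (·-congˡ subst-𝟘) (·-zeroʳ _)))
    on-polynomial (suc r) = ≈-trans (subst-cong (≈-trans (·-distribˡ _ _ _) (⊕-congˡ (·-• _ _ _))))
      (≈-trans (subst-⊕ _ _) (≈-trans
        (⊕-cong (on-polynomial r) (≈-trans (subst-• _ _) (≈-trans (•-cong refl (on-X r)) (≈-sym (·-• _ _ _)))))
        (≈-sym (≈-trans (·-congˡ (≈-trans (subst-⊕ _ _) (⊕-congˡ (subst-• _ _)))) (·-distribˡ _ _ _)))))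

  subst-· : ∀ f g → subst neg m (f · g) ≈ subst neg m f · subst neg m g
  subst-· f g = limit λ r → ≈[]-trans (subst-cong[] (·-cong[] (polynomial-≈ r f) ≈[]-refl))
    (≈[]-trans (≈⇒≈[] (on-polynomial r)) (≈[]-sym (·-cong[] (subst-cong[] (polynomial-≈ r f)) ≈[]-refl)))
    where
    on-polynomial : ∀ r → subst neg m (polynomial r f · g) ≈ subst neg m (polynomial r f) · subst neg m g
    on-polynomial zero = ≈-trans (≈-trans (subst-cong (·-zeroˡ _)) subst-𝟘)
      (≈-sym (≈-trans (·-congʳ subst-𝟘) (·-zeroˡ _)))
    on-polynomial (suc r) = ≈-trans (subst-cong (≈-trans (·-distribʳ _ _ _) (⊕-congˡ (•-· _ _ _))))
      (≈-trans (subst-⊕ _ _) (≈-trans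
        (⊕-cong (on-polynomial r) (≈-trans (subst-• _ _) (≈-trans (•-cong refl (subst-X-· r g)) (≈-sym (•-· _ _ _)))))
        (≈-sym (≈-trans (·-congʳ (≈-trans (subst-⊕ _ _) (⊕-congˡ (subst-• _ _)))) (·-distribʳ _ _ _)))))

  subst-S : ∀ N (f : ℤ → PS) → subst neg m (S N f) ≈ S N (λ k → subst neg m (f k))
  subst-S zero    f = subst-𝟘
  subst-S (suc N) f = ≈-trans (subst-⊕ _ _) (⊕-cong (subst-S N f) (subst-⊕ _ _))

  subst-one : subst neg m one ≈ one
  subst-one = ≈-trans (subst-cong (≈-sym X-zero)) (≈-trans (subst-X 0)
    (≈-trans (•-cong (sign-0 neg) (≈-trans (≈-reflexive (cong X (ℕ.*-zeroʳ m))) X-zero)) (1-• one)))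

  subst-⊝ : ∀ f → subst neg m (⊝ f) ≈ ⊝ subst neg m f
  subst-⊝ f = ≈-trans (subst-cong (⊝-• f)) (≈-trans (subst-• _ f) (≈-sym (⊝-• _)))
    where
    ⊝-• : ∀ f → ⊝ f ≈ (- 1ℤ) • f
    ⊝-• f = ≈-sym (≈-trans (•-neg 1ℤ f) (⊝-cong (1-• f)))

-- Doubling clears the halves in the triangular numbers. Exponents become integer polynomials in k,
-- uniform in the sign of k, and comparing them is a matter for the ring solver.
2*exponent : ∀ α β k → + 2 *ᶻ + exponent α β k ≡ (+ α +ᶻ + β) *ᶻ k *ᶻ k +ᶻ (+ α - + β) *ᶻ k
2*exponent α β (+ n) = trans
  (cong (+ 2 *ᶻ_) (trans (ℤ.pos-+ (α * (n + T n)) (β * T n))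
    (cong₂ _+ᶻ_ (trans (ℤ.pos-* α (n + T n)) (cong (+ α *ᶻ_) (ℤ.pos-+ n (T n)))) (ℤ.pos-* β (T n)))))
  (trans (lemma₁ (+ α) (+ β) (+ n) (+ T n)) (trans
    (cong (λ x → (+ α +ᶻ + β) *ᶻ x - + 2 *ᶻ + β *ᶻ + n) h) (lemma₂ (+ α) (+ β) (+ n))))
  where
  h : + 2 *ᶻ (+ n +ᶻ + T n) ≡ (1ℤ +ᶻ + n) *ᶻ + n
  h = trans (sym (ℤ.pos-* 2 (n + T n))) (trans (cong +_ (2T n)) (ℤ.pos-* (suc n) n))
  lemma₁ : ∀ α β n t → + 2 *ᶻ (α *ᶻ (n +ᶻ t) +ᶻ β *ᶻ t) ≡ (α +ᶻ β) *ᶻ (+ 2 *ᶻ (n +ᶻ t)) - + 2 *ᶻ β *ᶻ n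
  lemma₁ = ℤ-solver.solve-∀
  lemma₂ : ∀ α β n → (α +ᶻ β) *ᶻ ((1ℤ +ᶻ n) *ᶻ n) - + 2 *ᶻ β *ᶻ n ≡ (α +ᶻ β) *ᶻ n *ᶻ n +ᶻ (α - β) *ᶻ n
  lemma₂ = ℤ-solver.solve-∀
2*exponent α β -[1+ n ] = trans
  (cong (+ 2 *ᶻ_) (trans (ℤ.pos-+ (α * u) (β * (suc n + u)))
    (cong₂ _+ᶻ_ (ℤ.pos-* α u) (trans (ℤ.pos-* β (suc n + u)) (cong (+ β *ᶻ_) (ℤ.pos-+ (suc n) u))))))
  (trans (lemma₁ (+ α) (+ β) (+ n) (+ u)) (trans
    (cong (λ x → (+ α +ᶻ + β) *ᶻ x +ᶻ + 2 *ᶻ + β *ᶻ (1ℤ +ᶻ + n)) h) (lemma₂ (+ α) (+ β) (+ n))))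
  where
  u : ℕ
  u = T (suc n)
  h : + 2 *ᶻ + u ≡ (1ℤ +ᶻ + n) *ᶻ + n
  h = trans (sym (ℤ.pos-* 2 (n + T n))) (trans (cong +_ (2T n)) (ℤ.pos-* (suc n) n))
  lemma₁ : ∀ α β n u → + 2 *ᶻ (α *ᶻ u +ᶻ β *ᶻ ((1ℤ +ᶻ n) +ᶻ u)) ≡ (α +ᶻ β) *ᶻ (+ 2 *ᶻ u) +ᶻ + 2 *ᶻ β *ᶻ (1ℤ +ᶻ n)
  lemma₁ = ℤ-solver.solve-∀
  lemma₂ : ∀ α β n → (α +ᶻ β) *ᶻ ((1ℤ +ᶻ n) *ᶻ n) +ᶻ + 2 *ᶻ β *ᶻ (1ℤ +ᶻ n) ≡
    (α +ᶻ β) *ᶻ (- (1ℤ +ᶻ n)) *ᶻ (- (1ℤ +ᶻ n)) +ᶻ (α - β) *ᶻ (- (1ℤ +ᶻ n))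
  lemma₂ = ℤ-solver.solve-∀

2*-cancel : ∀ {i j} → + 2 *ᶻ i ≡ + 2 *ᶻ j → i ≡ j
2*-cancel {i} {j} = ℤ.*-cancelˡ-≡ (+ 2) i j

exponent-* : ∀ m α β k → exponent (m * α) (m * β) k ≡ m * exponent α β k
exponent-* m α β (+ n)    = lemma m α β (T (suc n)) (T n)
  where
  lemma : ∀ m α β x y → m * α * x + m * β * y ≡ m * (α * x + β * y)
  lemma = ℕ-solver.solve-∀
exponent-* m α β -[1+ n ] = lemma m α β (T (suc n)) (T (suc (suc n)))
  where
  lemma : ∀ m α β x y → m * α * x + m * β * y ≡ m * (α * x + β * y)
  lemma = ℕ-solver.solve-∀

module _ {neg s s′ : Bool} {α β m : ℕ} .{{_ : NonZero m}} (1≤α : 1 ≤ α) (1≤β : 1 ≤ β)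
         (signs : ∀ k → sign s ℤ.∣ k ∣ *ᶻ sign neg (exponent α β k) ≡ sign s′ ℤ.∣ k ∣) where

  subst-θ : subst neg m (θ s α β) ≈ θ s′ (m * α) (m * β)
  subst-θ = limit λ r → ≈[]-trans (subst-cong[] neg m (θ-S s 1≤α 1≤β ℕ.≤-refl))
    (≈[]-trans (≈⇒≈[] (≈-trans (subst-S neg m r (term s α β)) (S-cong r on-term)))
      (≈[]-sym (θ-S s′ (ℕ.*-mono-≤ 1≤m 1≤α) (ℕ.*-mono-≤ 1≤m 1≤β) ℕ.≤-refl)))
    where
    1≤m : 1 ≤ m
    1≤m = ℕ.>-nonZero⁻¹ m
    on-term : ∀ k → subst neg m (term s α β k) ≈ term s′ (m * α) (m * β) k
    on-term k = ≈-trans (subst-• neg m _ _) (≈-trans (•-cong refl (subst-X neg m _)) (≈-trans (•-• _ _ _)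
      (•-cong (signs k) (≈-reflexive (cong X (sym (exponent-* m α β k)))))))

dilate-θ : ∀ s {α β} m .{{_ : NonZero m}} → 1 ≤ α → 1 ≤ β → subst false m (θ s α β) ≈ θ s (m * α) (m * β)
dilate-θ s m 1≤α 1≤β = subst-θ {false} {s} {s} 1≤α 1≤β (λ k → ℤ.*-identityʳ _)

-- With α = 2a + 1 and β = 2b + 1 the exponent is k² + a k(k+1) + b k(k-1), which has the parity of
-- k. Hence q ↦ -q negates both arguments of the theta function.
sign-exponent : ∀ a b k → sign true (exponent (suc (2 * a)) (suc (2 * b)) k) ≡ sign true ℤ.∣ k ∣
sign-exponent a b k = trans (cong (sign true) (parity k)) (trans (sign-+ true ℤ.∣ k ∣ (half k + half k))
  (trans (cong (sign true ℤ.∣ k ∣ *ᶻ_) (trans (sign-+ true (half k) (half k)) (sign² true (half k)))) (ℤ.*-identityʳ _)))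
  where
  half : ℤ → ℕ
  half (+ n)    = a * n + (a + b + 1) * T n
  half -[1+ n ] = b * suc n + (a + b + 1) * T (suc n)
  lemma₁ : ∀ a b n t → suc (2 * a) * (n + t) + suc (2 * b) * t ≡ n + (a * n + (a + b + 1) * t + (a * n + (a + b + 1) * t))
  lemma₁ = ℕ-solver.solve-∀
  lemma₂ : ∀ a b n t → suc (2 * a) * t + suc (2 * b) * (n + t) ≡ n + (b * n + (a + b + 1) * t + (b * n + (a + b + 1) * t))
  lemma₂ = ℕ-solver.solve-∀
  parity : ∀ k → exponent (suc (2 * a)) (suc (2 * b)) k ≡ ℤ.∣ k ∣ + (half k + half k)
  parity (+ n)    = lemma₁ a b n (T n)
  parity -[1+ n ] = lemma₂ a b (suc n) (T (suc n))

alternate-θ : ∀ a b m .{{_ : NonZero m}} →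
  subst true m (θ false (suc (2 * a)) (suc (2 * b))) ≈ θ true (m * suc (2 * a)) (m * suc (2 * b))
alternate-θ a b m = subst-θ {true} {false} {true} 1≤ 1≤ (λ k → trans (ℤ.*-identityˡ _) (sign-exponent a b k))

-- φ and ψ as theta series: counting representations

sum-snoc : ∀ (g : ℕ → ℤ) n → sumℤ (applyUpTo g (suc n)) ≡ sumℤ (applyUpTo g n) +ᶻ g n
sum-snoc g zero    = ℤ.+-comm (g 0) 0ℤ
sum-snoc g (suc n) = trans (cong (g 0 +ᶻ_) (sum-snoc (g ∘ suc) n)) (sym (ℤ.+-assoc (g 0) _ _))

S-at : ∀ N (f : ℤ → PS) n →
  S N f n ≡ sumℤ (applyUpTo (λ i → f (+ i) n) N) +ᶻ sumℤ (applyUpTo (λ i → f -[1+ i ] n) N)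
S-at zero    f n = refl
S-at (suc N) f n
  rewrite ⊕-at (S N f) (f (+ N) ⊕ f -[1+ N ]) n | ⊕-at (f (+ N)) (f -[1+ N ]) n | S-at N f n
        | sum-snoc (λ i → f (+ i) n) N | sum-snoc (λ i → f -[1+ i ] n) N =
  lemma (sumℤ (applyUpTo (λ i → f (+ i) n) N)) (sumℤ (applyUpTo (λ i → f -[1+ i ] n) N)) (f (+ N) n) (f -[1+ N ] n)
  where
  lemma : ∀ a b c d → a +ᶻ b +ᶻ (c +ᶻ d) ≡ a +ᶻ c +ᶻ (b +ᶻ d)
  lemma = ℤ-solver.solve-∀

sumℤ-++ : ∀ xs ys → sumℤ (xs ++ ys) ≡ sumℤ xs +ᶻ sumℤ ys
sumℤ-++ []       ys = sym (ℤ.+-identityˡ _)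
sumℤ-++ (x ∷ xs) ys = trans (cong (x +ᶻ_) (sumℤ-++ xs ys)) (sym (ℤ.+-assoc x _ _))

module _ (e : ℤ → ℤ) {α β : ℕ} (1≤α : 1 ≤ α) (1≤β : 1 ≤ β) (e≡ : ∀ k → e k ≡ + exponent α β k) where

  count : ∀ n xs → + length (filter (λ k → e k ℤ.≟ + n) xs) ≡ sumℤ (map (λ k → term false α β k n) xs)
  count n [] = refl
  count n (k ∷ xs) with e k ℤ.≟ + n
  ... | yes p rewrite sym (ℤ.+-injective (trans (sym (e≡ k)) p)) =
    cong₂ _+ᶻ_ (sym (trans (•-at 1ℤ (X (exponent α β k)) _) (trans (ℤ.*-identityˡ _) (X-self _)))) (count _ xs)
  ... | no p = trans (count n xs) (sym (trans (cong (_+ᶻ _)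
    (trans (•-at 1ℤ _ n) (trans (ℤ.*-identityˡ _) (X-other (λ q → p (trans (e≡ k) (cong +_ (sym q)))))))) (ℤ.+-identityˡ _)))

  count-θ : ∀ n → + length (filter (λ k → e k ℤ.≟ + n) (intRange n)) ≡ θ false α β n
  count-θ n = begin
    + length (filter (λ k → e k ℤ.≟ + n) (intRange n))
      ≡⟨ count n (intRange n) ⟩
    sumℤ (map h (map +_ (upTo (suc n)) ++ map -[1+_] (upTo n)))
      ≡⟨ cong sumℤ (List.map-++ h (map +_ (upTo (suc n))) _) ⟩
    sumℤ (map h (map +_ (upTo (suc n))) ++ map h (map -[1+_] (upTo n)))
      ≡⟨ sumℤ-++ (map h (map +_ (upTo (suc n)))) _ ⟩
    sumℤ (map h (map +_ (upTo (suc n)))) +ᶻ sumℤ (map h (map -[1+_] (upTo n)))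
      ≡⟨ cong₂ _+ᶻ_ (flatten +_ (suc n)) (flatten -[1+_] n) ⟩
    sumℤ (applyUpTo (h ∘ +_) (suc n)) +ᶻ sumℤ (applyUpTo (h ∘ -[1+_]) n)
      -- `intRange n` stops at -n, whereas the theta sum also contains k = -n-1; that term has
      -- exponent above n and contributes 0.
      ≡⟨ cong (sumℤ (applyUpTo (h ∘ +_) (suc n)) +ᶻ_) (sym (trans (sum-snoc (h ∘ -[1+_]) n)
           (trans (cong (sumℤ (applyUpTo (h ∘ -[1+_]) n) +ᶻ_)
             (below (term-vanish false {m = suc n} 1≤α 1≤β -[1+ n ] ℕ.≤-refl) n ℕ.≤-refl)) (ℤ.+-identityʳ _)))) ⟩
    sumℤ (applyUpTo (h ∘ +_) (suc n)) +ᶻ sumℤ (applyUpTo (h ∘ -[1+_]) (suc n))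
      ≡⟨ S-at (suc n) (term false α β) n ⟨
    θ false α β n ∎
    where
    open ≡-Reasoning
    h : ℤ → ℤ
    h k = term false α β k n
    flatten : ∀ (c : ℕ → ℤ) N → sumℤ (map h (map c (upTo N))) ≡ sumℤ (applyUpTo (h ∘ c) N)
    flatten c N = trans (cong sumℤ (sym (List.map-∘ (upTo N)))) (sumℤ-applyUpTo (h ∘ c) id N)

ψ-θ : ψ ≈ θ false 3 1
ψ-θ = pointwise (count-θ (λ k → + 2 *ᶻ k *ᶻ k +ᶻ k) 1≤ 1≤
  (λ k → 2*-cancel (trans (lemma k) (sym (2*exponent 3 1 k)))))
  where
  lemma : ∀ k → + 2 *ᶻ (+ 2 *ᶻ k *ᶻ k +ᶻ k) ≡ (+ 3 +ᶻ + 1) *ᶻ k *ᶻ k +ᶻ (+ 3 - + 1) *ᶻ k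
  lemma = ℤ-solver.solve-∀

φ-θ : φ ≈ θ false 1 1
φ-θ = pointwise (count-θ (λ k → k *ᶻ k) 1≤ 1≤
  (λ k → 2*-cancel (trans (lemma k) (sym (2*exponent 1 1 k)))))
  where
  lemma : ∀ k → + 2 *ᶻ (k *ᶻ k) ≡ (+ 1 +ᶻ + 1) *ᶻ k *ᶻ k +ᶻ (+ 1 - + 1) *ᶻ k
  lemma = ℤ-solver.solve-∀

-- The character (±1)^k on the integers, and doubled exponents

sgn-suc : ∀ s k → sign s ℤ.∣ ℤ.suc k ∣ ≡ sign s 1 *ᶻ sign s ℤ.∣ k ∣
sgn-suc s (+ n)            = sign-suc s n
sgn-suc false -[1+ n ]     = refl
sgn-suc true -[1+ zero ]   = refl
sgn-suc true -[1+ suc n ]  = lemma (sign true n)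
  where
  lemma : ∀ x → - x ≡ - 1ℤ *ᶻ - (- x)
  lemma = ℤ-solver.solve-∀

sgn-pred : ∀ s k → sign s ℤ.∣ ℤ.pred k ∣ ≡ sign s 1 *ᶻ sign s ℤ.∣ k ∣
sgn-pred s k = sym (trans (cong (sign s 1 *ᶻ_) (trans (cong (λ i → sign s ℤ.∣ i ∣) (sym (ℤ.suc-pred k))) (sgn-suc s (ℤ.pred k))))
  (trans (sym (ℤ.*-assoc (sign s 1) (sign s 1) _)) (trans (cong (_*ᶻ sign s ℤ.∣ ℤ.pred k ∣) (sign² s 1)) (ℤ.*-identityˡ _))))

sgn-+ : ∀ s k l → sign s ℤ.∣ k +ᶻ l ∣ ≡ sign s ℤ.∣ k ∣ *ᶻ sign s ℤ.∣ l ∣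
sgn-+ false k l = refl
sgn-+ true (+ zero) l = trans (cong (λ i → sign true ℤ.∣ i ∣) (ℤ.+-identityˡ l)) (sym (ℤ.*-identityˡ _))
sgn-+ true (+ suc n) l = trans (cong (λ i → sign true ℤ.∣ i ∣) (ℤ.suc-+ n l)) (trans (sgn-suc true (+ n +ᶻ l))
  (trans (cong (- 1ℤ *ᶻ_) (sgn-+ true (+ n) l)) (lemma (sign true n) (sign true ℤ.∣ l ∣))))
  where
  lemma : ∀ x y → - 1ℤ *ᶻ (x *ᶻ y) ≡ - x *ᶻ y
  lemma = ℤ-solver.solve-∀
sgn-+ true -[1+ zero ] l = sgn-pred true l
sgn-+ true -[1+ suc n ] l = trans (cong (λ i → sign true ℤ.∣ i ∣) (ℤ.pred-+ -[1+ n ] l)) (trans (sgn-pred true (-[1+ n ] +ᶻ l))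
  (trans (cong (- 1ℤ *ᶻ_) (sgn-+ true -[1+ n ] l)) (lemma (sign true (suc n)) (sign true ℤ.∣ l ∣))))
  where
  lemma : ∀ x y → - 1ℤ *ᶻ (x *ᶻ y) ≡ - x *ᶻ y
  lemma = ℤ-solver.solve-∀

flip-≡ : ∀ k → flip k ≡ - 1ℤ - k
flip-≡ (+ zero)  = refl
flip-≡ (+ suc n) = refl
flip-≡ -[1+ n ]  = refl

sgn-neg : ∀ s k → sign s ℤ.∣ - k ∣ ≡ sign s ℤ.∣ k ∣
sgn-neg s k = cong (sign s) (ℤ.∣-i∣≡∣i∣ k)

sgn-flip : ∀ s k → sign s ℤ.∣ flip k ∣ ≡ sign s 1 *ᶻ sign s ℤ.∣ k ∣
sgn-flip s k = trans (cong (λ i → sign s ℤ.∣ i ∣) (flip-≡ k))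
  (trans (sgn-+ s (- 1ℤ) (- k)) (cong (sign s 1 *ᶻ_) (sgn-neg s k)))

sgn-3* : ∀ s k → sign s ℤ.∣ k +ᶻ k +ᶻ k ∣ ≡ sign s ℤ.∣ k ∣
sgn-3* s k = trans (sgn-+ s (k +ᶻ k) k) (trans (cong (_*ᶻ sign s ℤ.∣ k ∣) (trans (sgn-+ s k k) (sign² s ℤ.∣ k ∣))) (ℤ.*-identityˡ _))

twice : ℕ → ℤ
twice n = + 2 *ᶻ + n

twice-injective : ∀ {a b} → twice a ≡ twice b → a ≡ b
twice-injective p = ℤ.+-injective (2*-cancel p)

twice-+ : ∀ a b → twice (a + b) ≡ twice a +ᶻ twice b
twice-+ a b = trans (cong (+ 2 *ᶻ_) (ℤ.pos-+ a b)) (ℤ.*-distribˡ-+ (+ 2) (+ a) (+ b))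

twice-* : ∀ a b → twice (a * b) ≡ + a *ᶻ twice b
twice-* a b = trans (cong (+ 2 *ᶻ_) (ℤ.pos-* a b)) (lemma (+ a) (+ b))
  where
  lemma : ∀ x y → + 2 *ᶻ (x *ᶻ y) ≡ x *ᶻ (+ 2 *ᶻ y)
  lemma = ℤ-solver.solve-∀

1≤* : ∀ {m n} → 1 ≤ m → 1 ≤ n → 1 ≤ m * n
1≤* = ℕ.*-mono-≤

term-≈ : ∀ {c c′ e e′} → c ≡ c′ → e ≡ e′ → c • X e ≈ c′ • X e′
term-≈ p q = •-cong p (≈-reflexive (cong X q))

-- Trisection of ψ

dilate₃ : PS → PS
dilate₃ = subst false 3

dilate₃-X : ∀ e → dilate₃ (X e) ≈ X (3 * e)
dilate₃-X e = ≈-trans (subst-X false 3 e) (1-• _)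

dilate₃-term : ∀ s α β k → dilate₃ (term s α β k) ≈ sign s ℤ.∣ k ∣ • X (3 * exponent α β k)
dilate₃-term s α β k = ≈-trans (subst-• false 3 _ _) (•-cong refl (dilate₃-X _))

-- f(q^2m, q^m) when s = +1 and its image under q ↦ -q when s = -1 and m is odd
trisected : Bool → ℕ → PS
trisected s m = θ s (m * 7) (m * 5) ⊕ sign s 1 • (X m · θ s (m * 11) (m * 1))

-- For the exponent 2k² + k the classes k = 3j and k = 3j + 1 give 3(6j² + j) and 3 + 3(6j² + 5j),
-- both divisible by 3; together they form `trisected`. The class k = 3j + 2, reflected by `flip`,
-- gives 1 + 3(6j² + 3j).
trisection : ∀ s m → 1 ≤ m → θ s (m * 3) (m * 1) ≈
  dilate₃ (trisected s m) ⊕ sign s 1 • (X m · dilate₃ (θ s (m * 9) (m * 3)))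
trisection s m 1≤m = limit λ r → begin
  θ s (m * 3) (m * 1)
    ≈⟨ θ-S s (1≤* 1≤m 1≤) (1≤* 1≤m 1≤) (≤-triple r) ⟩
  S (triple r) t
    ≈⟨ ≈⇒≈[] (S-triple r t) ⟩
  S r (λ j → t (j +ᶻ j +ᶻ j)) ⊕ S r (λ j → t (j +ᶻ j +ᶻ j +ᶻ + 1)) ⊕ S r (λ j → t (j +ᶻ j +ᶻ j +ᶻ + 2))
    ≈⟨ ⊕-cong[] (⊕-cong[]
         (≈⇒≈[] (≈-trans (S-cong r t₀) (≈-sym (subst-S false 3 r _))))
         (≈⇒≈[] (≈-trans (S-cong r t₁) (pull r (3 * m) (term s (m * 11) (m * 1))))))
         (≈⇒≈[] (≈-trans (≈-sym (S-flip r _)) (≈-trans (S-cong r t₂) (pull r m (term s (m * 9) (m * 3)))))) ⟩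
  dilate₃ (S r (term s (m * 7) (m * 5))) ⊕ c • (X (3 * m) · dilate₃ (S r (term s (m * 11) (m * 1))))
    ⊕ c • (X m · dilate₃ (S r (term s (m * 9) (m * 3))))
    ≈⟨ ⊕-cong[] (⊕-cong[]
         (subst-cong[] false 3 (θ-S s (1≤* 1≤m 1≤) (1≤* 1≤m 1≤) ℕ.≤-refl))
         (•-cong[] (·-cong[] ≈[]-refl (subst-cong[] false 3 (θ-S s (1≤* 1≤m 1≤) (1≤* 1≤m 1≤) ℕ.≤-refl)))))
         (•-cong[] (·-cong[] ≈[]-refl (subst-cong[] false 3 (θ-S s (1≤* 1≤m 1≤) (1≤* 1≤m 1≤) ℕ.≤-refl)))) ⟨
  dilate₃ (θ s (m * 7) (m * 5)) ⊕ c • (X (3 * m) · dilate₃ (θ s (m * 11) (m * 1)))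
    ⊕ c • (X m · dilate₃ (θ s (m * 9) (m * 3)))
    ≈⟨ ≈⇒≈[] (⊕-congʳ (≈-sym (≈-trans (subst-⊕ false 3 _ _) (⊕-congˡ (≈-trans (subst-• false 3 _ _)
         (•-cong refl (≈-trans (subst-· false 3 _ _) (·-congʳ (dilate₃-X m))))))))) ⟩
  dilate₃ (trisected s m) ⊕ c • (X m · dilate₃ (θ s (m * 9) (m * 3))) ∎
  where
  open module R {r} = ≈[]-Reasoning r
  c : ℤ
  c = sign s 1
  t : ℤ → PS
  t = term s (m * 3) (m * 1)

  pull : ∀ r e (f : ℤ → PS) → S r (λ j → c • (X e · dilate₃ (f j))) ≈ c • (X e · dilate₃ (S r f))
  pull r e f = ≈-trans (≈-sym (S-• r c _)) (•-cong refl (≈-trans (≈-sym (S-· r _ _)) (·-congˡ (≈-sym (subst-S false 3 r f)))))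

  scaled : ∀ k α β j x → exponent 3 1 k ≡ x + 3 * exponent α β j →
    exponent (m * 3) (m * 1) k ≡ m * x + 3 * exponent (m * α) (m * β) j
  scaled k α β j x p = trans (exponent-* m 3 1 k) (trans (cong (m *_) p) (trans (lemma m x (exponent α β j))
    (cong (λ y → m * x + 3 * y) (sym (exponent-* m α β j)))))
    where
    lemma : ∀ m x y → m * (x + 3 * y) ≡ m * x + 3 * (m * y)
    lemma = ℕ-solver.solve-∀

  joined : ∀ e α β j → sign s ℤ.∣ j ∣ • X (e + 3 * exponent α β j) ≈ X e · dilate₃ (term s α β j)
  joined e α β j = ≈-sym (≈-trans (·-congˡ (dilate₃-term s α β j)) (≈-trans (·-• _ _ _) (•-cong refl (≈-sym (X-+ _ _)))))

  t₀ : ∀ j → t (j +ᶻ j +ᶻ j) ≈ dilate₃ (term s (m * 7) (m * 5) j)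
  t₀ j = ≈-trans (term-≈ (sgn-3* s j) (trans (scaled (j +ᶻ j +ᶻ j) 7 5 j 0 eq) (cong (_+ 3 * exponent (m * 7) (m * 5) j) (ℕ.*-zeroʳ m))))
    (≈-sym (dilate₃-term s _ _ j))
    where
    lemma : ∀ j → (+ 3 +ᶻ + 1) *ᶻ (j +ᶻ j +ᶻ j) *ᶻ (j +ᶻ j +ᶻ j) +ᶻ (+ 3 - + 1) *ᶻ (j +ᶻ j +ᶻ j) ≡
      + 3 *ᶻ ((+ 7 +ᶻ + 5) *ᶻ j *ᶻ j +ᶻ (+ 7 - + 5) *ᶻ j)
    lemma = ℤ-solver.solve-∀
    eq : exponent 3 1 (j +ᶻ j +ᶻ j) ≡ 3 * exponent 7 5 j
    eq = twice-injective (trans (2*exponent 3 1 (j +ᶻ j +ᶻ j)) (trans (lemma j)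
      (sym (trans (twice-* 3 (exponent 7 5 j)) (cong (+ 3 *ᶻ_) (2*exponent 7 5 j))))))

  t₁ : ∀ j → t (j +ᶻ j +ᶻ j +ᶻ + 1) ≈ c • (X (3 * m) · dilate₃ (term s (m * 11) (m * 1) j))
  t₁ j = ≈-trans (term-≈ signs (trans (scaled k 11 1 j 3 eq) (cong (_+ 3 * exponent (m * 11) (m * 1) j) (ℕ.*-comm m 3))))
    (≈-trans (≈-sym (•-• _ _ _)) (•-cong refl (joined (3 * m) _ _ j)))
    where
    k : ℤ
    k = j +ᶻ j +ᶻ j +ᶻ + 1
    signs : sign s ℤ.∣ k ∣ ≡ c *ᶻ sign s ℤ.∣ j ∣
    signs = trans (sgn-+ s (j +ᶻ j +ᶻ j) (+ 1)) (trans (ℤ.*-comm _ c) (cong (c *ᶻ_) (sgn-3* s j)))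
    lemma : ∀ j → (+ 3 +ᶻ + 1) *ᶻ (j +ᶻ j +ᶻ j +ᶻ + 1) *ᶻ (j +ᶻ j +ᶻ j +ᶻ + 1) +ᶻ (+ 3 - + 1) *ᶻ (j +ᶻ j +ᶻ j +ᶻ + 1) ≡
      + 6 +ᶻ + 3 *ᶻ ((+ 11 +ᶻ + 1) *ᶻ j *ᶻ j +ᶻ (+ 11 - + 1) *ᶻ j)
    lemma = ℤ-solver.solve-∀
    eq : exponent 3 1 k ≡ 3 + 3 * exponent 11 1 j
    eq = twice-injective (trans (2*exponent 3 1 k) (trans (lemma j) (sym (trans (twice-+ 3 (3 * exponent 11 1 j))
      (cong (+ 6 +ᶻ_) (trans (twice-* 3 (exponent 11 1 j)) (cong (+ 3 *ᶻ_) (2*exponent 11 1 j))))))))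

  t₂ : ∀ j → t (flip j +ᶻ flip j +ᶻ flip j +ᶻ + 2) ≈ c • (X m · dilate₃ (term s (m * 9) (m * 3) j))
  t₂ j = ≈-trans (term-≈ signs (trans (scaled k 9 3 j 1 eq) (cong (_+ 3 * exponent (m * 9) (m * 3) j) (ℕ.*-identityʳ m))))
    (≈-trans (≈-sym (•-• _ _ _)) (•-cong refl (joined m _ _ j)))
    where
    k : ℤ
    k = flip j +ᶻ flip j +ᶻ flip j +ᶻ + 2
    signs : sign s ℤ.∣ k ∣ ≡ c *ᶻ sign s ℤ.∣ j ∣
    signs = trans (sgn-+ s (flip j +ᶻ flip j +ᶻ flip j) (+ 2)) (trans (cong₂ _*ᶻ_ (sgn-3* s (flip j)) (sign-2 s))
      (trans (ℤ.*-identityʳ _) (sgn-flip s j)))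
      where
      sign-2 : ∀ s → sign s 2 ≡ 1ℤ
      sign-2 false = refl
      sign-2 true  = refl
    lemma : ∀ j → let k = (- 1ℤ - j) +ᶻ (- 1ℤ - j) +ᶻ (- 1ℤ - j) +ᶻ + 2 in
      (+ 3 +ᶻ + 1) *ᶻ k *ᶻ k +ᶻ (+ 3 - + 1) *ᶻ k ≡ + 2 +ᶻ + 3 *ᶻ ((+ 9 +ᶻ + 3) *ᶻ j *ᶻ j +ᶻ (+ 9 - + 3) *ᶻ j)
    lemma = ℤ-solver.solve-∀
    eq : exponent 3 1 k ≡ 1 + 3 * exponent 9 3 j
    eq = twice-injective (trans (2*exponent 3 1 k) (trans
      (cong (λ i → (+ 3 +ᶻ + 1) *ᶻ (i +ᶻ i +ᶻ i +ᶻ + 2) *ᶻ (i +ᶻ i +ᶻ i +ᶻ + 2) +ᶻ (+ 3 - + 1) *ᶻ (i +ᶻ i +ᶻ i +ᶻ + 2)) (flip-≡ j))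
      (trans (lemma j) (sym (trans (twice-+ 1 (3 * exponent 9 3 j))
        (cong (+ 2 +ᶻ_) (trans (twice-* 3 (exponent 9 3 j)) (cong (+ 3 *ᶻ_) (2*exponent 9 3 j)))))))))

-- Even and odd k in f(q^(2m), q^m) produce exactly the two halves of `trisected`, so that the first
-- component of the trisection becomes a single theta function, accessible to the triple product.
bisection : ∀ m → 1 ≤ m → θ false (m * 2) (m * 1) ≈ trisected false m
bisection m 1≤m = limit λ r → begin
  θ false (m * 2) (m * 1)
    ≈⟨ θ-S false (1≤* 1≤m 1≤) (1≤* 1≤m 1≤) (≤-double r) ⟩
  S (double r) t
    ≈⟨ ≈⇒≈[] (S-double r t) ⟩
  S r (λ j → t (j +ᶻ j)) ⊕ S r (λ j → t (j +ᶻ j +ᶻ + 1))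
    ≈⟨ ≈⇒≈[] (⊕-cong (S-cong r t₀) (≈-trans (≈-sym (S-flip r _)) (≈-trans (S-cong r t₁) (≈-sym (S-· r _ _))))) ⟩
  S r (term false (m * 7) (m * 5)) ⊕ X m · S r (term false (m * 11) (m * 1))
    ≈⟨ ⊕-cong[] (θ-S false (1≤* 1≤m 1≤) (1≤* 1≤m 1≤) ℕ.≤-refl)
         (·-cong[] ≈[]-refl (θ-S false (1≤* 1≤m 1≤) (1≤* 1≤m 1≤) ℕ.≤-refl)) ⟨
  θ false (m * 7) (m * 5) ⊕ X m · θ false (m * 11) (m * 1)
    ≈⟨ ≈⇒≈[] (⊕-congˡ (≈-sym (1-• _))) ⟩
  trisected false m ∎
  where
  open module R {r} = ≈[]-Reasoning r
  t : ℤ → PS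
  t = term false (m * 2) (m * 1)

  t₀ : ∀ j → t (j +ᶻ j) ≈ term false (m * 7) (m * 5) j
  t₀ j = term-≈ refl (trans (exponent-* m 2 1 (j +ᶻ j)) (trans (cong (m *_) eq) (sym (exponent-* m 7 5 j))))
    where
    lemma : ∀ j → (+ 2 +ᶻ + 1) *ᶻ (j +ᶻ j) *ᶻ (j +ᶻ j) +ᶻ (+ 2 - + 1) *ᶻ (j +ᶻ j) ≡ (+ 7 +ᶻ + 5) *ᶻ j *ᶻ j +ᶻ (+ 7 - + 5) *ᶻ j
    lemma = ℤ-solver.solve-∀
    eq : exponent 2 1 (j +ᶻ j) ≡ exponent 7 5 j
    eq = twice-injective (trans (2*exponent 2 1 (j +ᶻ j)) (trans (lemma j) (sym (2*exponent 7 5 j))))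

  t₁ : ∀ j → t (flip j +ᶻ flip j +ᶻ + 1) ≈ X m · term false (m * 11) (m * 1) j
  t₁ j = ≈-trans (term-≈ refl (trans (exponent-* m 2 1 k) (trans (cong (m *_) eq)
      (trans (ℕ.*-suc m (exponent 11 1 j)) (cong (λ x → m + x) (sym (exponent-* m 11 1 j)))))))
    (≈-sym (≈-trans (·-• _ _ _) (•-cong refl (≈-sym (X-+ _ _)))))
    where
    k : ℤ
    k = flip j +ᶻ flip j +ᶻ + 1
    lemma : ∀ j → let k = (- 1ℤ - j) +ᶻ (- 1ℤ - j) +ᶻ + 1 in
      (+ 2 +ᶻ + 1) *ᶻ k *ᶻ k +ᶻ (+ 2 - + 1) *ᶻ k ≡ + 2 +ᶻ ((+ 11 +ᶻ + 1) *ᶻ j *ᶻ j +ᶻ (+ 11 - + 1) *ᶻ j)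
    lemma = ℤ-solver.solve-∀
    eq : exponent 2 1 k ≡ 1 + exponent 11 1 j
    eq = twice-injective (trans (2*exponent 2 1 k) (trans
      (cong (λ i → (+ 2 +ᶻ + 1) *ᶻ (i +ᶻ i +ᶻ + 1) *ᶻ (i +ᶻ i +ᶻ + 1) +ᶻ (+ 2 - + 1) *ᶻ (i +ᶻ i +ᶻ + 1)) (flip-≡ j))
      (trans (lemma j) (sym (trans (twice-+ 1 (exponent 11 1 j)) (cong (+ 2 +ᶻ_) (2*exponent 11 1 j)))))))

-- Rotation of a double series

S-zero[] : ∀ {m} N {f : ℤ → PS} → (∀ k → f k ≈[ m ] 𝟘) → S N f ≈[ m ] 𝟘
S-zero[] N p = ≈[]-trans (S-cong[] N (λ k _ → p k)) (≈⇒≈[] (S-𝟘 N))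

-- Since k ≡ l or k ≡ l + 1 modulo 2, the sum splits along (k, l) = (l′ + j, l′ - j) and (l′ + j + 1, l′ - j).
rotate : ∀ {m L M} {g : ℤ → ℤ → PS} → (∀ k l → m ≤ ℤ.∣ k ∣ → g k l ≈[ m ] 𝟘) → (∀ k l → m ≤ ℤ.∣ l ∣ → g k l ≈[ m ] 𝟘) →
  m + m + m ≤ double L → m + L + L ≤ M →
  S M (λ l → S (double L) (λ k → g k l)) ≈[ m ]
    S L (λ j → S M (λ l → g (l +ᶻ j) (l - j))) ⊕ S L (λ j → S M (λ l → g (l +ᶻ j +ᶻ + 1) (l - j)))
rotate {m} {L} {M} {g} vₖ vₗ 3m≤2L ≤M = begin
  S M (λ l → S (double L) (λ k → g k l))
    ≈⟨ S-cong[] M (λ l _ → ≈[]-sym (shear l)) ⟩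
  S M (λ l → S (double L) (λ k → g (k +ᶻ l) l))
    ≈⟨ ≈⇒≈[] (S-cong M (λ l → S-double L (λ k → g (k +ᶻ l) l))) ⟩
  S M (λ l → S L (λ j → g (j +ᶻ j +ᶻ l) l) ⊕ S L (λ j → g (j +ᶻ j +ᶻ + 1 +ᶻ l) l))
    ≈⟨ ≈⇒≈[] (≈-trans (S-⊕ M _ _) (⊕-cong (S-swap M L (λ l j → g (j +ᶻ j +ᶻ l) l)) (S-swap M L (λ l j → g (j +ᶻ j +ᶻ + 1 +ᶻ l) l)))) ⟩
  S L (λ j → S M (λ l → g (j +ᶻ j +ᶻ l) l)) ⊕ S L (λ j → S M (λ l → g (j +ᶻ j +ᶻ + 1 +ᶻ l) l))
    ≈⟨ ⊕-cong[] (S-cong[] L (λ j j≤L → slide j j≤L (λ l → g (j +ᶻ j +ᶻ l) l) (λ l → vₗ _ l)))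
                (S-cong[] L (λ j j≤L → slide j j≤L (λ l → g (j +ᶻ j +ᶻ + 1 +ᶻ l) l) (λ l → vₗ _ l))) ⟨
  S L (λ j → S M (λ l → g (j +ᶻ j +ᶻ (l - j)) (l - j))) ⊕ S L (λ j → S M (λ l → g (j +ᶻ j +ᶻ + 1 +ᶻ (l - j)) (l - j)))
    ≈⟨ ≈⇒≈[] (⊕-cong (S-cong L (λ j → S-cong M (λ l → ≈-reflexive (cong (λ k → g k (l - j)) (lemma₀ j l)))))
                     (S-cong L (λ j → S-cong M (λ l → ≈-reflexive (cong (λ k → g k (l - j)) (lemma₁ j l)))))) ⟩
  S L (λ j → S M (λ l → g (l +ᶻ j) (l - j))) ⊕ S L (λ j → S M (λ l → g (l +ᶻ j +ᶻ + 1) (l - j))) ∎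
  where
  open ≈[]-Reasoning m
  lemma₀ : ∀ j l → j +ᶻ j +ᶻ (l - j) ≡ l +ᶻ j
  lemma₀ = ℤ-solver.solve-∀
  lemma₁ : ∀ j l → j +ᶻ j +ᶻ + 1 +ᶻ (l - j) ≡ l +ᶻ j +ᶻ + 1
  lemma₁ = ℤ-solver.solve-∀

  -- The shift by l must fit into the window: for |l| ≤ m this costs 3m ≤ 2L, and for other l both
  -- sides vanish modulo q^m.
  shear : ∀ l → S (double L) (λ k → g (k +ᶻ l) l) ≈[ m ] S (double L) (λ k → g k l)
  shear l with ℤ.∣ l ∣ ℕ.≤? m
  ... | yes l≤m = S-shift l {λ k → g k l} (λ k → vₖ k l)
    (ℕ.≤-trans (ℕ.+-mono-≤ (ℕ.+-monoʳ-≤ m l≤m) l≤m) 3m≤2L)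
  ... | no l≰m = ≈[]-trans (S-zero[] (double L) (λ k → vₗ (k +ᶻ l) l (ℕ.<⇒≤ (ℕ.≰⇒> l≰m))))
    (≈[]-sym (S-zero[] (double L) (λ k → vₗ k l (ℕ.<⇒≤ (ℕ.≰⇒> l≰m)))))

  -- The substitution l ↦ l - j depends on j, which is why the sums are exchanged first. Here |j| ≤
  -- L, whence the larger window m + 2L ≤ M.
  slide : ∀ j → ℤ.∣ j ∣ ≤ L → (h : ℤ → PS) → (∀ l → m ≤ ℤ.∣ l ∣ → h l ≈[ m ] 𝟘) →
    S M (λ l → h (l - j)) ≈[ m ] S M h
  slide j j≤L h v = S-shift (- j) {h} v (ℕ.≤-trans (ℕ.+-mono-≤ (ℕ.+-monoʳ-≤ m ∣-j∣≤L) ∣-j∣≤L) ≤M)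
    where
    ∣-j∣≤L : ℤ.∣ - j ∣ ≤ L
    ∣-j∣≤L = ℕ.≤-trans (ℕ.≤-reflexive (ℤ.∣-i∣≡∣i∣ j)) j≤L

S-product : ∀ N M (f g : ℤ → PS) → S N (λ j → S M (λ l → f j · g l)) ≈ S N f · S M g
S-product N M f g = ≈-trans (S-cong N (λ j → ≈-sym (S-· M (f j) g))) (≈-sym (S-·ʳ N (S M g) f))

sgn-± : ∀ s k → sign (not s) ℤ.∣ k ∣ *ᶻ sign s ℤ.∣ k ∣ ≡ sign true ℤ.∣ k ∣
sgn-± true  k = ℤ.*-identityˡ _
sgn-± false k = ℤ.*-identityʳ _

-- The exponents 3l² and 3k² + 2k have the same leading coefficient, so k = x + y, l = x - y removes
-- the cross term and leaves (6x² + 2x) + (6y² + 2y): the double sum factors into a square. The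
-- other coset, k = x + y + 1, leaves 1 + (6x² + 4x) + (6y² + 4y) once x and y are reflected.
lattice-identity : ∀ s → θ (not s) 3 3 · θ s 5 1 ≈
  θ true 8 4 · θ true 8 4 ⊕ sign s 1 • (X 1 · (θ true 10 2 · θ true 10 2))
lattice-identity s = limit λ m → let L = m + m ; M = m + L + L in begin
  θ (not s) 3 3 · θ s 5 1
    ≈⟨ ·-cong[] (θ-S (not s) {N = M} 1≤ 1≤ (m≤M m)) (θ-S s {N = double L} 1≤ 1≤ (ℕ.≤-trans (ℕ.m≤m+n m m) (≤-double L))) ⟩
  S M u · S (double L) v
    ≈⟨ ≈⇒≈[] (S-product M (double L) u v) ⟨
  S M (λ l → S (double L) (λ k → u l · v k))
    ≈⟨ rotate {m} {L} {M} {λ k l → u l · v k} (λ k l m≤k → ·-vanishʳ (term-vanish s 1≤ 1≤ k m≤k))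
         (λ k l m≤l → ≈[]-trans (≈⇒≈[] (·-comm _ _)) (·-vanishʳ (term-vanish (not s) 1≤ 1≤ l m≤l)))
         (3m≤ m) ℕ.≤-refl ⟩
  S L (λ j → S M (λ l → u (l - j) · v (l +ᶻ j))) ⊕ S L (λ j → S M (λ l → u (l - j) · v (l +ᶻ j +ᶻ + 1)))
    ≈⟨ ≈⇒≈[] (⊕-congˡ (≈-sym (≈-trans (S-flip L _) (S-cong L (λ j → S-flip M _))))) ⟩
  S L (λ j → S M (λ l → u (l - j) · v (l +ᶻ j)))
    ⊕ S L (λ j → S M (λ l → u (flip l - flip j) · v (flip l +ᶻ flip j +ᶻ + 1)))
    ≈⟨ ≈⇒≈[] (⊕-cong
         (≈-trans (S-cong L (λ j → S-cong M (λ l → even j l))) (S-product L M a a))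
         (≈-trans (S-cong L (λ j → ≈-trans (S-cong M (λ l → odd j l)) (≈-sym (S-• M c _))))
           (≈-trans (≈-sym (S-• L c _)) (•-cong refl
             (≈-trans (S-cong L (λ j → ≈-sym (S-· M (X 1) _))) (≈-trans (≈-sym (S-· L (X 1) _)) (·-congˡ (S-product L M b b)))))))) ⟩
  S L a · S M a ⊕ c • (X 1 · (S L b · S M b))
    ≈⟨ ⊕-cong[] (·-cong[] (θ-S true 1≤ 1≤ (ℕ.m≤m+n m m)) (θ-S true 1≤ 1≤ (m≤M m)))
         (•-cong[] (·-cong[] ≈[]-refl (·-cong[] (θ-S true 1≤ 1≤ (ℕ.m≤m+n m m)) (θ-S true 1≤ 1≤ (m≤M m))))) ⟨
  θ true 8 4 · θ true 8 4 ⊕ c • (X 1 · (θ true 10 2 · θ true 10 2)) ∎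
  where
  open module R {m} = ≈[]-Reasoning m
  c : ℤ
  c = sign s 1
  u v a b : ℤ → PS
  u = term (not s) 3 3
  v = term s 5 1
  a = term true 8 4
  b = term true 10 2

  m≤M : ∀ m → m ≤ m + (m + m) + (m + m)
  m≤M m = ℕ.≤-trans (ℕ.m≤m+n m (m + m)) (ℕ.m≤m+n _ (m + m))
  3m≤ : ∀ m → m + m + m ≤ double (m + m)
  3m≤ m = ℕ.≤-trans (ℕ.+-monoʳ-≤ (m + m) (ℕ.m≤m+n m m)) (ℕ.≤-reflexive (sym (double-≡ (m + m))))

  -- Exactly one of the two series alternates, and l - j and l + j have the same parity, so in
  -- either case the sign is (-1)^(j+l).
  signs : ∀ j l → sign (not s) ℤ.∣ l - j ∣ *ᶻ sign s ℤ.∣ l +ᶻ j ∣ ≡ sign true ℤ.∣ j ∣ *ᶻ sign true ℤ.∣ l ∣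
  signs j l = trans (cong₂ _*ᶻ_ (trans (sgn-+ (not s) l (- j)) (cong (sign (not s) ℤ.∣ l ∣ *ᶻ_) (sgn-neg (not s) j))) (sgn-+ s l j))
    (trans (lemma (sign (not s) ℤ.∣ l ∣) (sign (not s) ℤ.∣ j ∣) (sign s ℤ.∣ l ∣) (sign s ℤ.∣ j ∣)) (cong₂ _*ᶻ_ (sgn-± s j) (sgn-± s l)))
    where
    lemma : ∀ x y z w → x *ᶻ y *ᶻ (z *ᶻ w) ≡ y *ᶻ w *ᶻ (x *ᶻ z)
    lemma = ℤ-solver.solve-∀

  even : ∀ j l → u (l - j) · v (l +ᶻ j) ≈ a j · a l
  even j l = ≈-trans (monomial-· _ _ _ _) (≈-trans (term-≈ (signs j l) eq) (≈-sym (monomial-· _ _ _ _)))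
    where
    lemma : ∀ j l → (+ 3 +ᶻ + 3) *ᶻ (l - j) *ᶻ (l - j) +ᶻ (+ 3 - + 3) *ᶻ (l - j)
      +ᶻ ((+ 5 +ᶻ + 1) *ᶻ (l +ᶻ j) *ᶻ (l +ᶻ j) +ᶻ (+ 5 - + 1) *ᶻ (l +ᶻ j)) ≡
      (+ 8 +ᶻ + 4) *ᶻ j *ᶻ j +ᶻ (+ 8 - + 4) *ᶻ j +ᶻ ((+ 8 +ᶻ + 4) *ᶻ l *ᶻ l +ᶻ (+ 8 - + 4) *ᶻ l)
    lemma = ℤ-solver.solve-∀
    eq : exponent 3 3 (l - j) + exponent 5 1 (l +ᶻ j) ≡ exponent 8 4 j + exponent 8 4 l
    eq = twice-injective (trans (twice-+ (exponent 3 3 (l - j)) (exponent 5 1 (l +ᶻ j))) (trans (cong₂ _+ᶻ_ (2*exponent 3 3 (l - j)) (2*exponent 5 1 (l +ᶻ j)))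
      (trans (lemma j l) (sym (trans (twice-+ (exponent 8 4 j) _) (cong₂ _+ᶻ_ (2*exponent 8 4 j) (2*exponent 8 4 l)))))))

  odd : ∀ j l → u (flip l - flip j) · v (flip l +ᶻ flip j +ᶻ + 1) ≈ c • (X 1 · (b j · b l))
  odd j l = ≈-trans (monomial-· _ _ _ _) (≈-trans (term-≈ signs′ eq) (≈-sym (≈-trans
      (•-cong refl (≈-trans (·-congˡ (monomial-· _ _ _ _)) (≈-trans (·-• _ _ _) (•-cong refl (≈-sym (X-+ _ _)))))) (•-• _ _ _))))
    where
    lemma-sign : ∀ x y c → x *ᶻ (y *ᶻ c) ≡ c *ᶻ (x *ᶻ y)
    lemma-sign = ℤ-solver.solve-∀
    lemma-flip : ∀ x y → - 1ℤ *ᶻ x *ᶻ (- 1ℤ *ᶻ y) ≡ x *ᶻ y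
    lemma-flip = ℤ-solver.solve-∀
    signs′ : sign (not s) ℤ.∣ flip l - flip j ∣ *ᶻ sign s ℤ.∣ flip l +ᶻ flip j +ᶻ + 1 ∣ ≡ c *ᶻ (sign true ℤ.∣ j ∣ *ᶻ sign true ℤ.∣ l ∣)
    signs′ = trans (cong (sign (not s) ℤ.∣ flip l - flip j ∣ *ᶻ_) (sgn-+ s (flip l +ᶻ flip j) (+ 1)))
      (trans (lemma-sign (sign (not s) ℤ.∣ flip l - flip j ∣) (sign s ℤ.∣ flip l +ᶻ flip j ∣) c)
        (cong (c *ᶻ_) (trans (signs (flip j) (flip l)) (trans (cong₂ _*ᶻ_ (sgn-flip true j) (sgn-flip true l))
          (lemma-flip (sign true ℤ.∣ j ∣) (sign true ℤ.∣ l ∣))))))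
    quadratic : ℤ → ℤ → ℤ
    quadratic j l = (+ 3 +ᶻ + 3) *ᶻ (l - j) *ᶻ (l - j) +ᶻ (+ 3 - + 3) *ᶻ (l - j)
      +ᶻ ((+ 5 +ᶻ + 1) *ᶻ (l +ᶻ j +ᶻ + 1) *ᶻ (l +ᶻ j +ᶻ + 1) +ᶻ (+ 5 - + 1) *ᶻ (l +ᶻ j +ᶻ + 1))
    lemma : ∀ j l → (+ 3 +ᶻ + 3) *ᶻ ((- 1ℤ - l) - (- 1ℤ - j)) *ᶻ ((- 1ℤ - l) - (- 1ℤ - j)) +ᶻ (+ 3 - + 3) *ᶻ ((- 1ℤ - l) - (- 1ℤ - j))
      +ᶻ ((+ 5 +ᶻ + 1) *ᶻ ((- 1ℤ - l) +ᶻ (- 1ℤ - j) +ᶻ + 1) *ᶻ ((- 1ℤ - l) +ᶻ (- 1ℤ - j) +ᶻ + 1)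
        +ᶻ (+ 5 - + 1) *ᶻ ((- 1ℤ - l) +ᶻ (- 1ℤ - j) +ᶻ + 1)) ≡
      + 2 +ᶻ ((+ 10 +ᶻ + 2) *ᶻ j *ᶻ j +ᶻ (+ 10 - + 2) *ᶻ j +ᶻ ((+ 10 +ᶻ + 2) *ᶻ l *ᶻ l +ᶻ (+ 10 - + 2) *ᶻ l))
    lemma = ℤ-solver.solve-∀
    eq : exponent 3 3 (flip l - flip j) + exponent 5 1 (flip l +ᶻ flip j +ᶻ + 1) ≡ 1 + (exponent 10 2 j + exponent 10 2 l)
    eq = twice-injective (trans (twice-+ (exponent 3 3 (flip l - flip j)) (exponent 5 1 (flip l +ᶻ flip j +ᶻ + 1)))
      (trans (cong₂ _+ᶻ_ (2*exponent 3 3 (flip l - flip j)) (2*exponent 5 1 (flip l +ᶻ flip j +ᶻ + 1)))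
        (trans (cong₂ quadratic (flip-≡ j) (flip-≡ l)) (trans (lemma j l)
          (sym (trans (twice-+ 1 (exponent 10 2 j + exponent 10 2 l)) (cong (+ 2 +ᶻ_)
            (trans (twice-+ (exponent 10 2 j) _) (cong₂ _+ᶻ_ (2*exponent 10 2 j) (2*exponent 10 2 l))))))))))

-- Theta functions as eta quotients

E⁻₆ : P∞ (- 1ℤ) 6 6 ≈η (+ 0 ∷ + 0 ∷ + 0 ∷ + 0 ∷ - + 1 ∷ + 1 ∷ [])
E⁻₆ = ≈-trans (≈-trans (·-comm _ _) (P∞-± 1≤ 1≤)) E₁₂η /η E₆η

ψ-product : ∀ k → 1 ≤ k → θ false (k + (k + k)) k · E k ≈ E (k + k) · E (k + k)
ψ-product k 1≤k = begin
  θ false (k + (k + k)) k · E k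
    ≈⟨ ·-cong (jacobi-triple-product false {k + (k + k)} {k} (ℕ.m≤n⇒m≤n+o (k + k) 1≤k) 1≤k) (≈-sym (odd-product k 1≤k)) ⟩
  E (k + (k + k) + k) · (P∞ (- 1ℤ) (k + (k + k)) (k + (k + k) + k) · P∞ (- 1ℤ) k (k + (k + k) + k)) · (P∞ 1ℤ k (k + k) · E (k + k))
    ≈⟨ ≈-reflexive (cong (λ d → E d · (P∞ (- 1ℤ) (k + (k + k)) d · P∞ (- 1ℤ) k d) · (P∞ 1ℤ k (k + k) · E (k + k))) (lemma k)) ⟩
  E 4k · (P∞ (- 1ℤ) (k + (k + k)) 4k · P∞ (- 1ℤ) k 4k) · (P∞ 1ℤ k (k + k) · E (k + k))
    ≈⟨ solve 5 (λ a b c d e → a :* (b :* c) :* (d :* e) := c :* b :* d :* a :* e) ≈-refl _ _ _ _ _ ⟩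
  P∞ (- 1ℤ) k 4k · P∞ (- 1ℤ) (k + (k + k)) 4k · P∞ 1ℤ k (k + k) · E 4k · E (k + k)
    ≈⟨ ·-congʳ (·-congʳ (≈-trans (·-congʳ (≈-sym (P∞-split₂ (- 1ℤ) 1≤k 1≤2k))) (odd-product⁻ k 1≤k))) ⟩
  P∞ 1ℤ (k + k) 4k · E 4k · E (k + k)
    ≈⟨ ·-congʳ (odd-product (k + k) 1≤2k) ⟩
  E (k + k) · E (k + k) ∎
  where
  open ≈-Reasoning
  4k : ℕ
  4k = k + k + (k + k)
  1≤2k : 1 ≤ k + k
  1≤2k = ℕ.m≤n⇒m≤n+o k 1≤k
  lemma : ∀ k → k + (k + k) + k ≡ k + k + (k + k)
  lemma = ℕ-solver.solve-∀

ψ₂η : θ false 6 2 ≈η (+ 0 ∷ - + 1 ∷ + 0 ∷ + 2 ∷ + 0 ∷ + 0 ∷ [])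
ψ₂η = ≈-trans (ψ-product 2 1≤) (E₄η ·η E₄η) /η E₂η

ψ₃η : θ false 9 3 ≈η (+ 0 ∷ + 0 ∷ - + 1 ∷ + 0 ∷ + 2 ∷ + 0 ∷ [])
ψ₃η = ≈-trans (ψ-product 3 1≤) (E₆η ·η E₆η) /η E₃η

ψ₆η : θ false 18 6 ≈η (+ 0 ∷ + 0 ∷ + 0 ∷ + 0 ∷ - + 1 ∷ + 2 ∷ [])
ψ₆η = ≈-trans (ψ-product 6 1≤) (E₁₂η ·η E₁₂η) /η E₆η

ψ⁻₁η : θ true 3 1 ≈η (+ 1 ∷ - + 1 ∷ + 0 ∷ + 1 ∷ + 0 ∷ + 0 ∷ [])
ψ⁻₁η = ≈-trans (jacobi-triple-product true 1≤ 1≤)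
  (E₄η ·η ≈-trans (≈-trans (·-comm _ _) (≈-sym (P∞-split₂ 1ℤ {1} {2} 1≤ 1≤))) χ₁)

ψ⁻₃η : θ true 9 3 ≈η (+ 0 ∷ + 0 ∷ + 1 ∷ + 0 ∷ - + 1 ∷ + 1 ∷ [])
ψ⁻₃η = ≈-trans (jacobi-triple-product true 1≤ 1≤)
  (E₁₂η ·η ≈-trans (≈-trans (·-comm _ _) (≈-sym (P∞-split₂ 1ℤ {3} {6} 1≤ 1≤))) χ₃)

φ⁻₃η : θ true 3 3 ≈η (+ 0 ∷ + 0 ∷ + 2 ∷ + 0 ∷ - + 1 ∷ + 0 ∷ [])
φ⁻₃η = ≈-trans (jacobi-triple-product true 1≤ 1≤) (E₆η ·η (χ₃ ·η χ₃))

φ₃η : θ false 3 3 ≈η (+ 0 ∷ + 0 ∷ - + 2 ∷ + 0 ∷ + 5 ∷ - + 2 ∷ [])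
φ₃η = ≈-trans (jacobi-triple-product false 1≤ 1≤) (E₆η ·η (χ⁻₃ ·η χ⁻₃))

-- Splitting a product modulo 3 gives three residues, of which a triple product contains two. The
-- unwanted one is moved to the end, where `/η` divides it out: the middle residue here, the last
-- one in `inner`.
outer : ∀ {f g h p} → p ≈ f · g · h → h · f · g ≈ p
outer {f} {g} {h} q = ≈-sym (≈-trans q (solve 3 (λ f g h → f :* g :* h := h :* f :* g) ≈-refl f g h))

inner : ∀ {f g h p} → p ≈ f · g · h → g · f · h ≈ p
inner {f} {g} {h} q = ≈-sym (≈-trans q (solve 3 (λ f g h → f :* g :* h := g :* f :* h) ≈-refl f g h))

θ₅₁η : θ false 5 1 ≈η (- + 1 ∷ + 2 ∷ + 1 ∷ - + 1 ∷ - + 1 ∷ + 1 ∷ [])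
θ₅₁η = ≈-trans (jacobi-triple-product false 1≤ 1≤)
  (E₆η ·η (≈-trans (outer (P∞-split₃ (- 1ℤ) {1} {2} 1≤ 1≤)) χ⁻₁ /η χ⁻₃))

θ⁻₅₁η : θ true 5 1 ≈η (+ 1 ∷ - + 1 ∷ - + 1 ∷ + 0 ∷ + 2 ∷ + 0 ∷ [])
θ⁻₅₁η = ≈-trans (jacobi-triple-product true 1≤ 1≤)
  (E₆η ·η (≈-trans (outer (P∞-split₃ 1ℤ {1} {2} 1≤ 1≤)) χ₁ /η χ₃))

θ⁻₈₄η : θ true 8 4 ≈η (+ 0 ∷ + 0 ∷ + 0 ∷ + 1 ∷ + 0 ∷ + 0 ∷ [])
θ⁻₈₄η = ≈-trans (jacobi-triple-product true 1≤ 1≤)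
  (E₁₂η ·η (≈-trans (inner (P∞-split₃ 1ℤ {4} {4} 1≤ 1≤)) E₄η /η E₁₂η))

θ⁻₁₀₂η : θ true 10 2 ≈η (+ 0 ∷ + 1 ∷ + 0 ∷ - + 1 ∷ - + 1 ∷ + 2 ∷ [])
θ⁻₁₀₂η = ≈-trans (jacobi-triple-product true 1≤ 1≤)
  (E₁₂η ·η (≈-trans (outer (P∞-split₃ 1ℤ {2} {4} 1≤ 1≤)) χ₂ /η χ₆))

θ₂₁η : θ false 2 1 ≈η (- + 1 ∷ + 1 ∷ + 2 ∷ + 0 ∷ - + 1 ∷ + 0 ∷ [])
θ₂₁η = ≈-trans (jacobi-triple-product false 1≤ 1≤)
  (E₃η ·η (≈-trans (inner (P∞-split₃ (- 1ℤ) {1} {1} 1≤ 1≤)) E⁻₁ /η E⁻₃))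

θ₄₂η : θ false 4 2 ≈η (+ 0 ∷ - + 1 ∷ + 0 ∷ + 1 ∷ + 2 ∷ - + 1 ∷ [])
θ₄₂η = ≈-trans (jacobi-triple-product false 1≤ 1≤)
  (E₆η ·η (≈-trans (inner (P∞-split₃ (- 1ℤ) {2} {2} 1≤ 1≤)) E⁻₂ /η E⁻₆))

-- Eta quotients under q ↦ -q

alternate : PS → PS
alternate = subst true 1

alternate-factor : ∀ c e → alternate (factor c e) ≈ factor (c *ᶻ sign true e) e
alternate-factor c e = begin
  alternate (factor c e)               ≈⟨ subst-cong true 1 (factor-≈ c e) ⟩
  alternate (one ⊕ ⊝ (c • X e))        ≈⟨ subst-⊕ true 1 _ _ ⟩
  alternate one ⊕ alternate (⊝ (c • X e))
    ≈⟨ ⊕-cong (subst-one true 1) (≈-trans (subst-⊝ true 1 _) (⊝-cong (≈-trans (subst-• true 1 c (X e))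
         (≈-trans (•-cong refl (≈-trans (subst-X true 1 e) (•-cong refl (≈-reflexive (cong X (ℕ.*-identityˡ e)))))) (•-• _ _ _))))) ⟩
  one ⊕ ⊝ ((c *ᶻ sign true e) • X e)   ≈⟨ factor-≈ _ e ⟨
  factor (c *ᶻ sign true e) e ∎
  where open ≈-Reasoning

-- All exponents must have one parity, recorded by ε. `E 1` and `E 3` mix parities and are therefore
-- first split by `odd-product`, in `σE₁` and `σE₃`.
alternate-P∞ : ∀ c {a b} ε → 1 ≤ a → 1 ≤ b → (∀ k → sign true (a + b * k) ≡ ε) →
  alternate (P∞ c a b) ≈ P∞ (c *ᶻ ε) a b
alternate-P∞ c {a} {b} ε 1≤a 1≤b signs = limit λ m → ≈[]-trans
  (subst-cong[] true 1 (P∞-finProd c 1≤a 1≤b ℕ.≤-refl))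
  (≈[]-trans (≈⇒≈[] (finite m)) (≈[]-sym (P∞-finProd (c *ᶻ ε) 1≤a 1≤b ℕ.≤-refl)))
  where
  finite : ∀ N → alternate (finProd c a b N) ≈ finProd (c *ᶻ ε) a b N
  finite zero    = subst-one true 1
  finite (suc N) = ≈-trans (subst-cong true 1 (finProd-suc c a b N)) (≈-trans (subst-· true 1 _ _)
    (≈-trans (·-cong (finite N) (≈-trans (alternate-factor c _) (≈-reflexive (cong (λ s → factor (c *ᶻ s) (a + b * N)) (signs N)))))
      (≈-sym (finProd-suc _ a b N))))

sign-2* : ∀ n → sign true (2 * n) ≡ 1ℤ
sign-2* n = trans (cong (sign true) (cong (λ x → n + x) (ℕ.+-identityʳ n))) (trans (sign-+ true n n) (sign² true n))

sign-6* : ∀ n → sign true (6 * n) ≡ 1ℤ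
sign-6* n = trans (cong (sign true) (ℕ.*-assoc 2 3 n)) (sign-2* (3 * n))

even-sign : ∀ {x} → sign true x ≡ 1ℤ → - (- sign true x) ≡ 1ℤ
even-sign p = cong (λ s → - (- s)) p

σχ₁ : alternate (P∞ (- 1ℤ) 1 2) ≈η (+ 1 ∷ - + 1 ∷ + 0 ∷ + 0 ∷ + 0 ∷ + 0 ∷ [])
σχ₁ = ≈-trans (alternate-P∞ (- 1ℤ) (- 1ℤ) 1≤ 1≤ (λ k → cong -_ (sign-2* k))) χ₁

σE₂ : alternate (E 2) ≈η (+ 0 ∷ + 1 ∷ + 0 ∷ + 0 ∷ + 0 ∷ + 0 ∷ [])
σE₂ = ≈-trans (alternate-P∞ 1ℤ 1ℤ 1≤ 1≤ (λ k → even-sign {2 * k} (sign-2* k))) E₂η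

σE₆ : alternate (E 6) ≈η (+ 0 ∷ + 0 ∷ + 0 ∷ + 0 ∷ + 1 ∷ + 0 ∷ [])
σE₆ = ≈-trans (alternate-P∞ 1ℤ 1ℤ 1≤ 1≤ (λ k → cong (λ s → - (- (- (- (- (- s)))))) (sign-6* k))) E₆η

σE₁ : alternate (E 1) ≈η (- + 1 ∷ + 3 ∷ + 0 ∷ - + 1 ∷ + 0 ∷ + 0 ∷ [])
σE₁ = ≈-trans (subst-cong true 1 (≈-sym (odd-product 1 1≤))) (≈-trans (subst-· true 1 _ _)
  (≈-trans (alternate-P∞ 1ℤ (- 1ℤ) 1≤ 1≤ (λ k → cong -_ (sign-2* k))) χ⁻₁ ·η σE₂))

σE₃ : alternate (E 3) ≈η (+ 0 ∷ + 0 ∷ - + 1 ∷ + 0 ∷ + 3 ∷ - + 1 ∷ [])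
σE₃ = ≈-trans (subst-cong true 1 (≈-sym (odd-product 3 1≤))) (≈-trans (subst-· true 1 _ _)
  (≈-trans (alternate-P∞ 1ℤ (- 1ℤ) 1≤ 1≤ (λ k → cong (λ s → - (- (- s))) (sign-6* k))) χ⁻₃ ·η σE₆))

P⁻ : PS
P⁻ = trisected true 1

-- `alternate-θ` asks for odd parameters, which (2,1) are not. After `bisection` the parameters are
-- (7,5) and (11,1), and the sign of the second summand comes from q itself.
P⁻-alternate : P⁻ ≈ alternate (θ false 2 1)
P⁻-alternate = ≈-sym (begin
  alternate (θ false 2 1)
    ≈⟨ subst-cong true 1 (bisection 1 1≤) ⟩
  alternate (θ false 7 5 ⊕ 1ℤ • (X 1 · θ false 11 1))
    ≈⟨ ≈-trans (subst-⊕ true 1 _ _) (⊕-congˡ (subst-cong true 1 (1-• _))) ⟩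
  alternate (θ false 7 5) ⊕ alternate (X 1 · θ false 11 1)
    ≈⟨ ⊕-cong (alternate-θ 3 2 1) (≈-trans (subst-· true 1 _ _) (·-cong (subst-X true 1 1) (alternate-θ 5 0 1))) ⟩
  θ true 7 5 ⊕ (- 1ℤ) • X 1 · θ true 11 1
    ≈⟨ ⊕-congˡ (•-· _ _ _) ⟩
  P⁻ ∎)
  where open ≈-Reasoning

-- Since `subst-·` handles products, f(q,q²) = E₂E₃²/(E₁E₆) is cleared of denominators before q ↦ -q
-- and divided again afterwards.
P⁻η : P⁻ ≈η (+ 1 ∷ - + 2 ∷ - + 2 ∷ + 1 ∷ + 5 ∷ - + 2 ∷ [])
P⁻η = ≈-trans P⁻-alternate (≈-trans (≈-sym (subst-· true 1 _ _)) (≈-trans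
  (subst-cong true 1 (≈-trans (θ₂₁η ·η (E₁η ·η E₆η)) (≈-sym (E₂η ·η (E₃η ·η E₃η)))))
  (≈-trans (≈-trans (subst-· true 1 _ _) (·-congˡ (subst-· true 1 _ _))) (σE₂ ·η (σE₃ ·η σE₃))))
  /η ≈-trans (subst-· true 1 _ _) (σE₁ ·η σE₆))

lattice⁺ : eta (- + 1 ∷ + 2 ∷ + 3 ∷ - + 1 ∷ - + 2 ∷ + 1 ∷ []) ≈
  eta (+ 0 ∷ + 0 ∷ + 0 ∷ + 2 ∷ + 0 ∷ + 0 ∷ []) ⊕ X 1 · eta (+ 0 ∷ + 2 ∷ + 0 ∷ - + 2 ∷ - + 2 ∷ + 4 ∷ [])
lattice⁺ = ≈-trans (≈-sym (φ⁻₃η ·η θ₅₁η)) (≈-trans (lattice-identity false)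
  (⊕-cong (θ⁻₈₄η ·η θ⁻₈₄η) (≈-trans (1-• _) (·-congˡ (θ⁻₁₀₂η ·η θ⁻₁₀₂η)))))

lattice⁻ : eta (+ 1 ∷ - + 1 ∷ - + 3 ∷ + 0 ∷ + 7 ∷ - + 2 ∷ []) ⊕ X 1 · eta (+ 0 ∷ + 2 ∷ + 0 ∷ - + 2 ∷ - + 2 ∷ + 4 ∷ []) ≈
  eta (+ 0 ∷ + 0 ∷ + 0 ∷ + 2 ∷ + 0 ∷ + 0 ∷ [])
lattice⁻ = ≈-trans (⊕-congʳ (≈-trans (≈-sym (φ₃η ·η θ⁻₅₁η)) (≈-trans (lattice-identity true)
  (⊕-cong (θ⁻₈₄η ·η θ⁻₈₄η) (≈-trans (•-neg 1ℤ _) (⊝-cong (≈-trans (1-• _) (·-congˡ (θ⁻₁₀₂η ·η θ⁻₁₀₂η)))))))))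
  (solve 2 (λ a b → a :+ :- b :+ b := a) ≈-refl _ _)

-- Extraction of arithmetic progressions modulo 3

dilate₃-at : ∀ f n → dilate₃ f (3 * n) ≡ f n × dilate₃ f (3 * n + 1) ≡ 0ℤ × dilate₃ f (3 * n + 2) ≡ 0ℤ
dilate₃-at f n =
  trans (cong₂ select (trans (cong (ℕ._% 3) (ℕ.*-comm 3 n)) (ℕ.m*n%n≡0 n 3)) (trans (cong (ℕ._/ 3) (ℕ.*-comm 3 n)) (ℕ.m*n/n≡m n 3)))
    (ℤ.*-identityˡ (f n)) ,
  cong (λ r → select r ((3 * n + 1) ℕ./ 3)) (trans (cong (ℕ._% 3) (lemma n 1)) (ℕ.[m+kn]%n≡m%n 1 n 3)) ,
  cong (λ r → select r ((3 * n + 2) ℕ./ 3)) (trans (cong (ℕ._% 3) (lemma n 2)) (ℕ.[m+kn]%n≡m%n 2 n 3))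
  where
  select : ℕ → ℕ → ℤ
  select r k = if ⌊ r ℕ.≟ 0 ⌋ then 1ℤ *ᶻ f k else 0ℤ
  lemma : ∀ n r → 3 * n + r ≡ r + n * 3
  lemma = ℕ-solver.solve-∀

X-·-low : ∀ e f {n} → n < e → (X e · f) n ≡ 0ℤ
X-·-low e f {n} n<e = below (≈[]-trans (≈⇒≈[] (·-comm (X e) f)) (·-vanishʳ (X-vanish e ℕ.≤-refl))) n n<e

X-·-high : ∀ e f {n k} → n ≡ e + k → (X e · f) n ≡ f k
X-·-high e f {k = k} refl = X-·-at e f k

combine₃ : PS → PS → PS → PS
combine₃ f g h = dilate₃ f ⊕ X 1 · dilate₃ g ⊕ X 2 · dilate₃ h

module _ (f g h : PS) where

  private
    sum₃ : ∀ n {a b c} → dilate₃ f n ≡ a → (X 1 · dilate₃ g) n ≡ b → (X 2 · dilate₃ h) n ≡ c → combine₃ f g h n ≡ a +ᶻ b +ᶻ c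
    sum₃ n p q r = trans (⊕-at _ _ n) (cong₂ _+ᶻ_ (trans (⊕-at _ _ n) (cong₂ _+ᶻ_ p q)) r)
    at₀ : ∀ f n → dilate₃ f (3 * n) ≡ f n
    at₀ f n = proj₁ (dilate₃-at f n)
    at₁ : ∀ f n → dilate₃ f (3 * n + 1) ≡ 0ℤ
    at₁ f n = proj₁ (proj₂ (dilate₃-at f n))
    at₂ : ∀ f n → dilate₃ f (3 * n + 2) ≡ 0ℤ
    at₂ f n = proj₂ (proj₂ (dilate₃-at f n))
    l₁ : ∀ n → 3 * suc n ≡ 1 + (3 * n + 2)
    l₁ = ℕ-solver.solve-∀
    l₂ : ∀ n → 3 * suc n ≡ 2 + (3 * n + 1)
    l₂ = ℕ-solver.solve-∀
    l₃ : ∀ n → 3 * suc n + 1 ≡ 2 + (3 * n + 2)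
    l₃ = ℕ-solver.solve-∀
    l₄ : ∀ n → 3 * n + 2 ≡ 1 + (3 * n + 1)
    l₄ = ℕ-solver.solve-∀

  -- The factors q and q² move the other two summands into other residue classes. Small indices lie
  -- below the shift, hence the separate case n = 0.
  combine₃-0 : ∀ n → combine₃ f g h (3 * n) ≡ f n
  combine₃-0 n = trans (sum₃ (3 * n) (at₀ f n) (x₁ n) (x₂ n)) (trans (ℤ.+-identityʳ _) (ℤ.+-identityʳ _))
    where
    x₁ : ∀ n → (X 1 · dilate₃ g) (3 * n) ≡ 0ℤ
    x₁ zero    = X-·-low 1 _ 1≤
    x₁ (suc n) = trans (X-·-high 1 _ (l₁ n)) (at₂ g n)
    x₂ : ∀ n → (X 2 · dilate₃ h) (3 * n) ≡ 0ℤ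
    x₂ zero    = X-·-low 2 _ 1≤
    x₂ (suc n) = trans (X-·-high 2 _ (l₂ n)) (at₁ h n)

  combine₃-1 : ∀ n → combine₃ f g h (3 * n + 1) ≡ g n
  combine₃-1 n = trans (sum₃ (3 * n + 1) (at₁ f n) (trans (X-·-high 1 _ (ℕ.+-comm (3 * n) 1)) (at₀ g n)) (x₂ n))
    (trans (ℤ.+-identityʳ _) (ℤ.+-identityˡ _))
    where
    x₂ : ∀ n → (X 2 · dilate₃ h) (3 * n + 1) ≡ 0ℤ
    x₂ zero    = X-·-low 2 _ ℕ.≤-refl
    x₂ (suc n) = trans (X-·-high 2 _ (l₃ n)) (at₂ h n)

  combine₃-2 : ∀ n → combine₃ f g h (3 * n + 2) ≡ h n
  combine₃-2 n = trans (sum₃ (3 * n + 2) (at₂ f n) (trans (X-·-high 1 _ (l₄ n)) (at₁ g n))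
    (trans (X-·-high 2 _ (ℕ.+-comm (3 * n) 2)) (at₀ h n))) (ℤ.+-identityˡ _)

-- Trisection of f₁/f₄ = ψ(-q)/ψ(q²)

-- The subscripts of ψ and P give the power of q in the argument, a superscript minus a change of
-- sign. `A₀`, `A₁`, `A₂` are the theta quotients claimed for A(3n), -A(3n+1), -A(3n+2), rewritten
-- as eta quotients.
q ψ₂ ψ₆ ψ⁻₁ ψ⁻₃ P₂ A₀ A₁ A₂ : PS
q   = X 1
ψ₂  = θ false 6 2
ψ₆  = θ false 18 6
ψ⁻₁ = θ true 3 1
ψ⁻₃ = θ true 9 3
P₂  = θ false 4 2
A₀  = eta (+ 0 ∷ + 1 ∷ + 1 ∷ - + 3 ∷ + 1 ∷ + 0 ∷ [])
A₁  = eta (+ 1 ∷ + 0 ∷ - + 2 ∷ - + 3 ∷ + 4 ∷ + 0 ∷ [])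
A₂  = eta (+ 0 ∷ + 2 ∷ + 1 ∷ - + 4 ∷ - + 2 ∷ + 3 ∷ [])

X₂ : X 2 ≈ q · q
X₂ = X-+ 1 1

X₃ : X 3 ≈ q · q · q
X₃ = ≈-trans (X-+ 2 1) (·-congʳ X₂)

dilate₃-q : dilate₃ q ≈ q · q · q
dilate₃-q = ≈-trans (dilate₃-X 1) X₃

dilate₃-· : ∀ f g → dilate₃ (f · g) ≈ dilate₃ f · dilate₃ g
dilate₃-· = subst-· false 3

dilate₃-⊕ : ∀ f g → dilate₃ (f ⊕ g) ≈ dilate₃ f ⊕ dilate₃ g
dilate₃-⊕ = subst-⊕ false 3

dilate₃-cong : ∀ {f g} → f ≈ g → dilate₃ f ≈ dilate₃ g
dilate₃-cong = subst-cong false 3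

dilate₃-⊝ : ∀ f → dilate₃ (⊝ f) ≈ ⊝ dilate₃ f
dilate₃-⊝ = subst-⊝ false 3

ψ⁻₁-trisection : ψ⁻₁ ≈ dilate₃ P⁻ ⊕ ⊝ (q · dilate₃ ψ⁻₃)
ψ⁻₁-trisection = ≈-trans (trisection true 1 1≤) (⊕-congˡ (≈-trans (•-neg 1ℤ _) (⊝-cong (1-• _))))

ψ₂-trisection : ψ₂ ≈ dilate₃ P₂ ⊕ q · q · dilate₃ ψ₆
ψ₂-trisection = ≈-trans (trisection false 2 1≤)
  (⊕-cong (dilate₃-cong (≈-sym (bisection 2 1≤))) (≈-trans (1-• _) (·-congʳ X₂)))

relation₀ : P₂ · A₀ ≈ P⁻ ⊕ q · (ψ₆ · A₁)
relation₀ = ≈-trans (θ₄₂η ·η ≈-refl) (≈-trans (eta-+ v _) (≈-trans (·-congˡ lattice⁺) (≈-trans (·-distribˡ _ _ _)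
  (⊕-cong (≈-trans (≈-sym (eta-+ v _)) (≈-sym P⁻η))
    (≈-trans (solve 3 (λ a b c → a :* (b :* c) := b :* (a :* c)) ≈-refl _ _ _)
      (·-congˡ (≈-trans (≈-sym (eta-+ v _)) (≈-sym (ψ₆η ·η ≈-refl)))))))))
  where
  -- The exponents of `P₂ · A₀` minus those on the left of `lattice⁺`; the two terms on its right
  -- then become `P⁻` and `ψ₆ · A₁`.
  v : Vec ℤ 6
  v = + 1 ∷ - + 2 ∷ - + 2 ∷ - + 1 ∷ + 5 ∷ - + 2 ∷ []

relation₁ : P₂ · A₁ ⊕ q · (ψ₆ · A₂) ≈ ψ⁻₃
relation₁ = ≈-trans (⊕-cong (≈-trans (θ₄₂η ·η ≈-refl) (eta-+ v _))
    (≈-trans (·-congˡ (≈-trans (ψ₆η ·η ≈-refl) (eta-+ v _))) (solve 3 (λ a b c → b :* (a :* c) := a :* (b :* c)) ≈-refl _ _ _)))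
  (≈-trans (≈-sym (·-distribˡ _ _ _)) (≈-trans (·-congˡ lattice⁻) (≈-trans (≈-sym (eta-+ v _)) (≈-sym ψ⁻₃η))))
  where
  v : Vec ℤ 6
  v = + 0 ∷ + 0 ∷ + 1 ∷ - + 2 ∷ - + 1 ∷ + 1 ∷ []

relation₂ : P₂ · A₂ ≈ ψ₆ · A₀
relation₂ = ≈-trans (θ₄₂η ·η ≈-refl) (≈-sym (ψ₆η ·η ≈-refl))

A-η : A ≈η (+ 1 ∷ + 0 ∷ + 0 ∷ - + 1 ∷ + 0 ∷ + 0 ∷ [])
A-η = inv-η (≈-trans (pointwise λ n → sym (·-at _ _ n)) (E⁻₁ ·η E⁻₂))

A-trisection : A ≈ combine₃ A₀ (⊝ A₁) (⊝ A₂)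
A-trisection = ≈-trans A-η (≈-sym (≈-trans (≈-trans (·-comm _ _) ψ₂·W) ψ⁻₁η /η ψ₂η))
  where
  open ≈-Reasoning
  a b x y z p r : PS
  a = dilate₃ P₂
  b = dilate₃ ψ₆
  x = dilate₃ A₀
  y = dilate₃ A₁
  z = dilate₃ A₂
  p = dilate₃ P⁻
  r = dilate₃ ψ⁻₃

  dilated₀ : a · x ≈ p ⊕ q · q · q · (b · y)
  dilated₀ = ≈-trans (≈-sym (dilate₃-· _ _)) (≈-trans (dilate₃-cong relation₀) (≈-trans (dilate₃-⊕ _ _)
    (⊕-congˡ (≈-trans (dilate₃-· _ _) (·-cong dilate₃-q (dilate₃-· _ _))))))
  dilated₁ : a · y ⊕ q · q · q · (b · z) ≈ r
  dilated₁ = ≈-trans (≈-sym (≈-trans (dilate₃-⊕ _ _)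
    (⊕-cong (dilate₃-· _ _) (≈-trans (dilate₃-· _ _) (·-cong dilate₃-q (dilate₃-· _ _)))))) (dilate₃-cong relation₁)
  dilated₂ : a · z ≈ b · x
  dilated₂ = ≈-trans (≈-sym (dilate₃-· _ _)) (≈-trans (dilate₃-cong relation₂) (dilate₃-· _ _))

  ψ₂·W : ψ₂ · combine₃ A₀ (⊝ A₁) (⊝ A₂) ≈ ψ⁻₁
  ψ₂·W = begin
    ψ₂ · combine₃ A₀ (⊝ A₁) (⊝ A₂)
      ≈⟨ ·-cong ψ₂-trisection (⊕-cong (⊕-congˡ (·-congˡ (dilate₃-⊝ A₁))) (·-cong X₂ (dilate₃-⊝ A₂))) ⟩
    (a ⊕ q · q · b) · (x ⊕ q · (⊝ y) ⊕ q · q · (⊝ z))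
      -- The product is sorted by powers of q modulo 3, everything else being a series in q³. Each
      -- class is one of the three relations with q replaced by q³; the class of q² cancels because
      -- ψ(-q) has no such part.
      ≈⟨ solve 6 (λ q a b x y z → (a :+ q :* q :* b) :* (x :+ q :* (:- y) :+ q :* q :* (:- z)) :=
           a :* x :+ :- (q :* q :* q :* (b :* y)) :+ :- (q :* (a :* y :+ q :* q :* q :* (b :* z))) :+ q :* q :* (b :* x :+ :- (a :* z)))
           ≈-refl q a b x y z ⟩
    a · x ⊕ ⊝ (q · q · q · (b · y)) ⊕ ⊝ (q · (a · y ⊕ q · q · q · (b · z))) ⊕ q · q · (b · x ⊕ ⊝ (a · z))
      ≈⟨ ⊕-cong (⊕-cong (⊕-congʳ dilated₀) (⊝-cong (·-congˡ dilated₁))) (·-congˡ (⊕-congˡ (⊝-cong dilated₂))) ⟩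
    p ⊕ q · q · q · (b · y) ⊕ ⊝ (q · q · q · (b · y)) ⊕ ⊝ (q · r) ⊕ q · q · (b · x ⊕ ⊝ (b · x))
      ≈⟨ solve 5 (λ q p r u v → p :+ q :* q :* q :* u :+ :- (q :* q :* q :* u) :+ :- (q :* r) :+ q :* q :* (v :+ :- v) := p :+ :- (q :* r))
           ≈-refl q p r (b · y) (b · x) ⟩
    p ⊕ ⊝ (q · r)
      ≈⟨ ψ⁻₁-trisection ⟨
    ψ⁻₁ ∎

-- Trisection of 1/ψ(q²)

-- The product of P₂(q³) + ω² q² ψ₆(q³) over the cube roots of unity ω, with q³ renamed q.
norm : PS
norm = P₂ · P₂ · P₂ ⊕ q · q · (ψ₆ · ψ₆ · ψ₆)

-- A sum of two cubes is not visibly an eta quotient. Multiplied by `A₂` it collapses: `relation₂`,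
-- `relation₀` and `relation₁` in turn reduce it to ψ₆ times a bracket that is a multiple of
-- `lattice⁻`.
norm-η : norm ≈η (+ 0 ∷ - + 4 ∷ + 0 ∷ + 8 ∷ + 1 ∷ - + 2 ∷ [])
norm-η = ≈-trans norm·A₂ (ψ₆η ·η bracket) /η ≈-refl
  where
  open ≈-Reasoning
  v : Vec ℤ 6
  v = + 0 ∷ - + 2 ∷ + 1 ∷ + 2 ∷ + 0 ∷ - + 1 ∷ []

  bracket : P₂ · P⁻ ⊕ q · (ψ₆ · ψ⁻₃) ≈η (+ 0 ∷ - + 2 ∷ + 1 ∷ + 4 ∷ + 0 ∷ - + 1 ∷ [])
  bracket = ≈-trans (⊕-cong (≈-trans (θ₄₂η ·η P⁻η) (eta-+ v _))
      (≈-trans (·-congˡ (≈-trans (ψ₆η ·η ψ⁻₃η) (eta-+ v _))) (solve 3 (λ a b c → b :* (a :* c) := a :* (b :* c)) ≈-refl _ _ _)))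
    (≈-trans (≈-sym (·-distribˡ _ _ _)) (≈-trans (·-congˡ lattice⁻) (≈-sym (eta-+ v _))))

  norm·A₂ : norm · A₂ ≈ ψ₆ · (P₂ · P⁻ ⊕ q · (ψ₆ · ψ⁻₃))
  norm·A₂ = begin
    (P₂ · P₂ · P₂ ⊕ q · q · (ψ₆ · ψ₆ · ψ₆)) · A₂
      ≈⟨ solve 4 (λ q a b z → (a :* a :* a :+ q :* q :* (b :* b :* b)) :* z := a :* a :* (a :* z) :+ q :* q :* (b :* b :* b :* z)) ≈-refl q P₂ ψ₆ A₂ ⟩
    P₂ · P₂ · (P₂ · A₂) ⊕ q · q · (ψ₆ · ψ₆ · ψ₆ · A₂)
      ≈⟨ ⊕-congʳ (·-congˡ relation₂) ⟩
    P₂ · P₂ · (ψ₆ · A₀) ⊕ q · q · (ψ₆ · ψ₆ · ψ₆ · A₂)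
      ≈⟨ ⊕-congʳ (solve 3 (λ a b x → a :* a :* (b :* x) := b :* (a :* (a :* x))) ≈-refl P₂ ψ₆ A₀) ⟩
    ψ₆ · (P₂ · (P₂ · A₀)) ⊕ q · q · (ψ₆ · ψ₆ · ψ₆ · A₂)
      ≈⟨ ⊕-congʳ (·-congˡ (·-congˡ relation₀)) ⟩
    ψ₆ · (P₂ · (P⁻ ⊕ q · (ψ₆ · A₁))) ⊕ q · q · (ψ₆ · ψ₆ · ψ₆ · A₂)
      ≈⟨ solve 6 (λ q a b p y z → b :* (a :* (p :+ q :* (b :* y))) :+ q :* q :* (b :* b :* b :* z) :=
           b :* (a :* p :+ q :* (b :* (a :* y :+ q :* (b :* z))))) ≈-refl q P₂ ψ₆ P⁻ A₁ A₂ ⟩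
    ψ₆ · (P₂ · P⁻ ⊕ q · (ψ₆ · (P₂ · A₁ ⊕ q · (ψ₆ · A₂))))
      ≈⟨ ·-congˡ (⊕-congˡ (·-congˡ (·-congˡ relation₁))) ⟩
    ψ₆ · (P₂ · P⁻ ⊕ q · (ψ₆ · ψ⁻₃)) ∎

C : PS
C = inv norm

-- With a = P₂(q³) and b = q²ψ₆(q³) this is 1/(a + b) = (a² - ab + b²)/(a³ + b³): the denominator is
-- the norm at q³, so every power of q outside q³ sits in the numerator.
1/ψ₂ : PS
1/ψ₂ = dilate₃ C · (dilate₃ P₂ · dilate₃ P₂ ⊕ ⊝ (q · q · (dilate₃ P₂ · dilate₃ ψ₆)) ⊕ q · q · q · q · (dilate₃ ψ₆ · dilate₃ ψ₆))

dilate₃-norm : dilate₃ norm ≈ dilate₃ P₂ · dilate₃ P₂ · dilate₃ P₂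
  ⊕ q · q · q · (q · q · q) · (dilate₃ ψ₆ · dilate₃ ψ₆ · dilate₃ ψ₆)
dilate₃-norm = ≈-trans (dilate₃-⊕ _ _) (⊕-cong (cube P₂)
  (≈-trans (dilate₃-· _ _) (·-cong (≈-trans (dilate₃-· q q) (·-cong dilate₃-q dilate₃-q)) (cube ψ₆))))
  where
  cube : ∀ f → dilate₃ (f · f · f) ≈ dilate₃ f · dilate₃ f · dilate₃ f
  cube f = ≈-trans (dilate₃-· _ _) (·-congʳ (dilate₃-· _ _))

ψ₂·1/ψ₂ : ψ₂ · 1/ψ₂ ≈ one
ψ₂·1/ψ₂ = begin
  ψ₂ · 1/ψ₂
    ≈⟨ ·-congʳ ψ₂-trisection ⟩
  (dilate₃ P₂ ⊕ q · q · dilate₃ ψ₆) · 1/ψ₂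
    ≈⟨ solve 4 (λ q a b c → (a :+ q :* q :* b) :* (c :* (a :* a :+ :- (q :* q :* (a :* b)) :+ q :* q :* q :* q :* (b :* b))) :=
         (a :* a :* a :+ q :* q :* q :* (q :* q :* q) :* (b :* b :* b)) :* c) ≈-refl q _ _ _ ⟩
  (dilate₃ P₂ · dilate₃ P₂ · dilate₃ P₂ ⊕ q · q · q · (q · q · q) · (dilate₃ ψ₆ · dilate₃ ψ₆ · dilate₃ ψ₆)) · dilate₃ C
    ≈⟨ ·-congʳ dilate₃-norm ⟨
  dilate₃ norm · dilate₃ C
    ≈⟨ ≈-trans (≈-sym (dilate₃-· _ _)) (dilate₃-cong (·-inverseʳ (η-monic norm-η))) ⟩
  dilate₃ one
    ≈⟨ subst-one false 3 ⟩
  one ∎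
  where open ≈-Reasoning

ψ⁻₃-dilate : ψ⁻₃ ≈ dilate₃ ψ⁻₁
ψ⁻₃-dilate = ≈-sym (dilate-θ true 3 1≤ 1≤)

ψ₆-dilate : ψ₆ ≈ dilate₃ ψ₂
ψ₆-dilate = ≈-sym (dilate-θ false 3 1≤ 1≤)

-- The right side is a series in q³, so trisecting `A₂` means trisecting 1/ψ₂². The same equation
-- drives the reduction modulo 3.
A₂·ψ₂² : A₂ · (ψ₂ · ψ₂) ≈ ψ⁻₃ · ψ₆
A₂·ψ₂² = ≈-trans (≈-refl ·η (ψ₂η ·η ψ₂η)) (≈-sym (ψ⁻₃η ·η ψ₆η))

K : PS
K = ψ⁻₁ · ψ₂ · (C · C)

-- From (a² - ab + b²)² = a⁴ - 2a³b + 3a²b² - 2ab³ + b⁴ with b carrying q², the powers are q⁰, q²,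
-- q⁴, q⁶, q⁸. Only 3a²b² lies in the class of 1 modulo 3, and q⁴ = q·q³ leaves the extra factor q.
A₂₀ A₂₁ A₂₂ : PS
A₂₀ = K · (P₂ · P₂ · (P₂ · P₂) ⊕ ⊝ ((q · q ⊕ q · q) · (P₂ · ψ₆ · (ψ₆ · ψ₆))))
A₂₁ = (q ⊕ q ⊕ q) · (K · (P₂ · P₂ · (ψ₆ · ψ₆)))
A₂₂ = K · (q · q · (ψ₆ · ψ₆ · (ψ₆ · ψ₆)) ⊕ ⊝ (P₂ · P₂ · (P₂ · ψ₆) ⊕ P₂ · P₂ · (P₂ · ψ₆)))

A₂-trisection : A₂ ≈ combine₃ A₂₀ A₂₁ A₂₂
A₂-trisection = begin
  A₂
    ≈⟨ ≈-trans (·-congˡ (≈-trans (·-cong ψ₂·1/ψ₂ ψ₂·1/ψ₂) (·-identityˡ one))) (·-identityʳ _) ⟨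
  A₂ · (ψ₂ · 1/ψ₂ · (ψ₂ · 1/ψ₂))
    ≈⟨ solve 3 (λ z s r → z :* (s :* r :* (s :* r)) := z :* (s :* s) :* (r :* r)) ≈-refl A₂ ψ₂ 1/ψ₂ ⟩
  A₂ · (ψ₂ · ψ₂) · (1/ψ₂ · 1/ψ₂)
    ≈⟨ ·-congʳ (≈-trans A₂·ψ₂² (≈-trans (·-cong ψ⁻₃-dilate ψ₆-dilate) (≈-sym (dilate₃-· _ _)))) ⟩
  dilate₃ (ψ⁻₁ · ψ₂) · (1/ψ₂ · 1/ψ₂)
    ≈⟨ solve 5 (λ q a b c u → u :* (c :* (a :* a :+ :- (q :* q :* (a :* b)) :+ q :* q :* q :* q :* (b :* b)) :*
           (c :* (a :* a :+ :- (q :* q :* (a :* b)) :+ q :* q :* q :* q :* (b :* b)))) :=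
         u :* (c :* c) :* (a :* a :* (a :* a) :+ :- ((q :* q :* q :* (q :* q :* q) :+ q :* q :* q :* (q :* q :* q)) :* (a :* b :* (b :* b))))
         :+ q :* ((q :* q :* q :+ q :* q :* q :+ q :* q :* q) :* (u :* (c :* c) :* (a :* a :* (b :* b))))
         :+ q :* q :* (u :* (c :* c) :* (q :* q :* q :* (q :* q :* q) :* (b :* b :* (b :* b)) :+ :- (a :* a :* (a :* b) :+ a :* a :* (a :* b)))))
         ≈-refl q a b c (dilate₃ (ψ⁻₁ · ψ₂)) ⟩
  k · (a · a · (a · a) ⊕ ⊝ ((q³ · q³ ⊕ q³ · q³) · (a · b · (b · b))))
    ⊕ q · ((q³ ⊕ q³ ⊕ q³) · (k · (a · a · (b · b))))
    ⊕ q · q · (k · (q³ · q³ · (b · b · (b · b)) ⊕ ⊝ (a · a · (a · b) ⊕ a · a · (a · b))))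
    ≈⟨ ⊕-cong (⊕-cong d₀ (·-congˡ d₁)) (·-cong X₂ d₂) ⟨
  combine₃ A₂₀ A₂₁ A₂₂ ∎
  where
  open ≈-Reasoning
  a b c k q³ : PS
  a  = dilate₃ P₂
  b  = dilate₃ ψ₆
  c  = dilate₃ C
  k  = dilate₃ (ψ⁻₁ · ψ₂) · (c · c)
  q³ = q · q · q

  dk : dilate₃ K ≈ k
  dk = ≈-trans (dilate₃-· _ _) (·-congˡ (dilate₃-· _ _))
  d⁴ : ∀ f g h i → dilate₃ (f · g · (h · i)) ≈ dilate₃ f · dilate₃ g · (dilate₃ h · dilate₃ i)
  d⁴ f g h i = ≈-trans (dilate₃-· _ _) (·-cong (dilate₃-· _ _) (dilate₃-· _ _))
  dq² : dilate₃ (q · q) ≈ q³ · q³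
  dq² = ≈-trans (dilate₃-· q q) (·-cong dilate₃-q dilate₃-q)

  d₀ : dilate₃ A₂₀ ≈
    k · (a · a · (a · a) ⊕ ⊝ ((q³ · q³ ⊕ q³ · q³) · (a · b · (b · b))))
  d₀ = ≈-trans (dilate₃-· _ _) (·-cong dk (≈-trans (dilate₃-⊕ _ _) (⊕-cong (d⁴ P₂ P₂ P₂ P₂) (≈-trans (dilate₃-⊝ _)
    (⊝-cong (≈-trans (dilate₃-· _ _) (·-cong (≈-trans (dilate₃-⊕ _ _) (⊕-cong dq² dq²)) (d⁴ P₂ ψ₆ ψ₆ ψ₆))))))))
  d₁ : dilate₃ A₂₁ ≈ (q³ ⊕ q³ ⊕ q³) · (k · (a · a · (b · b)))
  d₁ = ≈-trans (dilate₃-· _ _) (·-cong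
    (≈-trans (dilate₃-⊕ _ _) (⊕-cong (≈-trans (dilate₃-⊕ q q) (⊕-cong dilate₃-q dilate₃-q)) dilate₃-q))
    (≈-trans (dilate₃-· _ _) (·-cong dk (d⁴ P₂ P₂ ψ₆ ψ₆))))
  d₂ : dilate₃ A₂₂ ≈
    k · (q³ · q³ · (b · b · (b · b)) ⊕ ⊝ (a · a · (a · b) ⊕ a · a · (a · b)))
  d₂ = ≈-trans (dilate₃-· _ _) (·-cong dk (≈-trans (dilate₃-⊕ _ _) (⊕-cong
    (≈-trans (dilate₃-· _ _) (·-cong dq² (d⁴ ψ₆ ψ₆ ψ₆ ψ₆)))
    (≈-trans (dilate₃-⊝ _) (⊝-cong (≈-trans (dilate₃-⊕ _ _) (⊕-cong (d⁴ P₂ P₂ P₂ ψ₆) (d⁴ P₂ P₂ P₂ ψ₆))))))))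

A₂₁-η : A₂₁ ≈ (+ 3) • (q · eta (+ 1 ∷ + 4 ∷ + 0 ∷ - + 11 ∷ + 0 ∷ + 6 ∷ []))
A₂₁-η = begin
  (q ⊕ q ⊕ q) · (K · (P₂ · P₂ · (ψ₆ · ψ₆)))
    ≈⟨ ·-congˡ (ψ⁻₁η ·η ψ₂η ·η (inv-η norm-η ·η inv-η norm-η) ·η (θ₄₂η ·η θ₄₂η ·η (ψ₆η ·η ψ₆η))) ⟩
  (q ⊕ q ⊕ q) · e
    ≈⟨ solve 2 (λ q e → (q :+ q :+ q) :* e := con (+ 3) :* (q :* e)) ≈-refl q e ⟩
  (+ 3) • one · (q · e)
    ≈⟨ ≈-trans (•-· _ _ _) (•-cong refl (·-identityˡ _)) ⟩
  (+ 3) • (q · e) ∎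
  where
  open ≈-Reasoning
  e : PS
  e = eta (+ 1 ∷ + 4 ∷ + 0 ∷ - + 11 ∷ + 0 ∷ + 6 ∷ [])

-- Reduction modulo 3

-- The quotient is kept as data: the quotients of all coefficients are collected into a series in
-- `A₂-mod3`.
Multiple₃ : ℤ → Set
Multiple₃ x = Σ ℤ λ k → x ≡ + 3 *ᶻ k

fermat : ∀ c → Multiple₃ (c *ᶻ c *ᶻ c - c)
fermat (+ n) = natural n
  where
  step : ∀ n k → n *ᶻ n *ᶻ n - n ≡ + 3 *ᶻ k → (1ℤ +ᶻ n) *ᶻ (1ℤ +ᶻ n) *ᶻ (1ℤ +ᶻ n) - (1ℤ +ᶻ n) ≡ + 3 *ᶻ (k +ᶻ n *ᶻ n +ᶻ n)
  step n k p = trans (l₁ n) (trans (cong (_+ᶻ + 3 *ᶻ (n *ᶻ n +ᶻ n)) p) (l₂ n k))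
    where
    l₁ : ∀ n → (1ℤ +ᶻ n) *ᶻ (1ℤ +ᶻ n) *ᶻ (1ℤ +ᶻ n) - (1ℤ +ᶻ n) ≡ n *ᶻ n *ᶻ n - n +ᶻ + 3 *ᶻ (n *ᶻ n +ᶻ n)
    l₁ = ℤ-solver.solve-∀
    l₂ : ∀ n k → + 3 *ᶻ k +ᶻ + 3 *ᶻ (n *ᶻ n +ᶻ n) ≡ + 3 *ᶻ (k +ᶻ n *ᶻ n +ᶻ n)
    l₂ = ℤ-solver.solve-∀
  natural : ∀ n → Multiple₃ (+ n *ᶻ + n *ᶻ + n - + n)
  natural zero    = 0ℤ , refl
  natural (suc n) = let k , p = natural n in k +ᶻ + n *ᶻ + n +ᶻ + n , step (+ n) k p
fermat -[1+ n ] = let k , p = fermat (+ suc n) in - k ,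
  trans (l₁ (+ suc n)) (trans (cong -_ p) (ℤ.neg-distribʳ-* (+ 3) k))
  where
  l₁ : ∀ x → (- x) *ᶻ (- x) *ᶻ (- x) - (- x) ≡ - (x *ᶻ x *ᶻ x - x)
  l₁ = ℤ-solver.solve-∀

head-tail : ∀ f → f ≈ f 0 • one ⊕ q · tail f
head-tail f = ≈-trans (pointwise split) (⊕-congˡ (≈-sym (≈-trans (X-suc-· 0 (tail f)) (shift-cong (≈-trans (·-congʳ X-zero) (·-identityˡ _))))))
  where
  split : ∀ n → f n ≡ (f 0 • one ⊕ shift (tail f)) n
  split zero    = sym (trans (⊕-at _ _ 0) (trans (cong (_+ᶻ 0ℤ) (trans (•-at _ _ 0) (ℤ.*-identityʳ (f 0)))) (ℤ.+-identityʳ (f 0))))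
  split (suc n) = sym (trans (⊕-at _ _ (suc n)) (trans (cong (_+ᶻ f (suc n)) (trans (•-at _ _ (suc n)) (ℤ.*-zeroʳ (f 0)))) (ℤ.+-identityˡ _)))

-- With f = c + qt, the difference f³ - f(q³) is (c³ - c) plus a multiple of 3 plus q³ times the
-- same difference for t. Fermat's little theorem handles c, and `frobenius-at` recurses three
-- degrees down.
frobenius-step : ∀ f → f · f · f ⊕ ⊝ dilate₃ f ≈
  (f 0 *ᶻ f 0 *ᶻ f 0 - f 0) • one
    ⊕ (+ 3) • (f 0 • one · (q · tail f) · (f 0 • one ⊕ q · tail f))
    ⊕ X 3 · (tail f · tail f · tail f ⊕ ⊝ dilate₃ (tail f))
frobenius-step f = begin
  f · f · f ⊕ ⊝ dilate₃ f
    ≈⟨ ⊕-cong (·-cong (·-cong (head-tail f) (head-tail f)) (head-tail f)) (⊝-cong (≈-trans (dilate₃-cong (head-tail f))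
         (≈-trans (dilate₃-⊕ _ _) (⊕-cong (≈-trans (subst-• false 3 _ _) (•-cong refl (subst-one false 3)))
           (≈-trans (dilate₃-· _ _) (·-congʳ dilate₃-q)))))) ⟩
  (u ⊕ q · t) · (u ⊕ q · t) · (u ⊕ q · t) ⊕ ⊝ (u ⊕ q · q · q · dilate₃ t)
    ≈⟨ solve 4 (λ q u t d → (u :+ q :* t) :* (u :+ q :* t) :* (u :+ q :* t) :+ :- (u :+ q :* q :* q :* d) :=
         u :* u :* u :+ :- u :+ con (+ 3) :* (u :* (q :* t) :* (u :+ q :* t)) :+ q :* q :* q :* (t :* t :* t :+ :- d)) ≈-refl q u t (dilate₃ t) ⟩
  u · u · u ⊕ ⊝ u ⊕ (+ 3) • one · (u · (q · t) · (u ⊕ q · t)) ⊕ q · q · q · (t · t · t ⊕ ⊝ dilate₃ t)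
    ≈⟨ ⊕-cong (⊕-cong constants (≈-trans (•-· _ _ _) (•-cong refl (·-identityˡ _)))) (·-congʳ (≈-sym X₃)) ⟩
  (c *ᶻ c *ᶻ c - c) • one ⊕ (+ 3) • (u · (q · t) · (u ⊕ q · t)) ⊕ X 3 · (t · t · t ⊕ ⊝ dilate₃ t) ∎
  where
  open ≈-Reasoning
  c : ℤ
  c = f 0
  t u : PS
  t = tail f
  u = c • one
  constants : u · u · u ⊕ ⊝ u ≈ (c *ᶻ c *ᶻ c - c) • one
  constants = ≈-trans (⊕-cong (≈-trans (·-congʳ (square c c)) (square (c *ᶻ c) c)) (≈-sym (•-neg c one))) (≈-sym (•-+ _ _ one))
    where
    square : ∀ c d → c • one · d • one ≈ (c *ᶻ d) • one
    square c d = ≈-trans (•-· _ _ _) (≈-trans (•-cong refl (·-identityˡ _)) (•-• c d one))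

frobenius-at : ∀ n f → Multiple₃ ((f · f · f ⊕ ⊝ dilate₃ f) n)
frobenius-at n f = conclude (higher n)
  where
  rest : PS
  rest = tail f · tail f · tail f ⊕ ⊝ dilate₃ (tail f)
  m : PS
  m = f 0 • one · (q · tail f) · (f 0 • one ⊕ q · tail f)
  lemma : ∀ a b d e → + 3 *ᶻ a *ᶻ e +ᶻ + 3 *ᶻ b +ᶻ + 3 *ᶻ d ≡ + 3 *ᶻ (a *ᶻ e +ᶻ b +ᶻ d)
  lemma = ℤ-solver.solve-∀
  conclude : Multiple₃ ((X 3 · rest) n) → Multiple₃ ((f · f · f ⊕ ⊝ dilate₃ f) n)
  conclude (k , p) = let j , r = fermat (f 0) in j *ᶻ one n +ᶻ m n +ᶻ k ,
    trans (at (frobenius-step f) n) (trans (⊕-at _ _ n) (trans (cong₂ _+ᶻ_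
      (trans (⊕-at _ _ n) (cong₂ _+ᶻ_ (trans (•-at _ _ n) (cong (_*ᶻ one n) r)) (•-at (+ 3) m n))) p) (lemma j (m n) k (one n))))
  higher : ∀ n → Multiple₃ ((X 3 · rest) n)
  higher 0 = 0ℤ , X-·-low 3 rest (s≤s z≤n)
  higher 1 = 0ℤ , X-·-low 3 rest (s≤s (s≤s z≤n))
  higher 2 = 0ℤ , X-·-low 3 rest (s≤s (s≤s (s≤s z≤n)))
  higher (suc (suc (suc n))) = let k , p = frobenius-at n (tail f) in k , trans (X-·-at 3 rest n) p

-- Multiplying A₂ψ₂² = ψ⁻₃ψ₆ by ψ₂ and replacing ψ₂³ by ψ₆ + 3h leaves a common factor ψ₆ up to a
-- multiple of 3. Its constant term is 1, so dividing by it keeps the coefficients integral.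
A₂-mod3 : Σ PS λ h → A₂ ≈ ψ⁻₃ · ψ₂ ⊕ (+ 3) • h
A₂-mod3 = ⊝ (A₂ · h) · inv ψ₆ , (begin
  A₂
    ≈⟨ ·-identityʳ A₂ ⟨
  A₂ · one
    ≈⟨ ·-congˡ unit ⟨
  A₂ · (ψ₆ · inv ψ₆)
    ≈⟨ solve 4 (λ z s i m → z :* (s :* i) := (z :* (s :+ m) :+ :- (z :* m)) :* i) ≈-refl A₂ ψ₆ (inv ψ₆) ((+ 3) • h) ⟩
  (A₂ · (ψ₆ ⊕ (+ 3) • h) ⊕ ⊝ (A₂ · (+ 3) • h)) · inv ψ₆
    ≈⟨ ·-congʳ (⊕-congʳ (·-congˡ (≈-sym cube))) ⟩
  (A₂ · (ψ₂ · ψ₂ · ψ₂) ⊕ ⊝ (A₂ · (+ 3) • h)) · inv ψ₆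
    ≈⟨ ·-congʳ (⊕-congʳ (≈-trans (≈-sym (·-assoc _ _ _)) (·-congʳ A₂·ψ₂²))) ⟩
  (ψ⁻₃ · ψ₆ · ψ₂ ⊕ ⊝ (A₂ · (+ 3) • h)) · inv ψ₆
    ≈⟨ solve 5 (λ r s t i m → (r :* s :* t :+ :- m) :* i := r :* t :* (s :* i) :+ (:- m) :* i) ≈-refl ψ⁻₃ ψ₆ ψ₂ (inv ψ₆) (A₂ · (+ 3) • h) ⟩
  ψ⁻₃ · ψ₂ · (ψ₆ · inv ψ₆) ⊕ (⊝ (A₂ · (+ 3) • h)) · inv ψ₆
    ≈⟨ ⊕-cong (≈-trans (·-congˡ unit) (·-identityʳ _)) (·-congʳ (⊝-cong (≈-trans (·-• _ _ _) (≈-sym (constant-· (+ 3) _))))) ⟩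
  ψ⁻₃ · ψ₂ ⊕ (⊝ (constant (+ 3) · (A₂ · h))) · inv ψ₆
    ≈⟨ ⊕-congˡ (≈-trans (solve 3 (λ c x i → (:- (c :* x)) :* i := c :* ((:- x) :* i)) ≈-refl (constant (+ 3)) (A₂ · h) (inv ψ₆)) (constant-· (+ 3) _)) ⟩
  ψ⁻₃ · ψ₂ ⊕ (+ 3) • (⊝ (A₂ · h) · inv ψ₆) ∎)
  where
  open ≈-Reasoning
  h : PS
  h n = proj₁ (frobenius-at n ψ₂)
  unit : ψ₆ · inv ψ₆ ≈ one
  unit = ·-inverseʳ (η-monic ψ₆η)
  cube : ψ₂ · ψ₂ · ψ₂ ≈ ψ₆ ⊕ (+ 3) • h
  cube = begin
    ψ₂ · ψ₂ · ψ₂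
      ≈⟨ solve 2 (λ a b → a := b :+ (a :+ :- b)) ≈-refl (ψ₂ · ψ₂ · ψ₂) (dilate₃ ψ₂) ⟩
    dilate₃ ψ₂ ⊕ (ψ₂ · ψ₂ · ψ₂ ⊕ ⊝ dilate₃ ψ₂)
      ≈⟨ ⊕-cong (≈-sym ψ₆-dilate) (pointwise λ n → trans (proj₂ (frobenius-at n ψ₂)) (sym (•-at (+ 3) h n))) ⟩
    ψ₆ ⊕ (+ 3) • h ∎

-- The middle part is 0 because ψ(q²) has no exponents congruent to 1 modulo 3 and ψ(-q³) is a
-- series in q³. This zero is the source of the congruence for A(81n+44).
ψ⁻₃ψ₂-trisection : ψ⁻₃ · ψ₂ ≈ combine₃ (ψ⁻₁ · P₂) 𝟘 (ψ⁻₁ · ψ₆)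
ψ⁻₃ψ₂-trisection = begin
  ψ⁻₃ · ψ₂
    ≈⟨ ·-cong ψ⁻₃-dilate ψ₂-trisection ⟩
  dilate₃ ψ⁻₁ · (dilate₃ P₂ ⊕ q · q · dilate₃ ψ₆)
    ≈⟨ solve 4 (λ q x a b → x :* (a :+ q :* q :* b) := x :* a :+ q :* con 0ℤ :+ q :* q :* (x :* b)) ≈-refl q _ _ _ ⟩
  dilate₃ ψ⁻₁ · dilate₃ P₂ ⊕ q · 𝟘 ⊕ q · q · (dilate₃ ψ⁻₁ · dilate₃ ψ₆)
    ≈⟨ ⊕-cong (⊕-cong (dilate₃-· _ _) (·-congˡ (subst-𝟘 false 3))) (·-cong X₂ (dilate₃-· _ _)) ⟨
  combine₃ (ψ⁻₁ · P₂) 𝟘 (ψ⁻₁ · ψ₆) ∎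
  where open ≈-Reasoning

-- The middle part is again ψ(-q³)ψ(q²), with a minus sign: two trisections return the series they
-- started from, whence the relation between A(3n+2) and A(27n+17).
ψ⁻₁ψ₆-trisection : ψ⁻₁ · ψ₆ ≈ combine₃ (P⁻ · ψ₂) (⊝ (ψ⁻₃ · ψ₂)) 𝟘
ψ⁻₁ψ₆-trisection = begin
  ψ⁻₁ · ψ₆
    ≈⟨ ·-cong ψ⁻₁-trisection ψ₆-dilate ⟩
  (dilate₃ P⁻ ⊕ ⊝ (q · dilate₃ ψ⁻₃)) · dilate₃ ψ₂
    ≈⟨ solve 4 (λ q p r x → (p :+ :- (q :* r)) :* x := p :* x :+ q :* (:- (r :* x)) :+ q :* q :* con 0ℤ) ≈-refl q _ _ _ ⟩
  dilate₃ P⁻ · dilate₃ ψ₂ ⊕ q · (⊝ (dilate₃ ψ⁻₃ · dilate₃ ψ₂)) ⊕ q · q · 𝟘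
    ≈⟨ ⊕-cong (⊕-cong (dilate₃-· _ _) (·-congˡ (≈-trans (dilate₃-⊝ _) (⊝-cong (dilate₃-· _ _))))) (·-cong X₂ (subst-𝟘 false 3)) ⟨
  combine₃ (P⁻ · ψ₂) (⊝ (ψ⁻₃ · ψ₂)) 𝟘 ∎
  where open ≈-Reasoning

-- The quotients of the theorem as eta quotients, and its coefficients

infixl 7 _⊛η_ _⊘η_

_⊛η_ : ∀ {f g v w} → f ≈η v → g ≈η w → f ⊛ g ≈η zipWith _+ᶻ_ v w
_⊛η_ {f} {g} p r = ≈-trans (pointwise λ n → sym (·-at f g n)) (p ·η r)

_⊘η_ : ∀ {f g v w} → f ≈η v → g ≈η w → f ⊘ g ≈η zipWith _+ᶻ_ v (Vec.map -_ w)
p ⊘η r = p ⊛η inv-η r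

pow-η : ∀ {f v} n → f ≈η v → pow f n ≈η Vec.map (+ n *ᶻ_) v
pow-η {f} n p = ≈-trans (pow-^ n) (p ^η n)
  where
  pow-^ : ∀ n → pow f n ≈ f ^ n
  pow-^ zero    = ≈-refl
  pow-^ (suc n) = ≈-trans (pointwise λ k → sym (·-at f (pow f n) k)) (·-congˡ (pow-^ n))

dilate-ψ : ∀ m .{{_ : NonZero m}} → subst false m ψ ≈ θ false (m * 3) (m * 1)
dilate-ψ m = ≈-trans (subst-cong false m ψ-θ) (dilate-θ false m 1≤ 1≤)

alternate-ψ : ∀ m .{{_ : NonZero m}} → subst true m ψ ≈ θ true (m * 3) (m * 1)
alternate-ψ m = ≈-trans (subst-cong true m ψ-θ) (alternate-θ 1 0 m)

alternate-φ : ∀ m .{{_ : NonZero m}} → subst true m φ ≈ θ true (m * 1) (m * 1)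
alternate-φ m = ≈-trans (subst-cong true m φ-θ) (alternate-θ 0 0 m)

A-3n : ∀ n → A (3 * n) ≡ A₀ n
A-3n n = trans (at A-trisection (3 * n)) (combine₃-0 A₀ (⊝ A₁) (⊝ A₂) n)

A-3n+1 : ∀ n → A (3 * n + 1) ≡ - A₁ n
A-3n+1 n = trans (at A-trisection (3 * n + 1)) (trans (combine₃-1 A₀ (⊝ A₁) (⊝ A₂) n) (⊝-at A₁ n))

A-3n+2 : ∀ n → A (3 * n + 2) ≡ - A₂ n
A-3n+2 n = trans (at A-trisection (3 * n + 2)) (trans (combine₃-2 A₀ (⊝ A₁) (⊝ A₂) n) (⊝-at A₂ n))

A-9n+5 : ∀ n → A (9 * n + 5) ≡ - A₂₁ n
A-9n+5 n = trans (cong A (lemma n)) (trans (A-3n+2 (3 * n + 1)) (cong -_ (trans (at A₂-trisection (3 * n + 1)) (combine₃-1 A₂₀ A₂₁ A₂₂ n))))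
  where
  lemma : ∀ n → 9 * n + 5 ≡ 3 * (3 * n + 1) + 2
  lemma = ℕ-solver.solve-∀

private
  V H : PS
  V = ψ⁻₃ · ψ₂
  H = proj₁ A₂-mod3

A₂-at : ∀ n → A₂ n ≡ V n +ᶻ + 3 *ᶻ H n
A₂-at n = trans (at (proj₂ A₂-mod3) n) (trans (⊕-at V _ n) (cong (V n +ᶻ_) (•-at (+ 3) H n)))

V-3n+1 : ∀ n → V (3 * n + 1) ≡ 0ℤ
V-3n+1 n = trans (at ψ⁻₃ψ₂-trisection (3 * n + 1)) (combine₃-1 (ψ⁻₁ · P₂) 𝟘 (ψ⁻₁ · ψ₆) n)

V-9n+5 : ∀ n → V (3 * (3 * n + 1) + 2) ≡ - V n
V-9n+5 n = trans (at ψ⁻₃ψ₂-trisection (3 * (3 * n + 1) + 2)) (trans (combine₃-2 (ψ⁻₁ · P₂) 𝟘 (ψ⁻₁ · ψ₆) (3 * n + 1))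
  (trans (at ψ⁻₁ψ₆-trisection (3 * n + 1)) (trans (combine₃-1 (P⁻ · ψ₂) (⊝ V) 𝟘 n) (⊝-at V n))))

∣-from : ∀ {x} → Multiple₃ x → + 3 ∣ x
∣-from (k , p) = Signed.∣⇒∣ᵤ (Signed.divides k (trans p (ℤ.*-comm (+ 3) k)))

congruence₁ : ∀ n → Multiple₃ (A (3 * n + 2) - (- A (27 * n + 17)))
congruence₁ n = - H n - H N , (begin
  A (3 * n + 2) - (- A (27 * n + 17))
    ≡⟨ cong₂ (λ x y → x - (- y)) (A-3n+2 n) (trans (cong A (lemma n)) (A-3n+2 N)) ⟩
  - A₂ n - (- (- A₂ N))
    ≡⟨ cong₂ (λ x y → - x - (- (- y))) (A₂-at n) (trans (A₂-at N) (cong (_+ᶻ + 3 *ᶻ H N) (V-9n+5 n))) ⟩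
  - (V n +ᶻ + 3 *ᶻ H n) - (- (- (- V n +ᶻ + 3 *ᶻ H N)))
    ≡⟨ cancel (V n) (H n) (H N) ⟩
  + 3 *ᶻ (- H n - H N) ∎)
  where
  open ≡-Reasoning
  N : ℕ
  N = 3 * (3 * n + 1) + 2
  lemma : ∀ n → 27 * n + 17 ≡ 3 * (3 * (3 * n + 1) + 2) + 2
  lemma = ℕ-solver.solve-∀
  cancel : ∀ v h k → - (v +ᶻ + 3 *ᶻ h) - (- (- (- v +ᶻ + 3 *ᶻ k))) ≡ + 3 *ᶻ (- h - k)
  cancel = ℤ-solver.solve-∀

congruence₂ : ∀ n → Multiple₃ (A (81 * n + 44))
congruence₂ n = - H N , (begin
  A (81 * n + 44)                          ≡⟨ trans (cong A (lemma n)) (A-3n+2 N) ⟩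
  - A₂ N                                   ≡⟨ cong -_ (A₂-at N) ⟩
  -- N = 9(3n+1) + 5, so `V-9n+5` descends to the index 3n + 1, where V vanishes.
  - (V N +ᶻ + 3 *ᶻ H N)                    ≡⟨ cong (λ x → - (x +ᶻ + 3 *ᶻ H N)) (V-9n+5 (3 * n + 1)) ⟩
  - (- V (3 * n + 1) +ᶻ + 3 *ᶻ H N)        ≡⟨ cong (λ x → - (- x +ᶻ + 3 *ᶻ H N)) (V-3n+1 n) ⟩
  - (0ℤ +ᶻ + 3 *ᶻ H N)                     ≡⟨ cancel (H N) ⟩
  + 3 *ᶻ - H N ∎)
  where
  open ≡-Reasoning
  N : ℕ
  N = 3 * (3 * (3 * n + 1) + 1) + 2
  lemma : ∀ n → 81 * n + 44 ≡ 3 * (3 * (3 * (3 * n + 1) + 1) + 2) + 2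
  lemma = ℕ-solver.solve-∀
  cancel : ∀ h → - (0ℤ +ᶻ + 3 *ᶻ h) ≡ + 3 *ᶻ - h
  cancel = ℤ-solver.solve-∀

A9-η : ∀ {f} → f ≈η (+ 1 ∷ + 4 ∷ + 0 ∷ - + 11 ∷ + 0 ∷ + 6 ∷ []) → ∀ n → A9 n ≡ scale (- (+ 3)) (qs ⊛ f) n
A9-η {f} p n = trans (value n) (cong (- + 3 *ᶻ_) (trans (at (·-congˡ {q} (≈-sym p)) n) (·-at q f n)))
  where
  e : PS
  e = eta (+ 1 ∷ + 4 ∷ + 0 ∷ - + 11 ∷ + 0 ∷ + 6 ∷ [])
  value : ∀ n → A9 n ≡ - + 3 *ᶻ (q · e) n
  -- The sum over A(9n+5) starts at n = 1, so `A9` is 0 here by definition; on the other side the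
  -- factor q has the same effect.
  value zero    = cong (- + 3 *ᶻ_) (sym (X-·-low 1 e 1≤))
  value (suc n) = trans (A-9n+5 (suc n)) (trans (cong -_ (trans (at A₂₁-η (suc n)) (•-at (+ 3) (q · e) (suc n))))
    (ℤ.neg-distribˡ-* (+ 3) ((q · e) (suc n))))

χ⁻-η : subst true 1 χ ≈η (+ 1 ∷ - + 1 ∷ + 0 ∷ + 0 ∷ + 0 ∷ + 0 ∷ [])
χ⁻-η = σχ₁

ψ₂-η : subst false 2 ψ ≈η (+ 0 ∷ - + 1 ∷ + 0 ∷ + 2 ∷ + 0 ∷ + 0 ∷ [])
ψ₂-η = ≈-trans (dilate-ψ 2) ψ₂η

ψ₃-η : subst false 3 ψ ≈η (+ 0 ∷ + 0 ∷ - + 1 ∷ + 0 ∷ + 2 ∷ + 0 ∷ [])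
ψ₃-η = ≈-trans (dilate-ψ 3) ψ₃η

ψ₆-η : subst false 6 ψ ≈η (+ 0 ∷ + 0 ∷ + 0 ∷ + 0 ∷ - + 1 ∷ + 2 ∷ [])
ψ₆-η = ≈-trans (dilate-ψ 6) ψ₆η

ψ⁻₁-η : subst true 1 ψ ≈η (+ 1 ∷ - + 1 ∷ + 0 ∷ + 1 ∷ + 0 ∷ + 0 ∷ [])
ψ⁻₁-η = ≈-trans (alternate-ψ 1) ψ⁻₁η

ψ⁻₃-η : subst true 3 ψ ≈η (+ 0 ∷ + 0 ∷ + 1 ∷ + 0 ∷ - + 1 ∷ + 1 ∷ [])
ψ⁻₃-η = ≈-trans (alternate-ψ 3) ψ⁻₃η

φ⁻₃-η : subst true 3 φ ≈η (+ 0 ∷ + 0 ∷ + 2 ∷ + 0 ∷ - + 1 ∷ + 0 ∷ [])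
φ⁻₃-η = ≈-trans (alternate-φ 3) φ⁻₃η

A₀-quotient : subst true 1 χ ⊛ subst false 3 ψ ⊛ subst true 3 φ ⊘ (subst true 1 ψ ⊛ subst false 2 ψ) ≈ A₀
A₀-quotient = χ⁻-η ⊛η ψ₃-η ⊛η φ⁻₃-η ⊘η (ψ⁻₁-η ⊛η ψ₂-η)

A₁-quotient : pow (subst false 3 ψ) 2 ⊛ pow (subst true 1 χ) 2 ⊘ (subst true 1 ψ ⊛ subst false 2 ψ) ≈ A₁
A₁-quotient = pow-η 2 ψ₃-η ⊛η pow-η 2 χ⁻-η ⊘η (ψ⁻₁-η ⊛η ψ₂-η)

A₂-quotient : subst true 3 ψ ⊛ subst false 6 ψ ⊘ pow (subst false 2 ψ) 2 ≈ A₂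
A₂-quotient = ψ⁻₃-η ⊛η ψ₆-η ⊘η pow-η 2 ψ₂-η

poch-η₁ : poch 1 1 ≈η (+ 1 ∷ + 0 ∷ + 0 ∷ + 0 ∷ + 0 ∷ + 0 ∷ [])
poch-η₁ = E₁η

poch-η₂ : poch 2 2 ≈η (+ 0 ∷ + 1 ∷ + 0 ∷ + 0 ∷ + 0 ∷ + 0 ∷ [])
poch-η₂ = E₂η

poch-η₄ : poch 4 4 ≈η (+ 0 ∷ + 0 ∷ + 0 ∷ + 1 ∷ + 0 ∷ + 0 ∷ [])
poch-η₄ = E₄η

poch-η₁₂ : poch 12 12 ≈η (+ 0 ∷ + 0 ∷ + 0 ∷ + 0 ∷ + 0 ∷ + 1 ∷ [])
poch-η₁₂ = E₁₂η

A₂₁-quotient : poch 1 1 ⊛ pow (poch 2 2) 4 ⊛ pow (poch 12 12) 6 ⊘ pow (poch 4 4) 11 ≈η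
  (+ 1 ∷ + 4 ∷ + 0 ∷ - + 11 ∷ + 0 ∷ + 6 ∷ [])
A₂₁-quotient = poch-η₁ ⊛η pow-η 4 poch-η₂ ⊛η pow-η 6 poch-η₁₂ ⊘η pow-η 11 poch-η₄

theorem1p4 : (∀ n → A (3 * n)
    ≡ (subst true 1 χ ⊛ subst false 3 ψ ⊛ subst true 3 φ
    ⊘ (subst true 1 ψ ⊛ subst false 2 ψ)) n)
    × (∀ n → A (3 * n + 1)
    ≡ negPS (pow (subst false 3 ψ) 2 ⊛ pow (subst true 1 χ) 2
    ⊘ (subst true 1 ψ ⊛ subst false 2 ψ)) n)
    × (∀ n → A (3 * n + 2)
    ≡ negPS (subst true 3 ψ ⊛ subst false 6 ψ
    ⊘ pow (subst false 2 ψ) 2) n)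
    × (∀ n → A9 n
    ≡ scale (- (+ 3)) (qs ⊛ (poch 1 1 ⊛ pow (poch 2 2) 4 ⊛ pow (poch 12 12) 6
    ⊘ pow (poch 4 4) 11)) n)
    × (∀ n → + 3 ∣ (A (3 * n + 2) - (- A (27 * n + 17))))
    × (∀ n → + 3 ∣ A (81 * n + 44))
theorem1p4 =
  (λ n → trans (A-3n n) (sym (at A₀-quotient n))) ,
  (λ n → trans (A-3n+1 n) (cong -_ (sym (at A₁-quotient n)))) ,
  (λ n → trans (A-3n+2 n) (cong -_ (sym (at A₂-quotient n)))) ,
  A9-η A₂₁-quotient ,
  (λ n → ∣-from (congruence₁ n)) ,
  (λ n → ∣-from (congruence₂ n))
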